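{- Let $M$ be a simple connected binary matroid, and let $e$ and $f$ be distinct elements of $M$. Suppose that every circuit of $M$ containing $\{e,f\}$ is spanning. Then the canonical tree decomposition of $M$ is a path $\mathcal{P}$ every vertex of which is labeled by a circuit of size at least three, by $U_{1,3}$, or by $Z_r\backslash y_r$ for some $r\geq 3$, where the ends of $\mathcal{P}$ are not labeled by $U_{1,3}$.
   Context: All matroids are finite. A circuit $C$ of a matroid $M$ is spanning if $r_M(C)=r(M)$. $U_{k,n}$ denotes the uniform matroid of rank $k$ on $n$ elements. A vertex of a tree decomposition is "labeled by" a matroid $N$ if its label is isomorphic to $N$; "labeled by a circuit" of size $k$ means the label is isomorphic to $U_{k-1,k}$, and "labeled by a cocircuit" means the label is isomorphic to $U_{1,k}$ for some $k$. A path may consist of a single vertex, in which case that vertex is its only end. Spikes. For $r\geq 3$, $Z_r$ is the rank-$r$ binary spike with tip $t$: the binary matroid on $\{x_1,y_1,x_2,y_2,\dots,x_r,y_r,t\}$ represented over $\mathrm{GF}(2)$ by letting $x_1,\dots,x_r$ be the standard basis vectors of $\mathrm{GF}(2)^r$, $t$ the all-ones vector, and $y_i=x_i+t$ (so each $\{x_i,y_i,t\}$ is a triangle). 2-sums. If $M_1$ and $M_2$ are connected matroids, each with at least three elements and with $E(M_1)\cap E(M_2)=\{p\}$, then $M_1\oplus_2 M_2$ is the 2-sum with basepoint $p$: the matroid on $(E(M_1)\cup E(M_2))-\{p\}$ whose circuits are the circuits of $M_1$ avoiding $p$, the circuits of $M_2$ avoiding $p$, and all sets $(C_1\cup C_2)-\{p\}$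 where $C_i$ is a circuit of $M_i$ containing $p$. Tree decompositions. A tree decomposition of a connected matroid $M$ is a tree $\mathcal{T}$ with vertex set $\{M_1,\dots,M_k\}$, where each $M_i$ is a connected matroid (the label of that vertex), and edge set $\{e_1,\dots,e_{k-1}\}$, such that (i) $E(M)=(E(M_1)\cup\dots\cup E(M_k))-\{e_1,\dots,e_{k-1}\}$; (ii) if $M_{j_1}$ and $M_{j_2}$ are joined by an edge $e_i$, then $E(M_{j_1})\cap E(M_{j_2})=\{e_i\}$, and otherwise $E(M_{j_1})\cap E(M_{j_2})=\emptyset$; (iii) $|E(M_i)|\geq 3$ for all $i$ unless $|E(M)|<3$, in which case $k=1$ and $M_1=M$; and (iv) $M$ can be obtained from $\mathcal{T}$ by repeatedly taking an edge $e_i$ with ends $M_{j_1}$ and $M_{j_2}$, contracting $e_i$ from the current tree, and labeling the resulting composite vertex by $M_{j_1}\oplus_2 M_{j_2}$. By a theorem of Cunningham and Edmonds, every connected matroid $M$ has a tree decomposition, unique up to its edge labels, in which every vertex is labeled by a circuit, a cocircuit, or a 3-connected matroid with at least four elements, and no two adjacent vertices are both labeled by circuits or both labeled by cocircuits. This is the canonical tree decomposition of $M$. -}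

module Defs where

open import Algebra.Bundles using (CommutativeRing)
open import Data.Bool.Base using (Bool; true; false; _∧_; _xor_)
import Data.Bool.Properties as Bool
open import Data.Fin.Base
  using (Fin; zero; suc; toℕ; fromℕ; combine; _↑ˡ_; _↑ʳ_; splitAt; punchIn; punchOut; finToFun; funToFin)
open import Data.Fin.Permutation using (Permutation′; _⟨$⟩ʳ_)
open import Data.Fin.Properties
  using (_≟_; any?; all?; pigeonhole; 2↔Bool; finToFun-funToFin; funToFin-finToFin)
import Data.Fin.Properties as Fin
open import Data.Fin.Subset
open import Data.Fin.Subset.Properties
open import Data.List.Base using (List; []; _∷_; map; filter; length; _++_)
open import Data.List.Extrema.Nat using (max)
open import Data.List.Relation.Unary.Unique.Propositional using (Unique)
open import Data.Nat.Base using (ℕ; zero; suc; _+_; _∸_; _^_; _≤_; _<_; z≤n; s≤s)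
import Data.Nat.Properties as ℕ
open import Data.Product.Base using (Σ; ∃; ∃-syntax; _×_; _,_; proj₁; proj₂)
open import Data.Sum.Base using (_⊎_; inj₁; inj₂; [_,_]′)
open import Data.Vec.Base using (Vec; []; _∷_; lookup; tabulate; zipWith; here; there)
open import Data.Vec.Properties
  using ([]=⇒lookup; lookup⇒[]=; lookup-zipWith; lookup∘tabulate; tabulate∘lookup; tabulate-cong;
         ∷-injective; ≡-dec)
open import Function.Base using (_∘_; case_of_)
open import Function.Bundles using (_⇔_; _↔_; mk⇔; Inverse)
open import Relation.Binary.PropositionalEquality
open import Relation.Nullary.Decidable.Core
  using (Dec; yes; no; does; map′; _×-dec_; decidable-stable; ¬?)
open import Relation.Nullary.Negation.Core using (¬_; contradiction)

-- The ground set is an arbitrary subset E of Fin n, so that matroids with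
-- overlapping ground sets can be compared.  Independence is decidable, as it
-- classically is for every finite matroid.

record Matroid (n : ℕ) : Set₁ where
  field
    E       : Subset n
    Indep   : Subset n → Set
    indep?  : ∀ I → Dec (Indep I)
    indep⊆E : ∀ {I} → Indep I → I ⊆ E
    indep-⊥ : Indep ⊥
    indep-⊆ : ∀ {I J} → Indep J → I ⊆ J → Indep I
    augment : ∀ {I J} → Indep I → Indep J → ∣ I ∣ < ∣ J ∣ →
              ∃[ x ] x ∈ J × x ∉ I × Indep (I ∪ ⁅ x ⁆)

open Matroid public using (E; Indep; indep?)

infix 4 _≐_ _≅_

_≐_ : ∀ {n} → Matroid n → Matroid n → Set
M ≐ N = E M ≡ E N × (∀ I → Indep M I ⇔ Indep N I)

Element : ∀ {n} → Matroid n → Set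
Element M = ∃ λ x → x ∈ E M

-- The premise of `preserves` says that Y is the image of X under φ.

record _≅_ {m n} (M : Matroid m) (N : Matroid n) : Set where
  field
    φ         : Element M ↔ Element N
    preserves : ∀ X Y → X ⊆ E M → Y ⊆ E N →
                (∀ x → proj₁ x ∈ X ⇔ proj₁ (Inverse.to φ x) ∈ Y) →
                Indep M X ⇔ Indep N Y

module _ {n} (M : Matroid n) where

  Circuit : Subset n → Set
  Circuit C = C ⊆ E M × ¬ Indep M C × (∀ D → D ⊂ C → Indep M D)

subsets : ∀ n → List (Subset n)
subsets zero    = [] ∷ []
subsets (suc n) = map (outside ∷_) (subsets n) ++ map (inside ∷_) (subsets n)

module _ {n} (M : Matroid n) where

  rank : Subset n → ℕ
  rank X = max 0 (map ∣_∣ (filter (λ I → (I ⊆? X) ×-dec indep? M I) (subsets n)))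

  Spanning : Subset n → Set
  Spanning X = rank X ≡ rank (E M)

  Simple : Set
  Simple = (∀ x → ¬ Circuit M ⁅ x ⁆) × (∀ x y → x ≢ y → ¬ Circuit M (⁅ x ⁆ ∪ ⁅ y ⁆))

  Connected : Set
  Connected = ∀ x y → x ∈ E M → y ∈ E M → x ≢ y → ∃[ C ] Circuit M C × x ∈ C × y ∈ C

  -- r(X) + r(E − X) − r(M) ≤ k − 1, written without subtraction.

  Separation : ℕ → Subset n → Set
  Separation k X = X ⊆ E M × k ≤ ∣ X ∣ × k ≤ ∣ E M ─ X ∣ ×
                   rank X + rank (E M ─ X) < rank (E M) + k

  TutteConnected : ℕ → Set
  TutteConnected j = ∀ k X → 1 ≤ k → k < j → ¬ Separation k X

  ThreeConnected : Set
  ThreeConnected = TutteConnected 3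

delete : ∀ {n} → Matroid n → Fin n → Matroid n
delete M e = record
  { E       = E M - e
  ; Indep   = λ I → Indep M I × e ∉ I
  ; indep?  = λ I → indep? M I ×-dec ¬? (e ∈? I)
  ; indep⊆E = λ { (i , e∉I) x∈I →
                  x∈p∧x≢y⇒x∈p-y (M.indep⊆E i x∈I) λ { refl → e∉I x∈I } }
  ; indep-⊥ = M.indep-⊥ , ∉⊥
  ; indep-⊆ = λ { (j , e∉J) I⊆J → M.indep-⊆ j I⊆J , λ e∈I → e∉J (I⊆J e∈I) }
  ; augment = λ { {I} (i , e∉I) (j , e∉J) lt →
                  let (x , x∈J , x∉I , k) = M.augment i j lt in
                  x , x∈J , x∉I , k ,
                  λ e∈ → [ e∉I , (λ e∈x → e∉J (subst (_∈ _) (sym (x∈⁅y⁆⇒x≡y x e∈x)) x∈J)) ]′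
                         (x∈p∪q⁻ I ⁅ x ⁆ e∈) }
  }
  where module M = Matroid M

∣p∪⁅x⁆∣≤1+∣p∣ : ∀ {n} (p : Subset n) x → ∣ p ∪ ⁅ x ⁆ ∣ ≤ suc ∣ p ∣
∣p∪⁅x⁆∣≤1+∣p∣ (inside  ∷ p) zero rewrite ∪-identityʳ p = ℕ.n≤1+n _
∣p∪⁅x⁆∣≤1+∣p∣ (outside ∷ p) zero rewrite ∪-identityʳ p = ℕ.≤-refl
∣p∪⁅x⁆∣≤1+∣p∣ (inside  ∷ p) (suc x) = s≤s (∣p∪⁅x⁆∣≤1+∣p∣ p x)
∣p∪⁅x⁆∣≤1+∣p∣ (outside ∷ p) (suc x) = ∣p∪⁅x⁆∣≤1+∣p∣ p x

∣p∣<∣q∣⇒q⊈p : ∀ {n} {p q : Subset n} → ∣ p ∣ < ∣ q ∣ → ∃[ x ] x ∈ q × x ∉ p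
∣p∣<∣q∣⇒q⊈p {p = p} {q} lt with any? (λ x → (x ∈? q) ×-dec ¬? (x ∈? p))
... | yes found = found
... | no none = contradiction
  (p⊆q⇒∣p∣≤∣q∣ {p = q} {p} λ {x} x∈q → decidable-stable (x ∈? p) λ x∉p → none (x , x∈q , x∉p))
  (ℕ.<⇒≱ lt)

U : (k n : ℕ) → Matroid n
U k n = record
  { E       = ⊤
  ; Indep   = λ I → ∣ I ∣ ≤ k
  ; indep?  = λ I → ∣ I ∣ ℕ.≤? k
  ; indep⊆E = λ _ → ⊆⊤
  ; indep-⊥ = subst (_≤ k) (sym (∣⊥∣≡0 n)) z≤n
  ; indep-⊆ = λ j I⊆J → ℕ.≤-trans (p⊆q⇒∣p∣≤∣q∣ I⊆J) j
  ; augment = λ {I} {J} _ j lt →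
      let (x , x∈J , x∉I) = ∣p∣<∣q∣⇒q⊈p {p = I} {J} lt in
      x , x∈J , x∉I , ℕ.≤-trans (∣p∪⁅x⁆∣≤1+∣p∣ I x) (ℕ.≤-trans lt j)
  }

-- GF(2) is Bool with addition _xor_ and multiplication _∧_

open CommutativeRing Bool.xor-∧-commutativeRing using (semiring)
open import Algebra.Properties.Semiring.Sum semiring
  using (sum-syntax; sum-cong-≗; sum-replicate-zero; ∑-distrib-+; ∑-comm; *-distribˡ-sum; *-distribʳ-sum)

-- A matrix is given by its columns, which are indexed by Fin n.

Matrix : (r n : ℕ) → Set
Matrix r n = Fin n → Fin r → Bool

-- A subset c of Fin n doubles as a coefficient vector over GF(2).

combination : ∀ {r n} → Matrix r n → Subset n → Fin r → Bool
combination {n = n} A c k = ∑[ i < n ] (lookup c i ∧ A i k)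

LinearlyIndependent : ∀ {r n} → Matrix r n → Subset n → Set
LinearlyIndependent A X = ∀ c → c ⊆ X → (∀ k → combination A c k ≡ false) → c ≡ ⊥

module VectorMatroid {r n} (A : Matrix r n) where

  Dependence : Subset n → Subset n → Set
  Dependence X c = c ⊆ X × (∀ k → combination A c k ≡ false) × c ≢ ⊥

  dependence? : ∀ X c → Dec (Dependence X c)
  dependence? X c = (c ⊆? X) ×-dec all? (λ k → combination A c k Bool.≟ false)
                    ×-dec ¬? (≡-dec Bool._≟_ c ⊥)

  noDependence⇒independent : ∀ {X} → ¬ ∃ (Dependence X) → LinearlyIndependent A X
  noDependence⇒independent none c c⊆X c≡0 =
    decidable-stable (≡-dec Bool._≟_ c ⊥) λ c≢⊥ → none (c , c⊆X , c≡0 , c≢⊥)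

  independent⇒noDependence : ∀ {X} → LinearlyIndependent A X → ¬ ∃ (Dependence X)
  independent⇒noDependence ind (c , c⊆X , c≡0 , c≢⊥) = c≢⊥ (ind c c⊆X c≡0)

  independent? : ∀ X → Dec (LinearlyIndependent A X)
  independent? X = map′ (noDependence⇒independent {X}) (independent⇒noDependence {X})
    (¬? (anySubset? {P = Dependence X} (dependence? X)))

  dependent : ∀ {X} → ¬ LinearlyIndependent A X → ∃ (Dependence X)
  dependent {X} dep = decidable-stable (anySubset? {P = Dependence X} (dependence? X))
    λ none → dep (noDependence⇒independent {X} none)

  infixl 6 _⊕_
  _⊕_ : Subset n → Subset n → Subset n
  _⊕_ = zipWith _xor_

  combination-⊥ : ∀ {n} (A : Matrix r n) k → combination A ⊥ k ≡ false
  combination-⊥ {zero}  A k = refl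
  combination-⊥ {suc n} A k = combination-⊥ (A ∘ suc) k

  combination-⁅⁆ : ∀ {n} (A : Matrix r n) x k → combination A ⁅ x ⁆ k ≡ A x k
  combination-⁅⁆ A zero    k = trans (cong (A zero k xor_) (combination-⊥ (A ∘ suc) k)) (Bool.xor-identityʳ _)
  combination-⁅⁆ A (suc x) k = combination-⁅⁆ (A ∘ suc) x k

  combination-⊕ : ∀ c d k → combination A (c ⊕ d) k ≡ combination A c k xor combination A d k
  combination-⊕ c d k = trans
    (sum-cong-≗ λ i → trans (cong (_∧ A i k) (lookup-zipWith _xor_ i c d))
                            (Bool.∧-distribʳ-xor (A i k) (lookup c i) (lookup d i)))
    (∑-distrib-+ (λ i → lookup c i ∧ A i k) (λ i → lookup d i ∧ A i k))

  ⊕-lookup : ∀ {x} c d → x ∈ c ⊕ d → lookup c x xor lookup d x ≡ true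
  ⊕-lookup {x} c d x∈ = trans (sym (lookup-zipWith _xor_ x c d)) ([]=⇒lookup x∈)

  ⊕-⊆ : ∀ {c d X} → c ⊆ X → d ⊆ X → c ⊕ d ⊆ X
  ⊕-⊆ {c} {d} c⊆X d⊆X {x} x∈ with lookup c x in cx | lookup d x in dx | ⊕-lookup c d x∈
  ... | true  | _    | _ = c⊆X (lookup⇒[]= x c cx)
  ... | false | true | _ = d⊆X (lookup⇒[]= x d dx)

  ⊕≡⊥ : ∀ {n} (c d : Subset n) → zipWith _xor_ c d ≡ ⊥ → c ≡ d
  ⊕≡⊥ []          []          _  = refl
  ⊕≡⊥ (true ∷ c)  (true ∷ d)  eq = cong (true ∷_)  (⊕≡⊥ c d (proj₂ (∷-injective eq)))
  ⊕≡⊥ (false ∷ c) (false ∷ d) eq = cong (false ∷_) (⊕≡⊥ c d (proj₂ (∷-injective eq)))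

  inSpan : ∀ {I} x → LinearlyIndependent A I → ¬ LinearlyIndependent A (I ∪ ⁅ x ⁆) →
           ∃[ g ] g ⊆ I × (∀ k → combination A g k ≡ A x k)
  inSpan {I} x ind dep with dependent dep
  ... | c , c⊆ , c≡0 , c≢⊥ with x ∈? c
  ...   | no x∉c = contradiction (ind c c⊆I c≡0) c≢⊥
    where
    c⊆I : c ⊆ I
    c⊆I z∈c with x∈p∪q⁻ I ⁅ x ⁆ (c⊆ z∈c)
    ... | inj₁ z∈I = z∈I
    ... | inj₂ z∈x with refl ← x∈⁅y⁆⇒x≡y x z∈x = contradiction z∈c x∉c
  ...   | yes x∈c = c ⊕ ⁅ x ⁆ , g⊆I , g≡x
    where
    g≡x : ∀ k → combination A (c ⊕ ⁅ x ⁆) k ≡ A x k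
    g≡x k = trans (combination-⊕ c ⁅ x ⁆ k) (cong₂ _xor_ (c≡0 k) (combination-⁅⁆ A x k))
    g⊆I : c ⊕ ⁅ x ⁆ ⊆ I
    g⊆I {z} z∈g with z ≟ x
    ... | yes refl = case trans (sym (⊕-lookup c ⁅ x ⁆ z∈g))
                       (cong₂ _xor_ ([]=⇒lookup x∈c) ([]=⇒lookup (x∈⁅x⁆ x))) of λ ()
    ... | no z≢x with x∈p∪q⁻ I ⁅ x ⁆ (⊕-⊆ (c⊆) (λ z∈x → q⊆p∪q I ⁅ x ⁆ z∈x) z∈g)
    ...   | inj₁ z∈I = z∈I
    ...   | inj₂ z∈x = contradiction (x∈⁅y⁆⇒x≡y x z∈x) z≢x

  -- |J| > |I| forces two distinct subsets of J to have the same image.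

  spread : ∀ {n} (p : Subset n) → Vec Bool ∣ p ∣ → Subset n
  spread []            v       = []
  spread (outside ∷ p) v       = outside ∷ spread p v
  spread (inside  ∷ p) (b ∷ v) = b ∷ spread p v

  spread-⊆ : ∀ {n} (p : Subset n) v → spread p v ⊆ p
  spread-⊆ (outside ∷ p) v       (there x∈) = there (spread-⊆ p v x∈)
  spread-⊆ (inside  ∷ p) (b ∷ v) here       = here
  spread-⊆ (inside  ∷ p) (b ∷ v) (there x∈) = there (spread-⊆ p v x∈)

  spread-injective : ∀ {n} (p : Subset n) v w → spread p v ≡ spread p w → v ≡ w
  spread-injective []            []      []      eq = refl
  spread-injective (outside ∷ p) v       w       eq = spread-injective p v w (proj₂ (∷-injective eq))
  spread-injective (inside  ∷ p) (b ∷ v) (c ∷ w) eq =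
    cong₂ _∷_ (proj₁ (∷-injective eq)) (spread-injective p v w (proj₂ (∷-injective eq)))

  gather : ∀ {n} (p : Subset n) → Subset n → Vec Bool ∣ p ∣
  gather []            []      = []
  gather (outside ∷ p) (b ∷ q) = gather p q
  gather (inside  ∷ p) (b ∷ q) = b ∷ gather p q

  gather-injective : ∀ {n} (p q s : Subset n) → q ⊆ p → s ⊆ p → gather p q ≡ gather p s → q ≡ s
  gather-injective []            []            []            _   _   _  = refl
  gather-injective (outside ∷ p) (inside ∷ q)  s             q⊆p _   _  = case q⊆p here of λ ()
  gather-injective (outside ∷ p) (outside ∷ q) (inside ∷ s)  _   s⊆p _  = case s⊆p here of λ ()
  gather-injective (outside ∷ p) (outside ∷ q) (outside ∷ s) q⊆p s⊆p eq =
    cong (outside ∷_) (gather-injective p q s (drop-∷-⊆ q⊆p) (drop-∷-⊆ s⊆p) eq)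
  gather-injective (inside  ∷ p) (b ∷ q)       (c ∷ s)       q⊆p s⊆p eq =
    cong₂ _∷_ (proj₁ (∷-injective eq))
      (gather-injective p q s (drop-∷-⊆ q⊆p) (drop-∷-⊆ s⊆p) (proj₂ (∷-injective eq)))

  open Inverse 2↔Bool using (to; from; strictlyInverseˡ; strictlyInverseʳ)

  encode : ∀ {m} → Vec Bool m → Fin (2 ^ m)
  encode v = funToFin (from ∘ lookup v)

  decode : ∀ {m} → Fin (2 ^ m) → Vec Bool m
  decode k = tabulate (to ∘ finToFun k)

  decode-encode : ∀ {m} (v : Vec Bool m) → decode (encode v) ≡ v
  decode-encode v = trans
    (tabulate-cong λ i → trans (cong to (finToFun-funToFin (from ∘ lookup v) i)) (strictlyInverseˡ _))
    (tabulate∘lookup v)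

  funToFin-cong : ∀ {m k} {f g : Fin m → Fin k} → f ≗ g → funToFin f ≡ funToFin g
  funToFin-cong {zero}  f≗g = refl
  funToFin-cong {suc m} f≗g = cong₂ combine (f≗g zero) (funToFin-cong (f≗g ∘ suc))

  encode-decode : ∀ {m} (k : Fin (2 ^ m)) → encode {m} (decode k) ≡ k
  encode-decode {m} k = trans
    (funToFin-cong λ i → trans (cong from (lookup∘tabulate (to ∘ finToFun {2} {m} k) i)) (strictlyInverseʳ _))
    (funToFin-finToFin {m} {2} k)

  collision : ∀ {I J : Subset n} → ∣ I ∣ < ∣ J ∣ → (f : Subset n → Subset n) → (∀ Y → f Y ⊆ I) →
              ∃[ Y ] ∃[ Y′ ] Y ⊆ J × Y′ ⊆ J × Y ≢ Y′ × f Y ≡ f Y′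
  collision {I} {J} lt f f⊆I =
    let (a , b , a<b , eq) = pigeonhole (ℕ.^-monoʳ-< 2 (s≤s (s≤s z≤n)) lt)
                               (encode ∘ gather I ∘ f ∘ spread J ∘ decode)
    in spread J (decode a) , spread J (decode b) , spread-⊆ J _ , spread-⊆ J _
     , (λ same → Fin.<⇒≢ a<b
          (trans (sym (encode-decode {∣ J ∣} a))
            (trans (cong encode (spread-injective J _ _ same)) (encode-decode {∣ J ∣} b))))
     , gather-injective I _ _ (f⊆I _) (f⊆I _)
         (trans (sym (decode-encode _)) (trans (cong decode eq) (decode-encode _)))

  module _ {I J : Subset n} (g : ∀ x → ∃[ c ] c ⊆ I × (x ∈ J → ∀ k → combination A c k ≡ A x k)) where

    substitute : Subset n → Subset n
    substitute Y = tabulate λ i → ∑[ x < n ] (lookup Y x ∧ lookup (proj₁ (g x)) i)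

    substitute-⊆ : ∀ Y → substitute Y ⊆ I
    substitute-⊆ Y {i} i∈ with i ∈? I
    ... | yes i∈I = i∈I
    ... | no  i∉I = case trans (sym ([]=⇒lookup i∈)) (trans (lookup∘tabulate _ i) zeroSum) of λ ()
      where
      vanishes : ∀ x → lookup Y x ∧ lookup (proj₁ (g x)) i ≡ false
      vanishes x with lookup (proj₁ (g x)) i in eq
      ... | false = Bool.∧-zeroʳ _
      ... | true  = contradiction (proj₁ (proj₂ (g x)) (lookup⇒[]= i _ eq)) i∉I
      zeroSum : ∑[ x < n ] (lookup Y x ∧ lookup (proj₁ (g x)) i) ≡ false
      zeroSum = trans (sum-cong-≗ vanishes) (sum-replicate-zero n)

    combination-substitute : ∀ Y → Y ⊆ J → ∀ k → combination A (substitute Y) k ≡ combination A Y k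
    combination-substitute Y Y⊆J k = begin
      ∑[ i < n ] (lookup (substitute Y) i ∧ A i k)
        ≡⟨ sum-cong-≗ (λ i → cong (_∧ A i k) (lookup∘tabulate _ i)) ⟩
      ∑[ i < n ] ((∑[ x < n ] (lookup Y x ∧ h x i)) ∧ A i k)
        ≡⟨ sum-cong-≗ (λ i → *-distribʳ-sum (A i k) (λ x → lookup Y x ∧ h x i)) ⟩
      ∑[ i < n ] ∑[ x < n ] ((lookup Y x ∧ h x i) ∧ A i k)
        ≡⟨ ∑-comm (λ i x → (lookup Y x ∧ h x i) ∧ A i k) ⟩
      ∑[ x < n ] ∑[ i < n ] ((lookup Y x ∧ h x i) ∧ A i k)
        ≡⟨ sum-cong-≗ (λ x → sum-cong-≗ λ i → Bool.∧-assoc (lookup Y x) (h x i) (A i k)) ⟩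
      ∑[ x < n ] ∑[ i < n ] (lookup Y x ∧ (h x i ∧ A i k))
        ≡⟨ sum-cong-≗ (λ x → *-distribˡ-sum (lookup Y x) (λ i → h x i ∧ A i k)) ⟨
      ∑[ x < n ] (lookup Y x ∧ combination A (proj₁ (g x)) k)
        ≡⟨ sum-cong-≗ replace ⟩
      ∑[ x < n ] (lookup Y x ∧ A x k)
        ∎
      where
      open ≡-Reasoning
      h : Fin n → Fin n → Bool
      h x i = lookup (proj₁ (g x)) i
      replace : ∀ x → lookup Y x ∧ combination A (proj₁ (g x)) k ≡ lookup Y x ∧ A x k
      replace x with lookup Y x in eq
      ... | false = refl
      ... | true  = proj₂ (proj₂ (g x)) (Y⊆J (lookup⇒[]= x Y eq)) k

  exchange : ∀ {I J} → LinearlyIndependent A I → LinearlyIndependent A J → ∣ I ∣ < ∣ J ∣ →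
             ∃[ x ] x ∈ J × x ∉ I × LinearlyIndependent A (I ∪ ⁅ x ⁆)
  exchange {I} {J} ind-I ind-J lt
    with any? (λ x → (x ∈? J) ×-dec ¬? (x ∈? I) ×-dec independent? (I ∪ ⁅ x ⁆))
  ... | yes found = found
  ... | no  none  =
    let (Y , Y′ , Y⊆J , Y′⊆J , Y≢Y′ , eq) = collision {I} {J} lt (substitute g) (substitute-⊆ g)
        same k = trans (sym (combination-substitute g Y Y⊆J k))
                   (trans (cong (λ c → combination A c k) eq) (combination-substitute g Y′ Y′⊆J k))
    in contradiction
         (⊕≡⊥ Y Y′ (ind-J (Y ⊕ Y′) (⊕-⊆ Y⊆J Y′⊆J) λ k →
           trans (combination-⊕ Y Y′ k)
             (trans (cong (_xor combination A Y′ k) (same k)) (Bool.xor-same (combination A Y′ k)))))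
         Y≢Y′
    where
    g : ∀ x → ∃[ c ] c ⊆ I × (x ∈ J → ∀ k → combination A c k ≡ A x k)
    g x with x ∈? J | x ∈? I
    ... | no x∉J  | _       = ⊥ , ⊥⊆ , λ x∈J → contradiction x∈J x∉J
    ... | yes x∈J | yes x∈I =
      ⁅ x ⁆ , (λ z∈x → subst (_∈ I) (sym (x∈⁅y⁆⇒x≡y x z∈x)) x∈I) , λ _ → combination-⁅⁆ A x
    ... | yes x∈J | no x∉I  =
      let (c , c⊆I , c≡x) = inSpan x ind-I (λ ind → none (x , x∈J , x∉I , ind)) in c , c⊆I , λ _ → c≡x

vectorMatroid : ∀ {r n} → Matrix r n → Matroid n
vectorMatroid {n = n} A = record
  { E       = ⊤
  ; Indep   = LinearlyIndependent A
  ; indep?  = independent?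
  ; indep⊆E = λ _ → ⊆⊤
  ; indep-⊥ = λ c c⊆⊥ _ → ⊆-antisym c⊆⊥ ⊥⊆
  ; indep-⊆ = λ ind I⊆J c c⊆I → ind c (⊆-trans {i = c} c⊆I I⊆J)
  ; augment = exchange
  }
  where open VectorMatroid A

Binary : ∀ {n} → Matroid n → Set
Binary M = ∃[ r ] ∃[ m ] Σ (Matrix r m) λ A → M ≅ vectorMatroid A

-- Fin (r + (r + 1)) lists x₁,…,x_r, then y₁,…,y_r, then the tip

module _ {r : ℕ} where

  spike-x spike-y : Fin r → Fin (r + (r + 1))
  spike-x i = i ↑ˡ (r + 1)
  spike-y i = r ↑ʳ (i ↑ˡ 1)

  spike-t : Fin (r + (r + 1))
  spike-t = r ↑ʳ (r ↑ʳ zero)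

basisVector : ∀ {r} → Fin r → Fin r → Bool
basisVector i k = does (i ≟ k)

spikeMatrix : ∀ r → Matrix r (r + (r + 1))
spikeMatrix r = [ basisVector
                , [ (λ i k → basisVector i k xor true)
                  , (λ _ _ → true)
                  ]′ ∘ splitAt r
                ]′ ∘ splitAt r

Z : ∀ r → Matroid (r + (r + 1))
Z r = vectorMatroid (spikeMatrix r)

-- The circuits determine the 2-sum, so it is given as a relation.

record IsTwoSum {n} (p : Fin n) (M₁ M₂ N : Matroid n) : Set where
  field
    connected₁ : Connected M₁
    connected₂ : Connected M₂
    size₁      : 3 ≤ ∣ E M₁ ∣
    size₂      : 3 ≤ ∣ E M₂ ∣
    basepoint  : E M₁ ∩ E M₂ ≡ ⁅ p ⁆
    ground     : E N ≡ (E M₁ ∪ E M₂) - p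
    circuits   : ∀ C → Circuit N C ⇔
                   ( (Circuit M₁ C × p ∉ C)
                   ⊎ (Circuit M₂ C × p ∉ C)
                   ⊎ (∃[ C₁ ] ∃[ C₂ ] Circuit M₁ C₁ × p ∈ C₁ × Circuit M₂ C₂ × p ∈ C₂ ×
                        C ≡ (C₁ ∪ C₂) - p))

-- Graphs with suc m vertices labelled by matroids, and with m edges, each of
-- which carries a matroid element

record LabelledGraph (n m : ℕ) : Set₁ where
  field
    label : Fin (suc m) → Matroid n
    edge  : Fin m → Fin n
    ends  : Fin m → Fin (suc m) × Fin (suc m)

  Joins : Fin m → Fin (suc m) → Fin (suc m) → Set
  Joins d u v = ends d ≡ (u , v) ⊎ ends d ≡ (v , u)

  Adjacent : Fin (suc m) → Fin (suc m) → Set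
  Adjacent u v = ∃[ d ] Joins d u v

  data Walk : Fin (suc m) → Fin (suc m) → Set where
    stop : ∀ {u} → Walk u u
    go   : ∀ {u v w} d → Joins d u v → Walk v w → Walk u w

  walkEdges : ∀ {u v} → Walk u v → List (Fin m)
  walkEdges stop       = []
  walkEdges (go d _ w) = d ∷ walkEdges w

  -- The last vertex of the walk is omitted: for a closed walk it repeats the first.

  walkVertices : ∀ {u v} → Walk u v → List (Fin (suc m))
  walkVertices stop           = []
  walkVertices (go {u} _ _ w) = u ∷ walkVertices w

  -- Loops and pairs of parallel edges count as cycles.

  Cycle : ∀ {u} → Walk u u → Set
  Cycle w = 1 ≤ length (walkEdges w) × Unique (walkEdges w) × Unique (walkVertices w)

  record IsTree : Set where
    field
      connected : ∀ u v → Walk u v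
      acyclic   : ∀ {u} (w : Walk u u) → ¬ Cycle w

  record IsPath : Set where
    field
      order       : Permutation′ (suc m)
      consecutive : ∀ i j → Adjacent (order ⟨$⟩ʳ i) (order ⟨$⟩ʳ j) ⇔
                            (toℕ j ≡ suc (toℕ i) ⊎ toℕ i ≡ suc (toℕ j))

    End : Fin (suc m) → Set
    End v = v ≡ order ⟨$⟩ʳ zero ⊎ v ≡ order ⟨$⟩ʳ fromℕ m

-- Vertex v is deleted and u takes its place; the others keep their order.

mergeVertex : ∀ {k} {u v : Fin (suc k)} → u ≢ v → Fin (suc k) → Fin k
mergeVertex {v = v} u≢v w with v ≟ w
... | yes _  = punchOut (u≢v ∘ sym)
... | no v≢w = punchOut v≢w

module Contraction {n m} (T : LabelledGraph n (suc m)) (d : Fin (suc m)) where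

  open LabelledGraph T

  source target : Fin (suc (suc m))
  source = proj₁ (ends d)
  target = proj₂ (ends d)

  mergeLabel : Matroid n → Fin (suc m) → Matroid n
  mergeLabel N w with source ≟ punchIn target w
  ... | yes _ = N
  ... | no _  = label (punchIn target w)

  contract : source ≢ target → Matroid n → LabelledGraph n m
  contract s≢t N = record
    { label = mergeLabel N
    ; edge  = λ c → edge (punchIn d c)
    ; ends  = λ c → mergeVertex s≢t (proj₁ (ends (punchIn d c)))
                  , mergeVertex s≢t (proj₂ (ends (punchIn d c)))
    }

  ComposedBy : Matroid n → Set
  ComposedBy = IsTwoSum (edge d) (label source) (label target)

open Contraction

data ContractsTo {n} : ∀ {m} → LabelledGraph n m → Matroid n → Set₁ where
  done : ∀ {T : LabelledGraph n 0} {M} → LabelledGraph.label T zero ≐ M → ContractsTo T M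
  step : ∀ {m} {T : LabelledGraph n (suc m)} {M N} d (s≢t : source T d ≢ target T d) →
         ComposedBy T d N → ContractsTo (contract T d s≢t N) M → ContractsTo T M

record TreeDecomposition {n} (M : Matroid n) : Set₁ where
  field
    {m}   : ℕ
    graph : LabelledGraph n m

  open LabelledGraph graph public

  field
    isTree         : IsTree
    labelConnected : ∀ v → Connected (label v)
    ground         : ∀ x → x ∈ E M ⇔ ((∃[ v ] x ∈ E (label v)) × (∀ d → x ≢ edge d))
    joined         : ∀ d u v → Joins d u v → E (label u) ∩ E (label v) ≡ ⁅ edge d ⁆
    unjoined       : ∀ u v → u ≢ v → ¬ Adjacent u v → Empty (E (label u) ∩ E (label v))
    large          : 3 ≤ ∣ E M ∣ → ∀ v → 3 ≤ ∣ E (label v) ∣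
    small          : ∣ E M ∣ < 3 → m ≡ 0 × (∀ v → label v ≐ M)
    contracts      : ContractsTo graph M

-- To be used with k ≥ 1 only.

CircuitOfSize : ∀ {n} → ℕ → Matroid n → Set
CircuitOfSize k N = N ≅ U (k ∸ 1) k

IsCircuit : ∀ {n} → Matroid n → Set
IsCircuit N = ∃[ k ] 1 ≤ k × CircuitOfSize k N

IsCocircuit : ∀ {n} → Matroid n → Set
IsCocircuit N = ∃[ k ] 1 ≤ k × N ≅ U 1 k

-- N ≅ Z_r \ y_r with r = suc s, so that y_r is the y of index fromℕ s.

IsSpikeMinusY : ∀ {n} → Matroid n → Set
IsSpikeMinusY N = ∃[ s ] 3 ≤ suc s × N ≅ delete (Z (suc s)) (spike-y (fromℕ s))

record IsCanonical {n} {M : Matroid n} (T : TreeDecomposition M) : Set where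
  open TreeDecomposition T
  field
    labels       : ∀ v → IsCircuit (label v) ⊎ IsCocircuit (label v)
                         ⊎ (ThreeConnected (label v) × 4 ≤ ∣ E (label v) ∣)
    noCircuits   : ∀ u v → Adjacent u v → ¬ (IsCircuit (label u) × IsCircuit (label v))
    noCocircuits : ∀ u v → Adjacent u v → ¬ (IsCocircuit (label u) × IsCocircuit (label v))

{-# OPTIONS --safe #-}

-- Follow the marks a and b, the elements of a label in whose directions e and f
-- lie.  Undoing the 2-sums one at a time, every circuit of a label through a and b
-- spans the label and contains all its virtual elements (those outside E M).
--
-- Let C be such a circuit in a label.  If an element q outside C closed a circuit
-- with an arc of C containing both a and b, then that circuit would span, so the
-- other arc would be a single element parallel to q, although both are elements of
-- the simple matroid M.  Hence every q outside C separates a from b on C, and a ≡ b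
-- forces the label to be a circuit.
--
-- In a 3-connected label, let the trace t q be the arc of q that contains a.  If t q
-- and t q′ are incomparable, then C ⊕ (t q ∪ {q}) ⊕ (t q′ ∪ {q′}) is a circuit through
-- a and b.  It spans, so t q and t q′ differ by exchanging a single element.  Since there
-- are no 2-separations, the traces form an antichain that covers C ─ {b} and has only
-- a in common.  So either all traces are pairs {a, d} or all complements C ─ t q are
-- pairs {b, d}: the label is a spike with tip a or b, and its virtual elements are
-- among a and b.
--
-- So a label that is not a circuit has at most its two marks as virtual elements,
-- and an edge with e and f on the same side would join two circuits.  Each edge
-- therefore separates e from f, and the tree is a path.

module Submission where

open import Defs
open import Algebra.Bundles using (CommutativeRing)
open import Data.Bool.Base using (Bool; true; false; _∧_; _xor_)
import Data.Bool.Properties as Bool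
open import Data.Empty using (⊥-elim) renaming (⊥ to False)
open import Data.Fin.Base
  using (Fin; zero; suc; toℕ; fromℕ; fromℕ<; inject₁; _↑ˡ_; _↑ʳ_; splitAt; punchIn; punchOut)
open import Data.Fin.Permutation using (permutation)
open import Data.Fin.Properties using (_≟_; any?; all?)
import Data.Fin.Properties as Fin
open import Data.Fin.Relation.Unary.Top using (View; view; ‵fromℕ; ‵inject₁; view-fromℕ; view-inject₁)
open import Data.Fin.Subset
open import Data.Fin.Subset.Properties
open import Data.List.Base using (map; filter)
import Data.List.Extrema.Nat as Extrema
open import Data.List.Membership.Propositional using () renaming (_∈_ to _∈ˡ_)
open import Data.List.Membership.Propositional.Properties
  using (∈-map⁺; ∈-map⁻; ∈-++⁺ˡ; ∈-++⁺ʳ; ∈-filter⁺; ∈-filter⁻)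
open import Data.List.Relation.Unary.All using ([]; _∷_)
import Data.List.Relation.Unary.All as All
open import Data.List.Relation.Unary.AllPairs using ([]; _∷_)
import Data.List.Relation.Unary.Any as Any
open import Data.Nat.Base using (ℕ; zero; suc; _+_; _≤_; _<_; z≤n; s≤s; s≤s⁻¹)
import Data.Nat.Properties as ℕ
open import Data.Product.Base using (Σ; ∃; ∃-syntax; _×_; _,_; proj₁; proj₂)
open import Data.Product.Properties using () renaming (≡-dec to ×-≡-dec)
open import Data.Sum.Base using (_⊎_; inj₁; inj₂; [_,_]′)
open import Data.Vec.Base using ([]; _∷_; lookup; tabulate; zipWith; here; there)
open import Data.Vec.Properties
  using ([]=⇒lookup; lookup⇒[]=; lookup-zipWith; lookup∘tabulate; tabulate∘lookup; tabulate-cong; ≡-dec)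
open import Function.Base using (_∘_; case_of_)
open import Function.Bundles using (_⇔_; _↔_; mk⇔; mk↔ₛ′; Inverse; Equivalence)
open import Function.Definitions using (Injective)
open import Relation.Binary.PropositionalEquality
open import Relation.Nullary.Decidable using (dec-true)
open import Relation.Nullary.Decidable.Core
  using (Dec; yes; no; does; map′; _×-dec_; _⊎-dec_; decidable-stable; ¬?)
open import Relation.Nullary.Negation.Core using (¬_; contradiction)

open CommutativeRing Bool.xor-∧-commutativeRing using (semiring)
open import Algebra.Properties.Semiring.Sum semiring using (sum-cong-≗)

-- The labels come without matrices, so what they inherit from `M` is only a `CycleSpace`: a family
-- of sets closed under sums that contains all circuits and whose nonempty members are dependent.
-- For the same reason the hypothesis on ranks is replaced by `Spans`, which speaks of circuits only
-- and therefore splits along a 2-sum. The obstacle is that a label need not be simple: a virtual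
-- element may be parallel to a real one, as in U_{1,3}, and simplicity survives only for pairs of
-- real elements. Hence the invariant `Marked` also demands that circuits through both marks contain
-- every virtual element. Whatever such a circuit misses is then real, and this is what makes
-- simplicity applicable in each exchange argument. The same bookkeeping explains the role of
-- U_{1,3}: in a cocircuit the elements other than the marks are real and parallel to everything, so
-- there is just one of them and both marks are virtual. At the two ends of the path one mark is
-- real.

private variable
  n : ℕ

open Equivalence using () renaming (to to ⇒; from to ⇐)

-- Subsets as vectors over GF(2)

infixl 6 _⊕_
_⊕_ : Subset n → Subset n → Subset n
_⊕_ = zipWith _xor_

_≟ˢ_ : (c d : Subset n) → Dec (c ≡ d)
_≟ˢ_ = ≡-dec Bool._≟_

lookup-⊕ : ∀ (c d : Subset n) x → lookup (c ⊕ d) x ≡ lookup c x xor lookup d x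
lookup-⊕ c d x = lookup-zipWith _xor_ x c d

∈⇒true : ∀ {c : Subset n} {x} → x ∈ c → lookup c x ≡ true
∈⇒true = []=⇒lookup

true⇒∈ : ∀ {c : Subset n} {x} → lookup c x ≡ true → x ∈ c
true⇒∈ {c = c} {x} = lookup⇒[]= x c

∉⇒false : ∀ {c : Subset n} {x} → x ∉ c → lookup c x ≡ false
∉⇒false {c = c} {x} x∉ with lookup c x in eq
... | true  = contradiction (true⇒∈ eq) x∉
... | false = refl

false⇒∉ : ∀ {c : Subset n} {x} → lookup c x ≡ false → x ∉ c
false⇒∉ eq x∈ with () ← trans (sym (∈⇒true x∈)) eq

lookup-injective : ∀ {c d : Subset n} → (∀ x → lookup c x ≡ lookup d x) → c ≡ d
lookup-injective {c = c} {d} eq = trans (sym (tabulate∘lookup c)) (trans (tabulate-cong eq) (tabulate∘lookup d))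

∈⊕⁻ : ∀ (c d : Subset n) {x} → x ∈ c ⊕ d → (x ∈ c × x ∉ d) ⊎ (x ∉ c × x ∈ d)
∈⊕⁻ c d {x} x∈ with lookup c x in cx | lookup d x in dx | trans (sym (lookup-⊕ c d x)) (∈⇒true x∈)
... | true  | false | _ = inj₁ (true⇒∈ cx , false⇒∉ dx)
... | false | true  | _ = inj₂ (false⇒∉ cx , true⇒∈ dx)

∈⊕ˡ : ∀ {c d : Subset n} {x} → x ∈ c → x ∉ d → x ∈ c ⊕ d
∈⊕ˡ {c = c} {d} {x} x∈c x∉d = true⇒∈ (trans (lookup-⊕ c d x) (cong₂ _xor_ (∈⇒true x∈c) (∉⇒false x∉d)))

∈⊕ʳ : ∀ {c d : Subset n} {x} → x ∉ c → x ∈ d → x ∈ c ⊕ d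
∈⊕ʳ {c = c} {d} {x} x∉c x∈d = true⇒∈ (trans (lookup-⊕ c d x) (cong₂ _xor_ (∉⇒false x∉c) (∈⇒true x∈d)))

∉⊕ᵇ : ∀ {c d : Subset n} {x} → x ∈ c → x ∈ d → x ∉ c ⊕ d
∉⊕ᵇ {c = c} {d} {x} x∈c x∈d = false⇒∉ (trans (lookup-⊕ c d x) (cong₂ _xor_ (∈⇒true x∈c) (∈⇒true x∈d)))

∉⊕ⁿ : ∀ {c d : Subset n} {x} → x ∉ c → x ∉ d → x ∉ c ⊕ d
∉⊕ⁿ {c = c} {d} {x} x∉c x∉d = false⇒∉ (trans (lookup-⊕ c d x) (cong₂ _xor_ (∉⇒false x∉c) (∉⇒false x∉d)))

⊕⊆ : ∀ {c d X : Subset n} → c ⊆ X → d ⊆ X → c ⊕ d ⊆ X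
⊕⊆ {c = c} {d} c⊆X d⊆X x∈ = [ c⊆X ∘ proj₁ , d⊆X ∘ proj₂ ]′ (∈⊕⁻ c d x∈)

⊕-comm : ∀ (c d : Subset n) → c ⊕ d ≡ d ⊕ c
⊕-comm c d = lookup-injective λ x → trans (lookup-⊕ c d x) (trans (Bool.xor-comm (lookup c x) _) (sym (lookup-⊕ d c x)))

⊕-assoc : ∀ (b c d : Subset n) → (b ⊕ c) ⊕ d ≡ b ⊕ (c ⊕ d)
⊕-assoc b c d = lookup-injective λ x → begin
  lookup ((b ⊕ c) ⊕ d) x                      ≡⟨ lookup-⊕ (b ⊕ c) d x ⟩
  lookup (b ⊕ c) x xor lookup d x             ≡⟨ cong (_xor lookup d x) (lookup-⊕ b c x) ⟩
  (lookup b x xor lookup c x) xor lookup d x  ≡⟨ Bool.xor-assoc (lookup b x) _ _ ⟩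
  lookup b x xor (lookup c x xor lookup d x)  ≡⟨ cong (lookup b x xor_) (lookup-⊕ c d x) ⟨
  lookup b x xor lookup (c ⊕ d) x             ≡⟨ lookup-⊕ b (c ⊕ d) x ⟨
  lookup (b ⊕ (c ⊕ d)) x                      ∎
  where open ≡-Reasoning

⊕-self : ∀ (c : Subset n) → c ⊕ c ≡ ⊥
⊕-self c = ⊆-antisym (λ x∈ → [ (λ { (a , b) → contradiction a b }) , (λ { (a , b) → contradiction b a }) ]′ (∈⊕⁻ c c x∈)) ⊥⊆

⊕-⊥ʳ : ∀ (c : Subset n) → c ⊕ ⊥ ≡ c
⊕-⊥ʳ c = ⊆-antisym
  (λ x∈ → [ proj₁ , (λ { (_ , x∈⊥) → contradiction x∈⊥ ∉⊥ }) ]′ (∈⊕⁻ c ⊥ x∈)) (λ x∈ → ∈⊕ˡ x∈ ∉⊥)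

⊕-⊥ˡ : ∀ (c : Subset n) → ⊥ ⊕ c ≡ c
⊕-⊥ˡ c = trans (⊕-comm ⊥ c) (⊕-⊥ʳ c)

⊕-cancelʳ : ∀ (c d : Subset n) → (c ⊕ d) ⊕ d ≡ c
⊕-cancelʳ c d = trans (⊕-assoc c d d) (trans (cong (c ⊕_) (⊕-self d)) (⊕-⊥ʳ c))

⊕-move : ∀ {b c d : Subset n} → b ⊕ c ≡ d → b ≡ d ⊕ c
⊕-move {b = b} {c} refl = sym (⊕-cancelʳ b c)

⊕-swapʳ : ∀ (b c d : Subset n) → (b ⊕ c) ⊕ d ≡ (b ⊕ d) ⊕ c
⊕-swapʳ b c d = trans (⊕-assoc b c d) (trans (cong (b ⊕_) (⊕-comm c d)) (sym (⊕-assoc b d c)))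

∈⇒≢⊥ : ∀ {c : Subset n} {x} → x ∈ c → c ≢ ⊥
∈⇒≢⊥ x∈c refl = ∉⊥ x∈c

∈∉⇒≢ : ∀ {c : Subset n} {x y} → x ∈ c → y ∉ c → x ≢ y
∈∉⇒≢ x∈c y∉c refl = y∉c x∈c

≢⊥⇒∈ : ∀ {c : Subset n} → c ≢ ⊥ → ∃[ x ] x ∈ c
≢⊥⇒∈ {c = c} c≢⊥ with nonempty? c
... | yes ne = ne
... | no  e  = contradiction (Empty-unique e) c≢⊥

⊈⇒∃ : ∀ {c d : Subset n} → ¬ c ⊆ d → ∃[ x ] x ∈ c × x ∉ d
⊈⇒∃ {c = c} {d} c⊈d with any? (λ x → (x ∈? c) ×-dec ¬? (x ∈? d))
... | yes found = found
... | no  none  = contradiction (λ {x} x∈c → decidable-stable (x ∈? d) λ x∉d → none (x , x∈c , x∉d)) c⊈d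

⊆∧≢⇒⊂ : ∀ {c d : Subset n} → c ⊆ d → c ≢ d → c ⊂ d
⊆∧≢⇒⊂ c⊆d c≢d = c⊆d , ⊈⇒∃ λ d⊆c → c≢d (⊆-antisym c⊆d d⊆c)

≡⇒∈⁅⁆ : ∀ {x y : Fin n} → x ≡ y → x ∈ ⁅ y ⁆
≡⇒∈⁅⁆ {x = x} refl = x∈⁅x⁆ x

∈-∪⁅⁆⁻ : ∀ (c : Subset n) {x y} → x ∈ c ∪ ⁅ y ⁆ → x ∈ c ⊎ x ≡ y
∈-∪⁅⁆⁻ c {y = y} x∈ with x∈p∪q⁻ c ⁅ y ⁆ x∈
... | inj₁ x∈c = inj₁ x∈c
... | inj₂ x∈y = inj₂ (x∈⁅y⁆⇒x≡y y x∈y)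

∈-∪ˡ : ∀ {c d : Subset n} {x} → x ∈ c → x ∈ c ∪ d
∈-∪ˡ x∈c = x∈p∪q⁺ (inj₁ x∈c)

∈-∪ʳ : ∀ {c d : Subset n} {x} → x ∈ d → x ∈ c ∪ d
∈-∪ʳ x∈d = x∈p∪q⁺ (inj₂ x∈d)

∈-∪⁅⁆ : ∀ {c : Subset n} y → y ∈ c ∪ ⁅ y ⁆
∈-∪⁅⁆ y = ∈-∪ʳ (x∈⁅x⁆ y)

∈-∪⁅⁆-≢ : ∀ {c : Subset n} {x y} → x ∈ c ∪ ⁅ y ⁆ → x ≢ y → x ∈ c
∈-∪⁅⁆-≢ {c = c} x∈ x≢y with ∈-∪⁅⁆⁻ c x∈
... | inj₁ x∈c = x∈c
... | inj₂ x≡y = contradiction x≡y x≢y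

∪⁅⁆⊆ : ∀ {c d : Subset n} {y} → c ⊆ d → y ∈ d → c ∪ ⁅ y ⁆ ⊆ d
∪⁅⁆⊆ {c = c} c⊆d y∈d x∈ with ∈-∪⁅⁆⁻ c x∈
... | inj₁ x∈c  = c⊆d x∈c
... | inj₂ refl = y∈d

∪⁅⁆-mono : ∀ {c d : Subset n} {y} → c ⊆ d → c ∪ ⁅ y ⁆ ⊆ d ∪ ⁅ y ⁆
∪⁅⁆-mono {y = y} c⊆d = ∪⁅⁆⊆ (∈-∪ˡ ∘ c⊆d) (∈-∪⁅⁆ y)

∈-pair⁻ : ∀ {x y z : Fin n} → z ∈ ⁅ x ⁆ ∪ ⁅ y ⁆ → z ≡ x ⊎ z ≡ y
∈-pair⁻ {x = x} z∈ with ∈-∪⁅⁆⁻ ⁅ x ⁆ z∈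
... | inj₁ z∈x = inj₁ (x∈⁅y⁆⇒x≡y x z∈x)
... | inj₂ z≡y = inj₂ z≡y

∈-pairˡ : ∀ {x y : Fin n} → x ∈ ⁅ x ⁆ ∪ ⁅ y ⁆
∈-pairˡ {x = x} = ∈-∪ˡ (x∈⁅x⁆ x)

∈-minus⁻ : ∀ (c : Subset n) {x y} → x ∈ c - y → x ∈ c × x ≢ y
∈-minus⁻ (b ∷ c) {zero}  {zero}  ()
∈-minus⁻ (b ∷ c) {zero}  {suc y} here = here , λ ()
∈-minus⁻ (b ∷ c) {suc x} {zero}  (there x∈) = there (subst (x ∈_) (p─⊥≡p c) x∈) , λ ()
∈-minus⁻ (b ∷ c) {suc x} {suc y} (there x∈) =
  let (x∈c , x≢y) = ∈-minus⁻ c x∈ in there x∈c , x≢y ∘ Fin.suc-injective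

∈-diff⁻ : ∀ (c d : Subset n) {x} → x ∈ c ─ d → x ∈ c × x ∉ d
∈-diff⁻ (b ∷ c) (outside ∷ d) {zero}  here       = here , λ ()
∈-diff⁻ (b ∷ c) (s ∷ d)       {suc x} (there x∈) =
  let (x∈c , x∉d) = ∈-diff⁻ c d x∈ in there x∈c , λ { (there x∈d) → x∉d x∈d }

opaque
  comprehension : ∀ {P : Fin n → Set} → (∀ x → Dec (P x)) → Subset n
  comprehension P? = tabulate (does ∘ P?)

  ∈-comprehension⁺ : ∀ {P : Fin n → Set} (P? : ∀ x → Dec (P x)) {x} → P x → x ∈ comprehension P?
  ∈-comprehension⁺ P? {x} px = true⇒∈ (trans (lookup∘tabulate _ x) (dec-true (P? x) px))

  ∈-comprehension⁻ : ∀ {P : Fin n → Set} (P? : ∀ x → Dec (P x)) {x} → x ∈ comprehension P? → P x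
  ∈-comprehension⁻ P? {x} x∈ with P? x | trans (sym (lookup∘tabulate (does ∘ P?) x)) (∈⇒true x∈)
  ... | yes px | _ = px

enumerate : (p : Subset n) → Fin ∣ p ∣ → Fin n
enumerate (outside ∷ p) i       = suc (enumerate p i)
enumerate (inside  ∷ p) zero    = zero
enumerate (inside  ∷ p) (suc i) = suc (enumerate p i)

enumerate-∈ : ∀ (p : Subset n) i → enumerate p i ∈ p
enumerate-∈ (outside ∷ p) i       = there (enumerate-∈ p i)
enumerate-∈ (inside  ∷ p) zero    = here
enumerate-∈ (inside  ∷ p) (suc i) = there (enumerate-∈ p i)

enumerate-injective : ∀ (p : Subset n) {i j} → enumerate p i ≡ enumerate p j → i ≡ j
enumerate-injective (outside ∷ p)                 eq = enumerate-injective p (Fin.suc-injective eq)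
enumerate-injective (inside  ∷ p) {zero}  {zero}  eq = refl
enumerate-injective (inside  ∷ p) {suc i} {suc j} eq = cong suc (enumerate-injective p (Fin.suc-injective eq))

enumerate-surjective : ∀ (p : Subset n) {x} → x ∈ p → ∃[ i ] enumerate p i ≡ x
enumerate-surjective (outside ∷ p) (there x∈) = let (i , eq) = enumerate-surjective p x∈ in i , cong suc eq
enumerate-surjective (inside  ∷ p) here       = zero , refl
enumerate-surjective (inside  ∷ p) (there x∈) = let (i , eq) = enumerate-surjective p x∈ in suc i , cong suc eq

-- Otherwise choosing preimages under `f` would inject `p` into `Fin k`. The function `f` serves as
-- a list of elements to be avoided.
fresh : ∀ {k} (p : Subset n) (f : Fin k → Fin n) → k < ∣ p ∣ → ∃[ x ] x ∈ p × (∀ i → x ≢ f i)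
fresh {k = k} p f k<p with any? (λ x → (x ∈? p) ×-dec all? (λ i → ¬? (x ≟ f i)))
... | yes found = found
... | no  none  = contradiction (Fin.injective⇒≤ {f = g} g-injective) (ℕ.<⇒≱ k<p)
  where
  hit : ∀ j → ∃[ i ] enumerate p j ≡ f i
  hit j with any? (λ i → enumerate p j ≟ f i)
  ... | yes h = h
  ... | no ¬h = contradiction (enumerate p j , enumerate-∈ p j , λ i eq → ¬h (i , eq)) none
  g : Fin ∣ p ∣ → Fin k
  g = proj₁ ∘ hit
  g-injective : Injective _≡_ _≡_ g
  g-injective {i} {j} eq = enumerate-injective p (trans (proj₂ (hit i)) (trans (cong f eq) (sym (proj₂ (hit j)))))

two≤ : ∀ {p : Subset n} {x y} → x ∈ p → y ∈ p → x ≢ y → 2 ≤ ∣ p ∣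
two≤ {p = p} {x} {y} x∈p y∈p x≢y = ℕ.≤-<-trans
  (ℕ.≤-trans (ℕ.≤-reflexive (sym (∣⁅x⁆∣≡1 x))) (p⊆q⇒∣p∣≤∣q∣ {p = ⁅ x ⁆} {p - y}
    λ z∈x → subst (_∈ p - y) (sym (x∈⁅y⁆⇒x≡y x z∈x)) (x∈p∧x≢y⇒x∈p-y x∈p x≢y)))
  (x∈p⇒∣p-x∣<∣p∣ y∈p)

-- Circuits and rank

∈-subsets : ∀ (X : Subset n) → X ∈ˡ subsets n
∈-subsets []            = Any.here refl
∈-subsets (outside ∷ X) = ∈-++⁺ˡ (∈-map⁺ (outside ∷_) (∈-subsets X))
∈-subsets (inside  ∷ X) = ∈-++⁺ʳ (map (outside ∷_) (subsets _)) (∈-map⁺ (inside ∷_) (∈-subsets X))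

∣∩∣+∣─∣ : ∀ (p q : Subset n) → ∣ p ∩ q ∣ + ∣ p ─ q ∣ ≡ ∣ p ∣
∣∩∣+∣─∣ []            []            = refl
∣∩∣+∣─∣ (outside ∷ p) (outside ∷ q) = ∣∩∣+∣─∣ p q
∣∩∣+∣─∣ (outside ∷ p) (inside ∷ q)  = ∣∩∣+∣─∣ p q
∣∩∣+∣─∣ (inside ∷ p)  (outside ∷ q) = trans (ℕ.+-suc _ _) (cong suc (∣∩∣+∣─∣ p q))
∣∩∣+∣─∣ (inside ∷ p)  (inside ∷ q)  = cong suc (∣∩∣+∣─∣ p q)

module _ (M : Matroid n) where

  open Matroid M using (indep-⊥; indep-⊆; augment)

  circuit≢⊥ : ∀ {C} → Circuit M C → C ≢ ⊥
  circuit≢⊥ (_ , dep , _) refl = dep indep-⊥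

  circuit-⊆ : ∀ {C D} → Circuit M C → Circuit M D → C ⊆ D → C ≡ D
  circuit-⊆ {C} {D} (_ , dep , _) (_ , _ , min) C⊆D =
    decidable-stable (C ≟ˢ D) λ C≢D → dep (min C (⊆∧≢⇒⊂ C⊆D C≢D))

  -- Elements are deleted as long as dependence survives. Once no deletion is possible, every proper
  -- subset lies in an independent `X - x`. The number `k` bounds the size and drives the recursion.
  dependent⇒circuit : ∀ {X} → X ⊆ E M → ¬ Indep M X → ∃[ C ] Circuit M C × C ⊆ X
  dependent⇒circuit {X} X⊆E dep = go ∣ X ∣ X ℕ.≤-refl X⊆E dep
    where
    go : ∀ k X → ∣ X ∣ ≤ k → X ⊆ E M → ¬ Indep M X → ∃[ C ] Circuit M C × C ⊆ X
    go k X size X⊆E dep with any? (λ x → (x ∈? X) ×-dec ¬? (indep? M (X - x)))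
    ... | no none = X , (X⊆E , dep , λ { D (D⊆X , x , x∈X , x∉D) →
            indep-⊆ (decidable-stable (indep? M (X - x)) λ dep′ → none (x , x∈X , dep′))
                    (λ z∈D → x∈p∧x≢y⇒x∈p-y (D⊆X z∈D) λ { refl → x∉D z∈D }) }) , λ x∈ → x∈
    go zero X size X⊆E dep | yes (x , x∈X , dep′) =
      contradiction (ℕ.<-≤-trans (x∈p⇒∣p-x∣<∣p∣ x∈X) size) λ ()
    go (suc k) X size X⊆E dep | yes (x , x∈X , dep′) =
      let (C , circ , C⊆) = go k (X - x) (s≤s⁻¹ (ℕ.<-≤-trans (x∈p⇒∣p-x∣<∣p∣ x∈X) size))
                               (λ z∈ → X⊆E (proj₁ (∈-minus⁻ X z∈))) dep′
      in C , circ , λ z∈ → proj₁ (∈-minus⁻ X (C⊆ z∈))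

  rank-≥ : ∀ {I X} → Indep M I → I ⊆ X → ∣ I ∣ ≤ rank M X
  rank-≥ {I} {X} ind I⊆X = All.lookup (Extrema.xs≤max 0 _)
    (∈-map⁺ ∣_∣ (∈-filter⁺ (λ I → (I ⊆? X) ×-dec indep? M I) (∈-subsets I) (I⊆X , ind)))

  rank-attained : ∀ X → ∃[ I ] Indep M I × I ⊆ X × ∣ I ∣ ≡ rank M X
  rank-attained X with Extrema.argmax-sel (λ k → k) 0 (map ∣_∣ (filter (λ I → (I ⊆? X) ×-dec indep? M I) (subsets n)))
  ... | inj₁ eq = ⊥ , indep-⊥ , ⊥⊆ , trans (∣⊥∣≡0 n) (sym eq)
  ... | inj₂ m∈ with ∈-map⁻ ∣_∣ m∈
  ...   | I , I∈ , eq with ∈-filter⁻ (λ I → (I ⊆? X) ×-dec indep? M I) {xs = subsets n} I∈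
  ...     | _ , I⊆X , ind = I , ind , I⊆X , sym eq

  -- A larger independent subset of `X` would augment `G` by an element of `X`.
  rank-≤ : ∀ {G X} → Indep M G → (∀ {x} → x ∈ X → x ∉ G → ¬ Indep M (G ∪ ⁅ x ⁆)) → rank M X ≤ ∣ G ∣
  rank-≤ {G} {X} indG span with rank-attained X
  ... | I , indI , I⊆X , eq = ℕ.≮⇒≥ λ lt →
    let (x , x∈I , x∉G , ind) = augment indG indI (subst (∣ G ∣ <_) (sym eq) lt)
    in span (I⊆X x∈I) x∉G ind

  -- Spanning without ranks: every element outside closes a circuit with part of `C`. In this form
  -- the property can be cut down to one side of a 2-sum.
  Spans : Subset n → Set
  Spans C = ∀ y → y ∈ E M → y ∉ C → ∃[ D ] Circuit M D × y ∈ D × D ⊆ C ∪ ⁅ y ⁆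

  -- A largest independent subset `I` of `C` has the rank of `M` as its size, so adding `y` makes it
  -- dependent, and a circuit in `I ∪ ⁅ y ⁆` cannot avoid `y`.
  spanning⇒spans : ∀ {C} → C ⊆ E M → Spanning M C → Spans C
  spanning⇒spans {C} C⊆E spanning y y∈E y∉C with rank-attained C
  ... | I , ind , I⊆C , size
      with dependent⇒circuit {I ∪ ⁅ y ⁆} (∪⁅⁆⊆ (C⊆E ∘ I⊆C) y∈E) dependent
    where
    larger : ∣ I ∣ < ∣ I ∪ ⁅ y ⁆ ∣
    larger = p⊂q⇒∣p∣<∣q∣ (p⊆p∪q ⁅ y ⁆ , y , ∈-∪⁅⁆ y , y∉C ∘ I⊆C)
    dependent : ¬ Indep M (I ∪ ⁅ y ⁆)
    dependent ind′ = ℕ.<⇒≱ larger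
      (ℕ.≤-trans (rank-≥ ind′ (∪⁅⁆⊆ (C⊆E ∘ I⊆C) y∈E)) (ℕ.≤-reflexive (trans (sym spanning) (sym size))))
  ... | D , circ@(_ , dep , _) , D⊆ =
    D , circ
      , decidable-stable (y ∈? D) (λ y∉D → dep (indep-⊆ ind λ z∈D → ∈-∪⁅⁆-≢ (D⊆ z∈D) λ { refl → y∉D z∈D }))
      , ∪⁅⁆-mono {y = y} I⊆C ∘ D⊆

  -- A circuit C meeting both sides has rank |C| − 1, so if C ∩ X and C ─ X
  -- span the two sides, then X is a 2-separation.
  circuit-cut : ThreeConnected M → ∀ {C X} → Circuit M C → X ⊆ E M → 2 ≤ ∣ X ∣ → 2 ≤ ∣ E M ─ X ∣ →
    (∃[ a ] a ∈ C × a ∈ X) → (∃[ b ] b ∈ C × b ∉ X) →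
    (∀ {x} → x ∈ X → x ∉ C → ¬ Indep M (C ∩ X ∪ ⁅ x ⁆)) →
    (∀ {x} → x ∈ E M → x ∉ X → x ∉ C → ¬ Indep M ((C ─ X) ∪ ⁅ x ⁆)) → False
  circuit-cut conn {C} {X} (C⊆E , _ , min) X⊆E 2≤X 2≤Y (a , a∈C , a∈X) (b , b∈C , b∉X) spanX spanY =
    conn 2 X (s≤s z≤n) (s≤s (s≤s (s≤s z≤n))) (X⊆E , 2≤X , 2≤Y , bound)
    where
    open ℕ.≤-Reasoning
    rankX : rank M X ≤ ∣ C ∩ X ∣
    rankX = rank-≤ (min (C ∩ X) (p∩q⊆p C X , b , b∈C , b∉X ∘ proj₂ ∘ x∈p∩q⁻ C X))
      λ x∈X x∉ → spanX x∈X λ x∈C → x∉ (x∈p∩q⁺ (x∈C , x∈X))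
    rankY : rank M (E M ─ X) ≤ ∣ C ─ X ∣
    rankY = rank-≤ (min (C ─ X) (p─q⊆p C X , a , a∈C , λ a∈ → proj₂ (∈-diff⁻ C X a∈) a∈X))
      λ x∈ x∉ → let (x∈E , x∉X) = ∈-diff⁻ (E M) X x∈ in
                spanY x∈E x∉X λ x∈C → x∉ (x∈p∧x∉q⇒x∈p─q x∈C x∉X)
    C⊆ : C ⊆ (C - a) ∪ ⁅ a ⁆
    C⊆ {x} x∈C with x ≟ a
    ... | yes refl = ∈-∪⁅⁆ a
    ... | no x≢a   = ∈-∪ˡ (x∈p∧x≢y⇒x∈p-y x∈C x≢a)
    bound : rank M X + rank M (E M ─ X) < rank M (E M) + 2
    bound = begin-strict
      rank M X + rank M (E M ─ X)   ≤⟨ ℕ.+-mono-≤ rankX rankY ⟩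
      ∣ C ∩ X ∣ + ∣ C ─ X ∣         ≡⟨ ∣∩∣+∣─∣ C X ⟩
      ∣ C ∣                         ≤⟨ p⊆q⇒∣p∣≤∣q∣ C⊆ ⟩
      ∣ (C - a) ∪ ⁅ a ⁆ ∣           ≤⟨ ∣p∪⁅x⁆∣≤1+∣p∣ (C - a) a ⟩
      suc ∣ C - a ∣                 ≤⟨ s≤s (rank-≥ (min (C - a) (x∈p⇒p-x⊂p a∈C)) (C⊆E ∘ proj₁ ∘ ∈-minus⁻ C)) ⟩
      suc (rank M (E M))            <⟨ ℕ.n<1+n _ ⟩
      2 + rank M (E M)              ≡⟨ ℕ.+-comm 2 _ ⟩
      rank M (E M) + 2              ∎

  -- a loop would be properly contained in a circuit through a second element
  connected⇒loopless : Connected M → ∀ {x y} → x ∈ E M → y ∈ E M → x ≢ y → ¬ Circuit M ⁅ x ⁆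
  connected⇒loopless conn {x} {y} x∈E y∈E x≢y loop with conn x y x∈E y∈E x≢y
  ... | C , circ , x∈C , y∈C with refl ← circuit-⊆ loop circ
           (λ z∈x → subst (_∈ C) (sym (x∈⁅y⁆⇒x≡y x z∈x)) x∈C) =
    x≢y (sym (x∈⁅y⁆⇒x≡y x y∈C))

-- Cycle spaces of binary matroids

∈-irrelevant : ∀ {c : Subset n} {x} (p q : x ∈ c) → p ≡ q
∈-irrelevant here      here      = refl
∈-irrelevant (there p) (there q) = cong there (∈-irrelevant p q)

-- The trace of representability over GF(2) that the proof relies on. Being free of matrices, it can
-- be handed from a 2-sum to its summands.
record CycleSpace (M : Matroid n) : Set₁ where
  field
    Cycle           : Subset n → Set
    cycle⊆E         : ∀ {c} → Cycle c → c ⊆ E M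
    cycle-⊕         : ∀ {c d} → Cycle c → Cycle d → Cycle (c ⊕ d)
    circuit⇒cycle   : ∀ {C} → Circuit M C → Cycle C
    cycle⇒dependent : ∀ {c} → Cycle c → c ≢ ⊥ → ¬ Indep M c

  cycle⊆circuit : ∀ {c C} → Cycle c → Circuit M C → c ⊆ C → c ≡ ⊥ ⊎ c ≡ C
  cycle⊆circuit {c} {C} cyc (_ , _ , min) c⊆C with c ≟ˢ ⊥ | c ≟ˢ C
  ... | yes c≡⊥ | _       = inj₁ c≡⊥
  ... | no _    | yes c≡C = inj₂ c≡C
  ... | no c≢⊥  | no c≢C  = contradiction (min c (⊆∧≢⇒⊂ c⊆C c≢C)) (cycle⇒dependent cyc c≢⊥)

  -- A dependent proper subset would contain a circuit, which is itself a cycle. This reduces the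
  -- recognition of circuits to linear algebra.
  minimal⇒circuit : ∀ {C} → Cycle C → C ≢ ⊥ → (∀ c → Cycle c → c ⊆ C → c ≡ ⊥ ⊎ c ≡ C) → Circuit M C
  minimal⇒circuit {C} cyc C≢⊥ min = cycle⊆E cyc , cycle⇒dependent cyc C≢⊥ ,
    λ { D (D⊆C , x , x∈C , x∉D) → decidable-stable (indep? M D) λ dep →
      let (C′ , circ , C′⊆D) = dependent⇒circuit M (λ z∈D → cycle⊆E cyc (D⊆C z∈D)) dep
      in [ circuit≢⊥ M circ , (λ C′≡C → x∉D (C′⊆D (subst (x ∈_) (sym C′≡C) x∈C))) ]′
           (min C′ (circuit⇒cycle circ) (λ z∈ → D⊆C (C′⊆D z∈))) }

binary⇒cycleSpace : (M : Matroid n) → Binary M → CycleSpace M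
binary⇒cycleSpace {n} M (r , m , A , iso) = record
  { Cycle           = λ c → c ⊆ E M × (∀ k → combination A (image c) k ≡ false)
  ; cycle⊆E         = proj₁
  ; cycle-⊕         = λ { {c} {d} (c⊆E , c≡0) (d⊆E , d≡0) → ⊕⊆ c⊆E d⊆E , λ k →
                        trans (cong (λ v → combination A v k) (image-⊕ c d))
                          (trans (combination-⊕ (image c) (image d) k) (cong₂ _xor_ (c≡0 k) (d≡0 k))) }
  ; circuit⇒cycle   = λ circ → proj₁ circ , circuit-combination circ
  ; cycle⇒dependent = λ { {c} (c⊆E , c≡0) c≢⊥ ind →
                        let (x , x∈c) = ≢⊥⇒∈ c≢⊥ in
                        ∈⇒≢⊥ (⇒ (image-∈ c (x , c⊆E x∈c)) x∈c)
                          (⇒ (preserves′ c c⊆E) ind (image c) (λ z∈ → z∈) c≡0) }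
  }
  where
  open VectorMatroid A using (dependent; combination-⊕)
  open _≅_ iso
  open Inverse φ using (to; from; strictlyInverseˡ; strictlyInverseʳ)

  element : Fin m → Element (vectorMatroid A)
  element j = j , ∈⊤

  element-proj : ∀ y → element (proj₁ y) ≡ y
  element-proj (j , j∈) = cong (j ,_) (∈-irrelevant ∈⊤ j∈)

  image : Subset n → Subset m
  image c = tabulate λ j → lookup c (proj₁ (from (element j)))

  image-⊕ : ∀ c d → image (c ⊕ d) ≡ image c ⊕ image d
  image-⊕ c d = lookup-injective λ j → trans (lookup∘tabulate _ j) (trans (lookup-⊕ c d _)
    (sym (trans (lookup-⊕ (image c) (image d) j) (cong₂ _xor_ (lookup∘tabulate _ j) (lookup∘tabulate _ j)))))

  image-lookup : ∀ c x → lookup (image c) (proj₁ (to x)) ≡ lookup c (proj₁ x)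
  image-lookup c x = trans (lookup∘tabulate _ (proj₁ (to x)))
    (cong (lookup c ∘ proj₁) (trans (cong from (element-proj (to x))) (strictlyInverseʳ x)))

  image-∈ : ∀ c x → proj₁ x ∈ c ⇔ proj₁ (to x) ∈ image c
  image-∈ c x = mk⇔ (λ x∈ → true⇒∈ (trans (image-lookup c x) (∈⇒true x∈)))
                    (λ x∈ → true⇒∈ (trans (sym (image-lookup c x)) (∈⇒true x∈)))

  preserves′ : ∀ c → c ⊆ E M → Indep M c ⇔ LinearlyIndependent A (image c)
  preserves′ c c⊆E = preserves c (image c) c⊆E ⊆⊤ (image-∈ c)

  -- The isomorphism acts on elements paired with a membership proof, so that proof is part of the
  -- condition; its irrelevance makes the condition decidable.
  inPreimage? : ∀ v x → Dec (Σ (x ∈ E M) λ x∈E → proj₁ (to (x , x∈E)) ∈ v)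
  inPreimage? v x with x ∈? E M
  ... | no x∉E = no (x∉E ∘ proj₁)
  ... | yes x∈E = map′ (x∈E ,_)
    (λ { (x∈E′ , to∈) → subst (λ q → proj₁ (to (x , q)) ∈ v) (∈-irrelevant x∈E′ x∈E) to∈ })
    (proj₁ (to (x , x∈E)) ∈? v)

  preimage : Subset m → Subset n
  preimage v = comprehension (inPreimage? v)

  preimage⊆E : ∀ v → preimage v ⊆ E M
  preimage⊆E v = proj₁ ∘ ∈-comprehension⁻ (inPreimage? v)

  preimage⊆ : ∀ v C → v ⊆ image C → preimage v ⊆ C
  preimage⊆ v C v⊆ x∈ = let (x∈E , to∈) = ∈-comprehension⁻ (inPreimage? v) x∈ in ⇐ (image-∈ C (_ , x∈E)) (v⊆ to∈)

  image-preimage : ∀ v → image (preimage v) ≡ v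
  image-preimage v = ⊆-antisym
    (λ {j} j∈ → let (x∈E , to∈) = ∈-comprehension⁻ (inPreimage? v)
                       (true⇒∈ (trans (sym (lookup∘tabulate _ j)) (∈⇒true j∈)))
                in subst (_∈ v) (cong proj₁ (trans (cong (λ q → to (_ , q)) (∈-irrelevant x∈E _)) (strictlyInverseˡ (element j)))) to∈)
    (λ {j} j∈ → true⇒∈ (trans (lookup∘tabulate _ j) (∈⇒true (∈-comprehension⁺ (inPreimage? v)
                  (proj₂ (from (element j)) , subst (_∈ v) (sym (cong proj₁ (strictlyInverseˡ (element j)))) j∈)))))

  -- The image of `C` carries a nonzero dependence `v`. If `v` pulled back to a proper subset of
  -- `C`, that subset would be independent by minimality, and `v` would vanish.
  circuit-combination : ∀ {C} → Circuit M C → ∀ k → combination A (image C) k ≡ false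
  circuit-combination {C} (C⊆E , dep , min) with dependent {image C} (λ ind → dep (⇐ (preserves′ C C⊆E) ind))
  ... | v , v⊆ , v≡0 , v≢⊥ with preimage v ≟ˢ C
  ...   | yes v≡C = subst (λ w → ∀ k → combination A w k ≡ false) (trans (sym (image-preimage v)) (cong image v≡C)) v≡0
  ...   | no  v≢C = contradiction
    (⇒ (preserves′ (preimage v) (preimage⊆E v)) (min (preimage v) (⊆∧≢⇒⊂ (preimage⊆ v C v⊆) v≢C)) v
       (λ {z} z∈ → subst (z ∈_) (sym (image-preimage v)) z∈) v≡0)
    v≢⊥

-- 2-sums

private
  SumCircuit : Fin n → Matroid n → Matroid n → Subset n → Set
  SumCircuit p M₁ M₂ C = (Circuit M₁ C × p ∉ C) ⊎ (Circuit M₂ C × p ∉ C) ⊎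
    (∃[ C₁ ] ∃[ C₂ ] Circuit M₁ C₁ × p ∈ C₁ × Circuit M₂ C₂ × p ∈ C₂ × C ≡ (C₁ ∪ C₂) - p)

  sumCircuit-sym : ∀ {p : Fin n} {M₁ M₂ C} → SumCircuit p M₁ M₂ C → SumCircuit p M₂ M₁ C
  sumCircuit-sym (inj₁ c₁)        = inj₂ (inj₁ c₁)
  sumCircuit-sym (inj₂ (inj₁ c₂)) = inj₁ c₂
  sumCircuit-sym {p = p} (inj₂ (inj₂ (C₁ , C₂ , circ₁ , p∈₁ , circ₂ , p∈₂ , eq))) =
    inj₂ (inj₂ (C₂ , C₁ , circ₂ , p∈₂ , circ₁ , p∈₁ , trans eq (cong (_- p) (∪-comm C₁ C₂))))

twoSum-sym : ∀ {p : Fin n} {M₁ M₂ N} → IsTwoSum p M₁ M₂ N → IsTwoSum p M₂ M₁ N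
twoSum-sym {p = p} {M₁} {M₂} S = record
  { connected₁ = connected₂ ; connected₂ = connected₁ ; size₁ = size₂ ; size₂ = size₁
  ; basepoint  = trans (∩-comm (E M₂) (E M₁)) basepoint
  ; ground     = trans ground (cong (_- p) (∪-comm (E M₁) (E M₂)))
  ; circuits   = λ C → mk⇔ (sumCircuit-sym {M₁ = M₁} {M₂} {C} ∘ ⇒ (circuits C)) (⇐ (circuits C) ∘ sumCircuit-sym {M₁ = M₂} {M₁} {C})
  }
  where open IsTwoSum S

other : ∀ {X : Subset n} x → 2 ≤ ∣ X ∣ → ∃[ y ] y ∈ X × x ≢ y
other {X = X} x 2≤X = let (y , y∈X , y≢) = fresh {k = 1} X (λ _ → x) 2≤X in y , y∈X , y≢ zero ∘ sym

module TwoSum {p : Fin n} {M₁ M₂ N : Matroid n} (S : IsTwoSum p M₁ M₂ N) where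

  open IsTwoSum S

  p∈E₁ : p ∈ E M₁
  p∈E₁ = proj₁ (x∈p∩q⁻ (E M₁) (E M₂) (subst (p ∈_) (sym basepoint) (x∈⁅x⁆ p)))

  p∈E₂ : p ∈ E M₂
  p∈E₂ = proj₂ (x∈p∩q⁻ (E M₁) (E M₂) (subst (p ∈_) (sym basepoint) (x∈⁅x⁆ p)))

  common : ∀ {x} → x ∈ E M₁ → x ∈ E M₂ → x ≡ p
  common x∈₁ x∈₂ = x∈⁅y⁆⇒x≡y p (subst (_ ∈_) basepoint (x∈p∩q⁺ (x∈₁ , x∈₂)))

  ∈E₁⇒∈E : ∀ {x} → x ∈ E M₁ → x ≢ p → x ∈ E N
  ∈E₁⇒∈E x∈₁ x≢p = subst (_ ∈_) (sym ground) (x∈p∧x≢y⇒x∈p-y (∈-∪ˡ x∈₁) x≢p)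

  ∈E₂⇒∈E : ∀ {x} → x ∈ E M₂ → x ≢ p → x ∈ E N
  ∈E₂⇒∈E x∈₂ x≢p = subst (_ ∈_) (sym ground) (x∈p∧x≢y⇒x∈p-y (∈-∪ʳ x∈₂) x≢p)

  ∈E⁻ : ∀ {x} → x ∈ E N → (x ∈ E M₁ ⊎ x ∈ E M₂) × x ≢ p
  ∈E⁻ x∈E = let (x∈∪ , x≢p) = ∈-minus⁻ (E M₁ ∪ E M₂) (subst (_ ∈_) ground x∈E) in x∈p∪q⁻ (E M₁) (E M₂) x∈∪ , x≢p

  circuit₁⁺ : ∀ {C} → Circuit M₁ C → p ∉ C → Circuit N C
  circuit₁⁺ {C} circ p∉C = ⇐ (circuits C) (inj₁ (circ , p∉C))

  join : Subset n → Subset n → Subset n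
  join C₁ C₂ = (C₁ ∪ C₂) - p

  join⁺ : ∀ {C₁ C₂} → Circuit M₁ C₁ → p ∈ C₁ → Circuit M₂ C₂ → p ∈ C₂ → Circuit N (join C₁ C₂)
  join⁺ {C₁} {C₂} circ₁ p∈₁ circ₂ p∈₂ =
    ⇐ (circuits _) (inj₂ (inj₂ (C₁ , C₂ , circ₁ , p∈₁ , circ₂ , p∈₂ , refl)))

  ∈-joinˡ : ∀ {C₁ C₂ x} → x ∈ C₁ → x ≢ p → x ∈ join C₁ C₂
  ∈-joinˡ x∈ = x∈p∧x≢y⇒x∈p-y (∈-∪ˡ x∈)

  ∈-joinʳ : ∀ {C₁ C₂ x} → x ∈ C₂ → x ≢ p → x ∈ join C₁ C₂
  ∈-joinʳ x∈ = x∈p∧x≢y⇒x∈p-y (∈-∪ʳ x∈)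

  ∈-join⁻ : ∀ C₁ C₂ {x} → x ∈ join C₁ C₂ → (x ∈ C₁ ⊎ x ∈ C₂) × x ≢ p
  ∈-join⁻ C₁ C₂ x∈ = let (x∈∪ , x≢p) = ∈-minus⁻ (C₁ ∪ C₂) x∈ in x∈p∪q⁻ C₁ C₂ x∈∪ , x≢p

  -- The two circuits share `p` and nothing else, so the composition of circuits in a 2-sum is
  -- addition over GF(2).
  join≡⊕ : ∀ {C₁ C₂} → C₁ ⊆ E M₁ → C₂ ⊆ E M₂ → p ∈ C₁ → p ∈ C₂ → join C₁ C₂ ≡ C₁ ⊕ C₂
  join≡⊕ {C₁} {C₂} C₁⊆ C₂⊆ p∈₁ p∈₂ = ⊆-antisym
    (λ x∈ → case ∈-join⁻ C₁ C₂ x∈ of λ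
      { (inj₁ x∈₁ , x≢p) → ∈⊕ˡ x∈₁ λ x∈₂ → x≢p (common (C₁⊆ x∈₁) (C₂⊆ x∈₂))
      ; (inj₂ x∈₂ , x≢p) → ∈⊕ʳ (λ x∈₁ → x≢p (common (C₁⊆ x∈₁) (C₂⊆ x∈₂))) x∈₂ })
    (λ x∈ → case ∈⊕⁻ C₁ C₂ x∈ of λ
      { (inj₁ (x∈₁ , x∉₂)) → ∈-joinˡ x∈₁ λ { refl → x∉₂ p∈₂ }
      ; (inj₂ (x∉₁ , x∈₂)) → ∈-joinʳ x∈₂ λ { refl → x∉₁ p∈₁ } })

  through₂ : ∃[ D ] Circuit M₂ D × p ∈ D
  through₂ = let (y , y∈ , p≢y) = other p (ℕ.≤-trans (ℕ.n≤1+n 2) size₂)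
                 (D , circ , p∈D , _) = connected₂ p y p∈E₂ y∈ p≢y
             in D , circ , p∈D

  loopless₂ : ∀ {x} → x ∈ E M₂ → ¬ Circuit M₂ ⁅ x ⁆
  loopless₂ {x} x∈ = let (y , y∈ , x≢y) = other x (ℕ.≤-trans (ℕ.n≤1+n 2) size₂)
                     in connected⇒loopless M₂ connected₂ x∈ y∈ x≢y

  private
    D₂ : Subset n
    D₂ = proj₁ through₂
    D₂-circuit : Circuit M₂ D₂
    D₂-circuit = proj₁ (proj₂ through₂)
    p∈D₂ : p ∈ D₂
    p∈D₂ = proj₂ (proj₂ through₂)

  second : ∀ {C₂} → Circuit M₂ C₂ → p ∈ C₂ → ∃[ z ] z ∈ C₂ × z ≢ p
  second {C₂} circ p∈ with any? (λ z → (z ∈? C₂) ×-dec ¬? (z ≟ p))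
  ... | yes found = found
  ... | no  none  = contradiction
    (subst (Circuit M₂) (⊆-antisym
      (λ {z} z∈ → subst (_∈ ⁅ p ⁆) (sym (decidable-stable (z ≟ p) λ z≢p → none (z , z∈ , z≢p))) (x∈⁅x⁆ p))
      (λ z∈ → subst (_∈ C₂) (sym (x∈⁅y⁆⇒x≡y p z∈)) p∈)) circ)
    (loopless₂ p∈E₂)

  -- A cycle of M₁ through p is completed to one of N by the fixed path D₂ - p.
  cycleSpace₁ : CycleSpace N → CycleSpace M₁
  cycleSpace₁ cs = record
    { Cycle           = Cycle₁
    ; cycle⊆E         = proj₁
    ; cycle-⊕         = cycle₁-⊕
    ; circuit⇒cycle   = circuit⇒cycle₁
    ; cycle⇒dependent = cycle⇒dependent₁
    }
    where
    open CycleSpace cs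
    Cycle₁ : Subset n → Set
    Cycle₁ c = c ⊆ E M₁ × ((p ∉ c × Cycle c) ⊎ (p ∈ c × Cycle (c ⊕ D₂)))

    cycle₁-⊕ : ∀ {c d} → Cycle₁ c → Cycle₁ d → Cycle₁ (c ⊕ d)
    cycle₁-⊕ {c} {d} (c⊆ , pc) (d⊆ , pd) = ⊕⊆ c⊆ d⊆ , go pc pd
      where
      go : (p ∉ c × Cycle c) ⊎ (p ∈ c × Cycle (c ⊕ D₂)) → (p ∉ d × Cycle d) ⊎ (p ∈ d × Cycle (d ⊕ D₂)) →
           (p ∉ c ⊕ d × Cycle (c ⊕ d)) ⊎ (p ∈ c ⊕ d × Cycle ((c ⊕ d) ⊕ D₂))
      go (inj₁ (p∉c , cc)) (inj₁ (p∉d , cd)) = inj₁ (∉⊕ⁿ p∉c p∉d , cycle-⊕ cc cd)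
      go (inj₁ (p∉c , cc)) (inj₂ (p∈d , cd)) = inj₂ (∈⊕ʳ p∉c p∈d , subst Cycle (sym (⊕-assoc c d D₂)) (cycle-⊕ cc cd))
      go (inj₂ (p∈c , cc)) (inj₁ (p∉d , cd)) = inj₂ (∈⊕ˡ p∈c p∉d , subst Cycle (⊕-swapʳ c D₂ d) (cycle-⊕ cc cd))
      go (inj₂ (p∈c , cc)) (inj₂ (p∈d , cd)) = inj₁ (∉⊕ᵇ p∈c p∈d , subst Cycle eq (cycle-⊕ cc cd))
        where
        eq : (c ⊕ D₂) ⊕ (d ⊕ D₂) ≡ c ⊕ d
        eq = trans (⊕-assoc c D₂ (d ⊕ D₂)) (cong (c ⊕_) (trans (⊕-comm D₂ (d ⊕ D₂)) (⊕-cancelʳ d D₂)))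

    circuit⇒cycle₁ : ∀ {C} → Circuit M₁ C → Cycle₁ C
    circuit⇒cycle₁ {C} circ@(C⊆ , _) with p ∈? C
    ... | no  p∉C = C⊆ , inj₁ (p∉C , circuit⇒cycle (circuit₁⁺ circ p∉C))
    ... | yes p∈C = C⊆ , inj₂ (p∈C , subst Cycle (join≡⊕ C⊆ (proj₁ D₂-circuit) p∈C p∈D₂)
                                       (circuit⇒cycle (join⁺ circ p∈C D₂-circuit p∈D₂)))

    -- Here `c′` stands for `c` or for `c ⊕ D₂`. It contains a circuit of `N`, and each of the three
    -- kinds is impossible: one from `M₁` lies in `c`, one from `M₂` lies in `D₂` without `p`, and
    -- the `M₁` half of a composite one lies in `c`.
    no-circuit : ∀ {c c′} → c ⊆ E M₁ → Indep M₁ c → Cycle c′ → c′ ≢ ⊥ → (∀ {x} → x ∈ c′ → x ≢ p → x ∈ E M₁ → x ∈ c) →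
                 (∀ {x} → x ∈ c′ → x ∈ E M₂ → x ∈ D₂ × x ≢ p) → (∀ {x} → x ∈ c′ → x ∈ E M₂ → p ∈ c) → False
    no-circuit {c} {c′} c⊆ ind cc c≢⊥ in₁ in₂ p∈ with dependent⇒circuit N (cycle⊆E cc) (cycle⇒dependent cc c≢⊥)
    ... | K , circ , K⊆ with ⇒ (circuits K) circ
    ...   | inj₁ (circ₁@(K⊆₁ , dep , _) , p∉K) =
      dep (Matroid.indep-⊆ M₁ ind λ z∈ → in₁ (K⊆ z∈) (λ { refl → p∉K z∈ }) (K⊆₁ z∈))
    ...   | inj₂ (inj₁ (circ₂@(K⊆₂ , dep , _) , p∉K)) =
      p∉K (subst (p ∈_) (sym (circuit-⊆ M₂ circ₂ D₂-circuit λ z∈ → proj₁ (in₂ (K⊆ z∈) (K⊆₂ z∈)))) p∈D₂)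
    ...   | inj₂ (inj₂ (C₁ , C₂ , (C₁⊆ , dep , _) , p∈₁ , circ₂ , p∈₂ , refl)) =
      dep (Matroid.indep-⊆ M₁ ind sub)
      where
      sub : C₁ ⊆ c
      sub {z} z∈ with z ≟ p
      ... | no z≢p = in₁ (K⊆ (∈-joinˡ {C₁} {C₂} z∈ z≢p)) z≢p (C₁⊆ z∈)
      ... | yes refl = let (w , w∈ , w≢p) = second circ₂ p∈₂ in p∈ (K⊆ (∈-joinʳ {C₁} {C₂} w∈ w≢p)) (proj₁ circ₂ w∈)

    cycle⇒dependent₁ : ∀ {c} → Cycle₁ c → c ≢ ⊥ → ¬ Indep M₁ c
    cycle⇒dependent₁ {c} (c⊆ , inj₁ (p∉c , cc)) c≢⊥ ind = no-circuit c⊆ ind cc c≢⊥ (λ x∈ _ _ → x∈)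
      (λ x∈ x∈₂ → contradiction (subst (_∈ c) (common (c⊆ x∈) x∈₂) x∈) p∉c)
      (λ x∈ x∈₂ → subst (_∈ c) (common (c⊆ x∈) x∈₂) x∈)
    cycle⇒dependent₁ {c} (c⊆ , inj₂ (p∈c , cc)) c≢⊥ ind =
      no-circuit c⊆ ind cc
        (let (z , z∈ , z≢p) = second D₂-circuit p∈D₂ in
         ∈⇒≢⊥ (∈⊕ʳ (λ z∈c → z≢p (common (c⊆ z∈c) (D₂⊆ z∈))) z∈))
        (λ x∈ x≢p x∈₁ → case ∈⊕⁻ c D₂ x∈ of λ
          { (inj₁ (x∈c , _)) → x∈c
          ; (inj₂ (_ , x∈D)) → contradiction (common x∈₁ (D₂⊆ x∈D)) x≢p })
        (λ x∈ x∈₂ → case ∈⊕⁻ c D₂ x∈ of λ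
          { (inj₁ (x∈c , x∉D)) → contradiction (subst (_∈ D₂) (sym (common (c⊆ x∈c) x∈₂)) p∈D₂) x∉D
          ; (inj₂ (x∉c , x∈D)) → x∈D , λ { refl → x∉c p∈c } })
        (λ _ _ → p∈c)
      where
      D₂⊆ : D₂ ⊆ E M₂
      D₂⊆ = proj₁ D₂-circuit

-- Labels seen from two marked elements

-- The cycle contains a circuit, which must use both elements as there are no loops. The case
-- `x ≡ y` is allowed and serves to turn a one-element cycle into a loop.
pair-circuit : ∀ {M : Matroid n} (cs : CycleSpace M) → (∀ {x} → x ∈ E M → ¬ Circuit M ⁅ x ⁆) →
  ∀ {c x y} → CycleSpace.Cycle cs c → c ≢ ⊥ → c ⊆ ⁅ x ⁆ ∪ ⁅ y ⁆ → Circuit M (⁅ x ⁆ ∪ ⁅ y ⁆)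
pair-circuit {M = M} cs loopless {c} {x} {y} cyc c≢⊥ c⊆
  with dependent⇒circuit M (CycleSpace.cycle⊆E cs cyc) (CycleSpace.cycle⇒dependent cs cyc c≢⊥)
... | K , circ , K⊆c = subst (Circuit M) (⊆-antisym (λ z∈ → c⊆ (K⊆c z∈)) ⊆K) circ
  where
  not-singleton : ∀ {z} → ¬ (K ⊆ ⁅ z ⁆)
  not-singleton {z} K⊆z with ≢⊥⇒∈ (circuit≢⊥ M circ)
  ... | w , w∈K with refl ← x∈⁅y⁆⇒x≡y z (K⊆z w∈K) =
    loopless (proj₁ circ w∈K) (subst (Circuit M) (⊆-antisym K⊆z
      λ v∈ → subst (_∈ K) (sym (x∈⁅y⁆⇒x≡y z v∈)) w∈K) circ)
  x∈K : x ∈ K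
  x∈K = decidable-stable (x ∈? K) λ x∉K → not-singleton {y} λ {z} z∈ → case ∈-pair⁻ (c⊆ (K⊆c z∈)) of λ
    { (inj₁ refl) → contradiction z∈ x∉K ; (inj₂ refl) → x∈⁅x⁆ z }
  y∈K : y ∈ K
  y∈K = decidable-stable (y ∈? K) λ y∉K → not-singleton {x} λ {z} z∈ → case ∈-pair⁻ (c⊆ (K⊆c z∈)) of λ
    { (inj₁ refl) → x∈⁅x⁆ z ; (inj₂ refl) → contradiction z∈ y∉K }
  ⊆K : ⁅ x ⁆ ∪ ⁅ y ⁆ ⊆ K
  ⊆K z∈ = case ∈-pair⁻ z∈ of λ { (inj₁ refl) → x∈K ; (inj₂ refl) → y∈K }

-- In the application M is a label of the tree, R the ground set of the whole
-- matroid, and a and b are the elements of M leading to e and f.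
record Marked (R : Subset n) (M : Matroid n) (a b : Fin n) : Set₁ where
  field
    cycleSpace : CycleSpace M
    a∈E        : a ∈ E M
    b∈E        : b ∈ E M
    virtual    : ∀ {C} → Circuit M C → a ∈ C → b ∈ C → ∀ {v} → v ∈ E M → v ∉ R → v ∈ C
    spans      : ∀ {C} → Circuit M C → a ∈ C → b ∈ C → Spans M C
    simple     : ∀ {x y} → x ∈ R → y ∈ R → x ≢ y → ¬ Circuit M (⁅ x ⁆ ∪ ⁅ y ⁆)

marked-sym : ∀ {R} {M : Matroid n} {a b} → Marked R M a b → Marked R M b a
marked-sym m = record
  { cycleSpace = cycleSpace ; a∈E = b∈E ; b∈E = a∈E ; simple = simple
  ; virtual    = λ circ b∈ a∈ → virtual circ a∈ b∈
  ; spans      = λ circ b∈ a∈ → spans circ a∈ b∈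
  }
  where open Marked m

marked-≐ : ∀ {R} {M N : Matroid n} {a b} → N ≐ M → Marked R M a b → Marked R N a b
marked-≐ {M = M} {N} (E≡ , indep⇔) m = record
  { cycleSpace = record
    { Cycle           = Cycle
    ; cycle⊆E         = λ cyc x∈ → to∈N (cycle⊆E cyc x∈)
    ; cycle-⊕         = cycle-⊕
    ; circuit⇒cycle   = circuit⇒cycle ∘ to-circuit
    ; cycle⇒dependent = λ cyc c≢⊥ ind → cycle⇒dependent cyc c≢⊥ (⇒ (indep⇔ _) ind)
    }
  ; a∈E     = to∈N a∈E
  ; b∈E     = to∈N b∈E
  ; virtual = λ circ a∈ b∈ v∈ → virtual (to-circuit circ) a∈ b∈ (subst (_ ∈_) E≡ v∈)
  ; spans   = λ circ a∈ b∈ y y∈ y∉ → let (D , circD , rest) = spans (to-circuit circ) a∈ b∈ y (subst (_ ∈_) E≡ y∈) y∉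
                                     in D , from-circuit circD , rest
  ; simple  = λ x∈ y∈ x≢y circ → simple x∈ y∈ x≢y (to-circuit circ)
  }
  where
  open Marked m
  open CycleSpace cycleSpace
  to∈N : ∀ {x} → x ∈ E M → x ∈ E N
  to∈N = subst (_ ∈_) (sym E≡)
  to-circuit : ∀ {C} → Circuit N C → Circuit M C
  to-circuit (C⊆ , dep , min) = (λ x∈ → subst (_ ∈_) E≡ (C⊆ x∈)) , (λ ind → dep (⇐ (indep⇔ _) ind))
    , λ D D⊂ → ⇒ (indep⇔ D) (min D D⊂)
  from-circuit : ∀ {C} → Circuit M C → Circuit N C
  from-circuit (C⊆ , dep , min) = (λ x∈ → to∈N (C⊆ x∈)) , (λ ind → dep (⇒ (indep⇔ _) ind))
    , λ D D⊂ → ⇐ (indep⇔ D) (min D D⊂)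

spanning⇒marked : ∀ (M : Matroid n) {e f} → Simple M → Binary M → e ∈ E M → f ∈ E M →
  (∀ C → Circuit M C → e ∈ C → f ∈ C → Spanning M C) → Marked (E M) M e f
spanning⇒marked M simple binary e∈E f∈E spanning = record
  { cycleSpace = binary⇒cycleSpace M binary
  ; a∈E     = e∈E
  ; b∈E     = f∈E
  ; virtual = λ _ _ _ v∈ v∉ → contradiction v∈ v∉
  ; spans   = λ circ e∈ f∈ → spanning⇒spans M (proj₁ circ) (spanning _ circ e∈ f∈)
  ; simple  = λ _ _ x≢y → proj₂ simple _ _ x≢y
  }

module TwoSumMarked {p : Fin n} {M₁ M₂ N : Matroid n} (S : IsTwoSum p M₁ M₂ N)
                    {R : Subset n} (p∉R : p ∉ R) {a b : Fin n} (m : Marked R N a b) where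

  open IsTwoSum S
  open TwoSum S
  open Marked m
  private
    module Sym = TwoSum (twoSum-sym S)

  -- The circuit that `y` closes with `C` meets the side of `M₂` in `y` alone. It is not the loop
  -- `y`, so it is composite, and its `M₂` half consists of `p` and `y`.
  spanned⇒parallel : ∀ {C y} → Circuit M₁ C → Spans N C → y ∈ E M₂ → y ≢ p → Circuit M₂ (⁅ p ⁆ ∪ ⁅ y ⁆)
  spanned⇒parallel {C} {y} (C⊆ , _) sp y∈₂ y≢p with sp y (∈E₂⇒∈E y∈₂ y≢p) (λ y∈C → y≢p (common (C⊆ y∈C) y∈₂))
  ... | D , circ , y∈D , D⊆ with ⇒ (circuits D) circ
  ...   | inj₁ ((D⊆₁ , _) , _) = contradiction (common (D⊆₁ y∈D) y∈₂) y≢p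
  ...   | inj₂ (inj₁ (circ₂@(D⊆₂ , _) , p∉D)) = contradiction
    (subst (Circuit M₂) (⊆-antisym
      (λ {z} z∈ → case ∈-∪⁅⁆⁻ C (D⊆ z∈) of λ
        { (inj₁ z∈C)  → contradiction (subst (_∈ D) (common (C⊆ z∈C) (D⊆₂ z∈)) z∈) p∉D
        ; (inj₂ refl) → x∈⁅x⁆ z })
      (λ z∈ → subst (_∈ D) (sym (x∈⁅y⁆⇒x≡y y z∈)) y∈D)) circ₂)
    (loopless₂ y∈₂)
  ...   | inj₂ (inj₂ (C₁ , C₂ , (C₁⊆ , _) , p∈₁ , circ₂@(C₂⊆ , _) , p∈₂ , refl)) =
    subst (Circuit M₂) (⊆-antisym sub sup) circ₂
    where
    sub : C₂ ⊆ ⁅ p ⁆ ∪ ⁅ y ⁆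
    sub {z} z∈ with z ≟ p
    ... | yes refl = ∈-pairˡ
    ... | no  z≢p with ∈-∪⁅⁆⁻ C (D⊆ (∈-joinʳ {C₁} {C₂} z∈ z≢p))
    ...   | inj₁ z∈C  = contradiction (common (C⊆ z∈C) (C₂⊆ z∈)) z≢p
    ...   | inj₂ refl = ∈-∪⁅⁆ z
    sup : ⁅ p ⁆ ∪ ⁅ y ⁆ ⊆ C₂
    sup z∈ with ∈-pair⁻ z∈ | ∈-join⁻ C₁ C₂ y∈D
    ... | inj₁ refl | _               = p∈₂
    ... | inj₂ refl | inj₁ y∈₁ , _    = contradiction (common (C₁⊆ y∈₁) y∈₂) y≢p
    ... | inj₂ refl | inj₂ y∈C₂ , _   = y∈C₂

  -- Otherwise C would span all of M₂, whose elements would then be real and parallel to p.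
  through-basepoint : ∀ {C} → Circuit M₁ C → a ∈ C → b ∈ C → p ∈ C
  through-basepoint {C} circ a∈C b∈C = decidable-stable (p ∈? C) λ p∉C →
    let (y  , y∈  , y≢)  = fresh {k = 1} (E M₂) (λ _ → p) (ℕ.≤-trans (ℕ.n≤1+n 2) size₂)
        (y′ , y′∈ , y′≢) = fresh {k = 2} (E M₂) (λ { zero → p ; (suc _) → y }) size₂
        par  = spanned⇒parallel circ (spans (circuit₁⁺ circ p∉C) a∈C b∈C) y∈ (y≢ zero)
        par′ = spanned⇒parallel circ (spans (circuit₁⁺ circ p∉C) a∈C b∈C) y′∈ (y′≢ zero)
        y≢y′ = λ eq → y′≢ (suc zero) (sym eq)
        cs   = Sym.cycleSpace₁ cycleSpace
        y∉   = λ y∈p → [ y≢ zero , y≢y′ ]′ (∈-pair⁻ y∈p)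
        real : ∀ {z} → z ∈ E M₂ → z ≢ p → z ∈ R
        real z∈ z≢p = decidable-stable (_ ∈? R) λ z∉R → z≢p
          (common (proj₁ circ (virtual (circuit₁⁺ circ p∉C) a∈C b∈C (∈E₂⇒∈E z∈ z≢p) z∉R)) z∈)
        circ₂ = pair-circuit cs loopless₂
          (CycleSpace.cycle-⊕ cs (CycleSpace.circuit⇒cycle cs par) (CycleSpace.circuit⇒cycle cs par′))
          (∈⇒≢⊥ (∈⊕ˡ (∈-∪⁅⁆ y) y∉))
          (λ z∈ → case ∈⊕⁻ (⁅ p ⁆ ∪ ⁅ y ⁆) (⁅ p ⁆ ∪ ⁅ y′ ⁆) z∈ of λ
            { (inj₁ (z∈₁ , z∉₂)) → case ∈-pair⁻ z∈₁ of λ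
                { (inj₁ refl) → contradiction ∈-pairˡ z∉₂ ; (inj₂ refl) → ∈-pairˡ }
            ; (inj₂ (z∉₁ , z∈₂)) → case ∈-pair⁻ z∈₂ of λ
                { (inj₁ refl) → contradiction ∈-pairˡ z∉₁ ; (inj₂ refl) → ∈-∪⁅⁆ y′ } })
    in simple (real y∈ (y≢ zero)) (real y′∈ (y′≢ zero)) y≢y′
         (Sym.circuit₁⁺ circ₂ λ p∈ → [ (λ eq → y≢ zero (sym eq)) , (λ eq → y′≢ zero (sym eq)) ]′ (∈-pair⁻ p∈))

  module _ {C D} (circ : Circuit M₁ C) (p∈C : p ∈ C) (circD : Circuit M₂ D) (p∈D : p ∈ D)
           (a∈ : a ∈ join C D) (b∈ : b ∈ join C D) where

    join-virtual : ∀ {v} → v ∈ E M₁ → v ∉ R → v ∈ C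
    join-virtual {v} v∈ v∉R with v ≟ p
    ... | yes refl = p∈C
    ... | no v≢p with ∈-join⁻ C D (virtual (join⁺ circ p∈C circD p∈D) a∈ b∈ (∈E₁⇒∈E v∈ v≢p) v∉R)
    ...   | inj₁ v∈C , _ = v∈C
    ...   | inj₂ v∈D , _ = contradiction (common v∈ (proj₁ circD v∈D)) v≢p

    -- The closing circuit of `N` is cut down to its `M₁` half. Apart from `y` and `p` this half
    -- lies in `C`, because the two ground sets share only `p`; and `p ∈ C` by assumption.
    join-spans : Spans M₁ C
    join-spans y y∈ y∉C with spans (join⁺ circ p∈C circD p∈D) a∈ b∈ y (∈E₁⇒∈E y∈ λ { refl → y∉C p∈C })
           (λ y∈j → case ∈-join⁻ C D y∈j of λ
             { (inj₁ y∈C , _) → y∉C y∈C ; (inj₂ y∈D , y≢p) → y≢p (common y∈ (proj₁ circD y∈D)) })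
    ... | K , circK , y∈K , K⊆ with ⇒ (circuits K) circK
    ...   | inj₁ (circ₁ , p∉K) = K , circ₁ , y∈K , λ {z} z∈ → case ∈-∪⁅⁆⁻ (join C D) (K⊆ z∈) of λ
      { (inj₂ refl) → ∈-∪⁅⁆ z
      ; (inj₁ z∈j)  → case ∈-join⁻ C D z∈j of λ
          { (inj₁ z∈C , _) → ∈-∪ˡ z∈C
          ; (inj₂ z∈D , z≢p) → contradiction (common (proj₁ circ₁ z∈) (proj₁ circD z∈D)) z≢p } }
    ...   | inj₂ (inj₁ (circ₂ , p∉K)) = contradiction (subst (_∈ K) (common y∈ (proj₁ circ₂ y∈K)) y∈K) p∉K
    ...   | inj₂ (inj₂ (C₁ , C₂ , circ₁ , p∈₁ , circ₂ , p∈₂ , refl)) = C₁ , circ₁ , y∈C₁ , sub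
      where
      y∈C₁ : y ∈ C₁
      y∈C₁ = case ∈-join⁻ C₁ C₂ y∈K of λ
        { (inj₁ y∈₁ , _) → y∈₁ ; (inj₂ y∈₂ , y≢p) → contradiction (common y∈ (proj₁ circ₂ y∈₂)) y≢p }
      sub : C₁ ⊆ C ∪ ⁅ y ⁆
      sub {z} z∈ with z ≟ p
      ... | yes refl = ∈-∪ˡ p∈C
      ... | no z≢p with ∈-∪⁅⁆⁻ (join C D) (K⊆ (∈-joinˡ {C₁} {C₂} z∈ z≢p))
      ...   | inj₂ refl = ∈-∪⁅⁆ z
      ...   | inj₁ z∈j with ∈-join⁻ C D z∈j
      ...     | inj₁ z∈C , _   = ∈-∪ˡ z∈C
      ...     | inj₂ z∈D , _   = contradiction (common (proj₁ circ₁ z∈) (proj₁ circD z∈D)) z≢p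

-- the element of M leading to x, when p leads to everything outside M
project : Matroid n → Fin n → Fin n → Fin n
project M p x with x ∈? E M
... | yes _ = x
... | no  _ = p

-- Every circuit of `M₁` through the projected marks is one half of a circuit of `N` through `a` and
-- `b`, so the properties of the latter can be restricted to `M₁`.
twoSum-marked : ∀ {p : Fin n} {M₁ M₂ N R a b} → IsTwoSum p M₁ M₂ N → p ∉ R → Marked R N a b →
  Marked R M₁ (project M₁ p a) (project M₁ p b)
twoSum-marked {p = p} {M₁} {M₂} {N} {R} {a} {b} S p∉R m = record
  { cycleSpace = cycleSpace₁ cycleSpace
  ; a∈E        = project-∈ a
  ; b∈E        = project-∈ b
  ; virtual    = λ circ a∈ b∈ v∈ v∉ → let (_ , p∈C , circD , p∈D , a∈j , b∈j) = extend circ a∈ b∈ in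
                   join-virtual circ p∈C circD p∈D a∈j b∈j v∈ v∉
  ; spans      = λ circ a∈ b∈ → let (_ , p∈C , circD , p∈D , a∈j , b∈j) = extend circ a∈ b∈ in
                   join-spans circ p∈C circD p∈D a∈j b∈j
  ; simple     = λ x∈ y∈ x≢y circ → simple x∈ y∈ x≢y (circuit₁⁺ circ
                   λ p∈ → case ∈-pair⁻ p∈ of λ { (inj₁ refl) → p∉R x∈ ; (inj₂ refl) → p∉R y∈ })
  }
  where
  open IsTwoSum S
  open TwoSum S
  open Marked m
  open TwoSumMarked S p∉R m

  project-∈ : ∀ x → project M₁ p x ∈ E M₁
  project-∈ x with x ∈? E M₁
  ... | yes x∈ = x∈
  ... | no  _  = p∈E₁

  outside⇒∈E₂ : ∀ {x} → x ∈ E N → x ∉ E M₁ → x ∈ E M₂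
  outside⇒∈E₂ x∈ x∉ = [ (λ x∈₁ → contradiction x∈₁ x∉) , (λ x∈₂ → x∈₂) ]′ (proj₁ (∈E⁻ x∈))

  -- The two marks may coincide, whereas connectedness only speaks of distinct elements.
  circuit-through : ∀ {x y} → x ∈ E M₂ → y ∈ E M₂ → ∃[ D ] Circuit M₂ D × x ∈ D × y ∈ D
  circuit-through {x} {y} x∈ y∈ with x ≟ y
  ... | no x≢y = connected₂ x y x∈ y∈ x≢y
  ... | yes refl = let (z , z∈ , x≢z) = other x (ℕ.≤-trans (ℕ.n≤1+n 2) size₂)
                       (D , circ , x∈D , _) = connected₂ x z x∈ z∈ x≢z in D , circ , x∈D , x∈D

  -- The half `D` is chosen through those marks that lie in `M₂`. When both marks lie on one side,
  -- it is `through-basepoint`, applied to that side, which puts `p` into the half there.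
  extend : ∀ {C} → Circuit M₁ C → project M₁ p a ∈ C → project M₁ p b ∈ C →
           ∃[ D ] p ∈ C × Circuit M₂ D × p ∈ D × a ∈ join C D × b ∈ join C D
  extend {C} circ a∈ b∈ with a ∈? E M₁ | b ∈? E M₁
  ... | yes _ | yes _ =
    let (D , circD , p∈D) = through₂ in
    D , through-basepoint circ a∈ b∈ , circD , p∈D
      , ∈-joinˡ a∈ (proj₂ (∈E⁻ a∈E)) , ∈-joinˡ b∈ (proj₂ (∈E⁻ b∈E))
  ... | yes _ | no b∉ =
    let (D , circD , p∈D , b∈D) = circuit-through p∈E₂ (outside⇒∈E₂ b∈E b∉) in
    D , b∈ , circD , p∈D , ∈-joinˡ a∈ (proj₂ (∈E⁻ a∈E)) , ∈-joinʳ b∈D (proj₂ (∈E⁻ b∈E))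
  ... | no a∉ | yes _ =
    let (D , circD , p∈D , a∈D) = circuit-through p∈E₂ (outside⇒∈E₂ a∈E a∉) in
    D , a∈ , circD , p∈D , ∈-joinʳ a∈D (proj₂ (∈E⁻ a∈E)) , ∈-joinˡ b∈ (proj₂ (∈E⁻ b∈E))
  ... | no a∉ | no b∉ =
    let (D , circD , a∈D , b∈D) = circuit-through (outside⇒∈E₂ a∈E a∉) (outside⇒∈E₂ b∈E b∉) in
    D , a∈ , circD , TwoSumMarked.through-basepoint (twoSum-sym S) p∉R m circD a∈D b∈D
      , ∈-joinʳ a∈D (proj₂ (∈E⁻ a∈E)) , ∈-joinʳ b∈D (proj₂ (∈E⁻ b∈E))

-- A circuit through both marked elements

module Theta {R : Subset n} {M : Matroid n} {a b : Fin n} (m : Marked R M a b)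
             (loopless : ∀ {x} → x ∈ E M → ¬ Circuit M ⁅ x ⁆)
             {C : Subset n} (circ : Circuit M C) (a∈C : a ∈ C) (b∈C : b ∈ C) where

  open Marked m
  open CycleSpace cycleSpace

  outside⇒real : ∀ {q} → q ∈ E M → q ∉ C → q ∈ R
  outside⇒real q∈E q∉C = decidable-stable (_ ∈? R) λ q∉R → q∉C (virtual circ a∈C b∈C q∈E q∉R)

  no-theta : ∀ {q c} → q ∈ E M → q ∉ C → Cycle c → q ∈ c → c ⊆ C ∪ ⁅ q ⁆ → a ∈ c → b ∈ c → False
  no-theta {q} {c} q∈E q∉C cyc q∈c c⊆ a∈c b∈c =
    let (y , y∈C , y∉c)      = ⊈⇒∃ C⊈c
        (D , circD , y∈D , D⊆) = spans c-circuit a∈c b∈c y (proj₁ circ y∈C) y∉c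
        C⊆ = covers y∈C y∉c circD y∈D D⊆
    in simple (outside⇒real q∈E q∉C)
         (decidable-stable (y ∈? R) λ y∉R → y∉c (virtual c-circuit a∈c b∈c (proj₁ circ y∈C) y∉R))
         (λ q≡y → q∉C (subst (_∈ C) (sym q≡y) y∈C))
         (pair-circuit cycleSpace loopless (cycle-⊕ cyc (circuit⇒cycle circ)) (∈⇒≢⊥ (∈⊕ˡ q∈c q∉C))
           λ z∈ → case ∈⊕⁻ c C z∈ of λ
             { (inj₁ (z∈c , z∉C)) → case ∈-∪⁅⁆⁻ C (c⊆ z∈c) of λ
                 { (inj₁ z∈C) → contradiction z∈C z∉C ; (inj₂ refl) → ∈-pairˡ }
             ; (inj₂ (z∉c , z∈C)) → case ∈-∪⁅⁆⁻ c (C⊆ z∈C) of λ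
                 { (inj₁ z∈c) → contradiction z∈c z∉c ; (inj₂ refl) → ∈-∪⁅⁆ y } })
    where
    drop-q : ∀ {d} → d ⊆ C ∪ ⁅ q ⁆ → q ∉ d → d ⊆ C
    drop-q d⊆ q∉d z∈d = ∈-∪⁅⁆-≢ (d⊆ z∈d) λ { refl → q∉d z∈d }

    C⊈c : ¬ C ⊆ c
    C⊈c C⊆c = loopless q∈E (subst (Circuit M) (∪-idem ⁅ q ⁆)
      (pair-circuit cycleSpace loopless (cycle-⊕ cyc (circuit⇒cycle circ)) (∈⇒≢⊥ (∈⊕ˡ q∈c q∉C))
        λ z∈ → case ∈⊕⁻ c C z∈ of λ
          { (inj₁ (z∈c , z∉C)) → case ∈-∪⁅⁆⁻ C (c⊆ z∈c) of λ
              { (inj₁ z∈C) → contradiction z∈C z∉C ; (inj₂ refl) → ∈-pairˡ }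
          ; (inj₂ (z∉c , z∈C)) → contradiction (C⊆c z∈C) z∉c }))

    -- A cycle inside `c` that avoids `q` lies in `C` and is not all of it, hence is empty. One that
    -- contains `q` differs from `c` by such a cycle.
    c-circuit : Circuit M c
    c-circuit = minimal⇒circuit cyc (∈⇒≢⊥ q∈c) λ d cycd d⊆c → case q ∈? d of λ
      { (no q∉d) → case cycle⊆circuit cycd circ (drop-q (λ z∈ → c⊆ (d⊆c z∈)) q∉d) of λ
          { (inj₁ d≡⊥) → inj₁ d≡⊥ ; (inj₂ refl) → contradiction (λ {z} → d⊆c {z}) C⊈c }
      ; (yes q∈d) → case cycle⊆circuit (cycle-⊕ cycd cyc) circ
            (drop-q (⊕⊆ (λ z∈ → c⊆ (d⊆c z∈)) c⊆) (∉⊕ᵇ q∈d q∈c)) of λ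
          { (inj₁ ≡⊥) → inj₂ (trans (⊕-move ≡⊥) (⊕-⊥ˡ c))
          ; (inj₂ ≡C) → contradiction (λ {z} z∈C → decidable-stable (z ∈? c) λ z∉c →
              ∉⊕ⁿ (λ z∈d → z∉c (d⊆c z∈d)) z∉c (subst (z ∈_) (sym ≡C) z∈C)) C⊈c } }

    -- Adding `c` if necessary removes `q` from `D` and keeps `y`. The result is a nonempty cycle
    -- inside the circuit `C`, hence equal to it.
    covers : ∀ {y D} → y ∈ C → y ∉ c → Circuit M D → y ∈ D → D ⊆ c ∪ ⁅ y ⁆ → C ⊆ c ∪ ⁅ y ⁆
    covers {y} {D} y∈C y∉c circD y∈D D⊆ = case q ∈? D of λ
      { (no q∉D)  → whole (circuit⇒cycle circD) y∈D q∉D D⊆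
      ; (yes q∈D) → whole (cycle-⊕ (circuit⇒cycle circD) cyc) (∈⊕ˡ y∈D y∉c) (∉⊕ᵇ q∈D q∈c) (⊕⊆ D⊆ ∈-∪ˡ) }
      where
      whole : ∀ {d} → Cycle d → y ∈ d → q ∉ d → d ⊆ c ∪ ⁅ y ⁆ → C ⊆ c ∪ ⁅ y ⁆
      whole cycd y∈d q∉d d⊆ = case cycle⊆circuit cycd circ (drop-q (λ z∈ → ∪⁅⁆⊆ c⊆ (∈-∪ˡ y∈C) (d⊆ z∈)) q∉d) of λ
        { (inj₁ refl) → contradiction y∈d ∉⊥ ; (inj₂ refl) → d⊆ }

  -- Modulo C, the fundamental cycle of q with respect to C is the unique one
  -- separating a from b.
  Separates : Fin n → Subset n → Set
  Separates q c = Cycle c × q ∈ c × c ⊆ C ∪ ⁅ q ⁆ × a ∈ c × b ∉ c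

  -- Adding `C` to a fundamental cycle passes to the other arc, and by `no-theta` neither arc
  -- contains both marks. For `a ≡ b` the conclusion is absurd, which then shows that `C` is the
  -- whole ground set.
  separating : ∀ {q} → q ∈ E M → q ∉ C → ∃ (Separates q)
  separating {q} q∈E q∉C with spans circ a∈C b∈C q q∈E q∉C
  ... | D , circD , q∈D , D⊆ with a ∈? D | b ∈? D
  ...   | yes a∈D | no  b∉D = D , circuit⇒cycle circD , q∈D , D⊆ , a∈D , b∉D
  ...   | yes a∈D | yes b∈D = ⊥-elim (no-theta q∈E q∉C (circuit⇒cycle circD) q∈D D⊆ a∈D b∈D)
  ...   | no  a∉D | yes b∈D = D ⊕ C , cycle-⊕ (circuit⇒cycle circD) (circuit⇒cycle circ)
    , ∈⊕ˡ q∈D q∉C , ⊕⊆ D⊆ ∈-∪ˡ , ∈⊕ʳ a∉D a∈C , ∉⊕ᵇ b∈D b∈C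
  ...   | no  a∉D | no  b∉D = ⊥-elim (no-theta q∈E q∉C (cycle-⊕ (circuit⇒cycle circD) (circuit⇒cycle circ))
    (∈⊕ˡ q∈D q∉C) (⊕⊆ D⊆ ∈-∪ˡ) (∈⊕ʳ a∉D a∈C) (∈⊕ʳ b∉D b∈C))

-- Traces of the elements outside C in a 3-connected label

infixr 7 _·_
_·_ : Bool → Subset n → Subset n
true  · c = c
false · c = ⊥

lookup-⊥ : ∀ (x : Fin n) → lookup ⊥ x ≡ false
lookup-⊥ {n} x = ∉⇒false {n} {⊥} ∉⊥

-- The circuit and the cycles `s` are stored instead of recomputed, so that exchanging the marks
-- yields a frame on the same `C` and every statement about `a` has a dual about `b`.
record Frame (R : Subset n) (M : Matroid n) (a b : Fin n) : Set₁ where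
  field
    marked         : Marked R M a b
    connected      : Connected M
    threeConnected : ThreeConnected M
    size           : 4 ≤ ∣ E M ∣
    a≢b            : a ≢ b

  open Marked marked public
  open CycleSpace cycleSpace public

  loopless : ∀ {x} → x ∈ E M → ¬ Circuit M ⁅ x ⁆
  loopless {x} x∈ = let (y , y∈ , x≢y) = other x (ℕ.≤-trans (s≤s (s≤s z≤n)) size)
                    in connected⇒loopless M connected x∈ y∈ x≢y

  field
    {C}  : Subset n
    circ : Circuit M C
    a∈C  : a ∈ C
    b∈C  : b ∈ C

  open Theta marked loopless circ a∈C b∈C public

  field
    s          : Fin n → Subset n
    separates  : ∀ {q} → q ∈ E M → q ∉ C → Separates q (s q)

mkFrame : ∀ {R} {M : Matroid n} {a b} → Marked R M a b → Connected M → ThreeConnected M → 4 ≤ ∣ E M ∣ → a ≢ b →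
          Frame R M a b
mkFrame {n} {R} {M} {a} {b} m conn three size a≢b = record
  { marked = m ; connected = conn ; threeConnected = three ; size = size ; a≢b = a≢b
  ; circ = circ ; a∈C = a∈C ; b∈C = b∈C ; s = s ; separates = λ q∈E q∉C → separates _ q∈E q∉C }
  where
  loopless : ∀ {x} → x ∈ E M → ¬ Circuit M ⁅ x ⁆
  loopless {x} x∈ = let (y , y∈ , x≢y) = other x (ℕ.≤-trans (s≤s (s≤s z≤n)) size)
                    in connected⇒loopless M conn x∈ y∈ x≢y
  C : Subset n
  C = proj₁ (conn a b (Marked.a∈E m) (Marked.b∈E m) a≢b)
  circ : Circuit M C
  circ = proj₁ (proj₂ (conn a b (Marked.a∈E m) (Marked.b∈E m) a≢b))
  a∈C : a ∈ C
  a∈C = proj₁ (proj₂ (proj₂ (conn a b (Marked.a∈E m) (Marked.b∈E m) a≢b)))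
  b∈C : b ∈ C
  b∈C = proj₂ (proj₂ (proj₂ (conn a b (Marked.a∈E m) (Marked.b∈E m) a≢b)))
  open Theta m loopless circ a∈C b∈C
  choose : ∀ q → ∃[ c ] (q ∈ E M → q ∉ C → Separates q c)
  choose q with q ∈? E M | q ∈? C
  ... | yes q∈E | no  q∉C = let (c , sep) = separating q∈E q∉C in c , λ _ _ → sep
  ... | no  q∉E | _       = ⊥ , λ q∈E _ → contradiction q∈E q∉E
  ... | yes _   | yes q∈C = ⊥ , λ _ q∉C → contradiction q∈C q∉C
  s : Fin n → Subset n
  s = proj₁ ∘ choose
  separates : ∀ q → q ∈ E M → q ∉ C → Separates q (s q)
  separates q = proj₂ (choose q)

-- Each trace is replaced by its complement in `C`.
swapFrame : ∀ {R} {M : Matroid n} {a b} → Frame R M a b → Frame R M b a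
swapFrame {M = M} F = record
  { marked = marked-sym marked ; connected = connected ; threeConnected = threeConnected ; size = size
  ; a≢b = a≢b ∘ sym ; circ = circ ; a∈C = b∈C ; b∈C = a∈C
  ; s = λ q → s q ⊕ C
  ; separates = λ q∈E q∉C → let (cyc , q∈ , ⊆C , a∈ , b∉) = separates q∈E q∉C in
      cycle-⊕ cyc (circuit⇒cycle circ) , ∈⊕ˡ q∈ q∉C , ⊕⊆ ⊆C ∈-∪ˡ , ∈⊕ʳ b∉ b∈C , ∉⊕ᵇ a∈ a∈C
  }
  where open Frame F

module FrameProperties {R : Subset n} {M : Matroid n} {a b : Fin n} (F : Frame R M a b) where

  open Frame F

  Out : Fin n → Set
  Out q = q ∈ E M × q ∉ C

  out? : ∀ q → Dec (Out q)
  out? q = (q ∈? E M) ×-dec ¬? (q ∈? C)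

  s-cycle : ∀ {q} → Out q → Cycle (s q)
  s-cycle (q∈ , q∉) = proj₁ (separates q∈ q∉)

  q∈s : ∀ {q} → Out q → q ∈ s q
  q∈s (q∈ , q∉) = proj₁ (proj₂ (separates q∈ q∉))

  s⊆ : ∀ {q} → Out q → s q ⊆ C ∪ ⁅ q ⁆
  s⊆ (q∈ , q∉) = proj₁ (proj₂ (proj₂ (separates q∈ q∉)))

  a∈s : ∀ {q} → Out q → a ∈ s q
  a∈s (q∈ , q∉) = proj₁ (proj₂ (proj₂ (proj₂ (separates q∈ q∉))))

  b∉s : ∀ {q} → Out q → b ∉ s q
  b∉s (q∈ , q∉) = proj₂ (proj₂ (proj₂ (proj₂ (separates q∈ q∉))))

  ∉s : ∀ {q z} → Out q → z ∉ C → z ≢ q → z ∉ s q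
  ∉s out z∉C z≢q z∈s = z∉C (∈-∪⁅⁆-≢ (s⊆ out z∈s) z≢q)

  t : Fin n → Subset n
  t q = s q ∩ C

  t⁺ : ∀ {q z} → z ∈ s q → z ∈ C → z ∈ t q
  t⁺ z∈s z∈C = x∈p∩q⁺ (z∈s , z∈C)

  t⁻ : ∀ {q z} → z ∈ t q → z ∈ s q × z ∈ C
  t⁻ {q} = x∈p∩q⁻ (s q) C

  -- Adding `s q` or `s q′` clears `q` or `q′` from `c`. What remains is a cycle inside the circuit
  -- `C`, so it is empty or `C`.
  coefficients : ∀ {q q′ c} → Out q → Out q′ → q ≢ q′ → Cycle c → c ⊆ (C ∪ ⁅ q ⁆) ∪ ⁅ q′ ⁆ →
    ∃[ ε₁ ] ∃[ ε₂ ] ∃[ ε₃ ] (c ≡ ε₁ · C ⊕ (ε₂ · s q ⊕ ε₃ · s q′))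
  coefficients {q} {q′} {c} out out′ q≢q′ cyc c⊆ with q ∈? c | q′ ∈? c
  ... | no q∉ | no q′∉ =
    case cycle⊆circuit cyc circ (λ z∈ → ∈-∪⁅⁆-≢ (∈-∪⁅⁆-≢ (c⊆ z∈) λ { refl → q′∉ z∈ }) λ { refl → q∉ z∈ }) of λ
      { (inj₁ refl) → false , false , false , sym (trans (⊕-⊥ˡ _) (⊕-⊥ˡ _))
      ; (inj₂ refl) → true , false , false , sym (trans (cong (C ⊕_) (⊕-⊥ˡ ⊥)) (⊕-⊥ʳ _)) }
  ... | yes q∈ | no q′∉ =
    case cycle⊆circuit (cycle-⊕ cyc (s-cycle out)) circ
           (λ z∈ → ∈-∪⁅⁆-≢ (∈-∪⁅⁆-≢ (⊕⊆ c⊆ (λ w∈ → ∈-∪ˡ (s⊆ out w∈)) z∈)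
             λ { refl → ∉⊕ⁿ q′∉ (∉s out (proj₂ out′) (q≢q′ ∘ sym)) z∈ }) λ { refl → ∉⊕ᵇ q∈ (q∈s out) z∈ }) of λ
      { (inj₁ eq) → false , true , false , trans (⊕-move eq) (cong (⊥ ⊕_) (sym (⊕-⊥ʳ _)))
      ; (inj₂ eq) → true , true , false , trans (⊕-move eq) (cong (C ⊕_) (sym (⊕-⊥ʳ _))) }
  ... | no q∉ | yes q′∈ =
    case cycle⊆circuit (cycle-⊕ cyc (s-cycle out′)) circ
           (λ z∈ → ∈-∪⁅⁆-≢ (∈-∪⁅⁆-≢ (⊕⊆ c⊆ (λ w∈ → ∪⁅⁆-mono ∈-∪ˡ (s⊆ out′ w∈)) z∈)
             λ { refl → ∉⊕ᵇ q′∈ (q∈s out′) z∈ }) λ { refl → ∉⊕ⁿ q∉ (∉s out′ (proj₂ out) q≢q′) z∈ }) of λ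
      { (inj₁ eq) → false , false , true , trans (⊕-move eq) (cong (⊥ ⊕_) (sym (⊕-⊥ˡ _)))
      ; (inj₂ eq) → true , false , true , trans (⊕-move eq) (cong (C ⊕_) (sym (⊕-⊥ˡ _))) }
  ... | yes q∈ | yes q′∈ =
    case cycle⊆circuit (cycle-⊕ (cycle-⊕ cyc (s-cycle out)) (s-cycle out′)) circ
           (λ z∈ → ∈-∪⁅⁆-≢ (∈-∪⁅⁆-≢ (⊕⊆ (⊕⊆ c⊆ (λ w∈ → ∈-∪ˡ (s⊆ out w∈))) (λ w∈ → ∪⁅⁆-mono ∈-∪ˡ (s⊆ out′ w∈)) z∈)
             λ { refl → ∉⊕ᵇ (∈⊕ˡ q′∈ (∉s out (proj₂ out′) (q≢q′ ∘ sym))) (q∈s out′) z∈ })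
             λ { refl → ∉⊕ⁿ (∉⊕ᵇ q∈ (q∈s out)) (∉s out′ (proj₂ out) q≢q′) z∈ }) of λ
      { (inj₁ eq) → false , true , true , regroup eq
      ; (inj₂ eq) → true , true , true , regroup eq }
    where
    regroup : ∀ {d} → (c ⊕ s q) ⊕ s q′ ≡ d → c ≡ d ⊕ (s q ⊕ s q′)
    regroup eq = ⊕-move (trans (sym (⊕-assoc c (s q) (s q′))) eq)

  lookup-· : ∀ ε (c : Subset n) x → lookup (ε · c) x ≡ ε ∧ lookup c x
  lookup-· true  c x = refl
  lookup-· false c x = lookup-⊥ x

  lookup-combination : ∀ ε₁ ε₂ ε₃ q q′ x → lookup (ε₁ · C ⊕ (ε₂ · s q ⊕ ε₃ · s q′)) x ≡
    (ε₁ ∧ lookup C x) xor ((ε₂ ∧ lookup (s q) x) xor (ε₃ ∧ lookup (s q′) x))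
  lookup-combination ε₁ ε₂ ε₃ q q′ x = trans (lookup-⊕ (ε₁ · C) _ x) (cong₂ _xor_ (lookup-· ε₁ C x)
    (trans (lookup-⊕ (ε₂ · s q) _ x) (cong₂ _xor_ (lookup-· ε₂ (s q) x) (lookup-· ε₃ (s q′) x))))

  module Incomparable {q q′ y y′} (out : Out q) (out′ : Out q′)
           (y∈q : y ∈ t q) (y∉q′ : y ∉ t q′) (y′∈q′ : y′ ∈ t q′) (y′∉q : y′ ∉ t q) where

    private
      X : Subset n
      X = C ⊕ (s q ⊕ s q′)

      q≢q′ : q ≢ q′
      q≢q′ refl = y∉q′ y∈q

      module _ {ε₁ ε₂ ε₃ : Bool} {c : Subset n} (eq : c ≡ ε₁ · C ⊕ (ε₂ · s q ⊕ ε₃ · s q′)) where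
        value : ∀ {x α β γ} → lookup C x ≡ α → lookup (s q) x ≡ β → lookup (s q′) x ≡ γ →
                lookup c x ≡ (ε₁ ∧ α) xor ((ε₂ ∧ β) xor (ε₃ ∧ γ))
        value {x} refl refl refl = trans (cong (λ d → lookup d x) eq) (lookup-combination ε₁ ε₂ ε₃ q q′ x)

        left : ∀ {x} → x ∈ t q → x ∉ t q′ → lookup c x ≡ ε₁ xor ε₂
        left x∈ x∉ = let (x∈s , x∈C) = t⁻ x∈ in
          trans (value (∈⇒true x∈C) (∈⇒true x∈s) (∉⇒false λ x∈s′ → x∉ (t⁺ x∈s′ x∈C))) (simplify ε₁ ε₂ ε₃)
          where
          simplify : ∀ α β γ → (α ∧ true) xor ((β ∧ true) xor (γ ∧ false)) ≡ α xor β
          simplify α β γ = cong₂ _xor_ (Bool.∧-identityʳ α) (trans (cong₂ _xor_ (Bool.∧-identityʳ β) (Bool.∧-zeroʳ γ)) (Bool.xor-identityʳ β))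

        right : ∀ {x} → x ∈ t q′ → x ∉ t q → lookup c x ≡ ε₁ xor ε₃
        right x∈ x∉ = let (x∈s , x∈C) = t⁻ x∈ in
          trans (value (∈⇒true x∈C) (∉⇒false λ x∈s′ → x∉ (t⁺ x∈s′ x∈C)) (∈⇒true x∈s)) (simplify ε₁ ε₂ ε₃)
          where
          simplify : ∀ α β γ → (α ∧ true) xor ((β ∧ false) xor (γ ∧ true)) ≡ α xor γ
          simplify α β γ = cong₂ _xor_ (Bool.∧-identityʳ α) (cong₂ _xor_ (Bool.∧-zeroʳ β) (Bool.∧-identityʳ γ))

      X⊆ : X ⊆ (C ∪ ⁅ q ⁆) ∪ ⁅ q′ ⁆
      X⊆ = ⊕⊆ (λ z∈ → ∈-∪ˡ (∈-∪ˡ z∈)) (⊕⊆ (λ z∈ → ∈-∪ˡ (s⊆ out z∈)) (λ z∈ → ∪⁅⁆-mono ∈-∪ˡ (s⊆ out′ z∈)))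

      y∉X : ∀ {z} → z ∈ t q → z ∉ t q′ → z ∉ X
      y∉X z∈ z∉ = false⇒∉ (left {true} {true} {true} refl z∈ z∉)

      a∈X : a ∈ X
      a∈X = true⇒∈ (value {true} {true} {true} refl (∈⇒true a∈C) (∈⇒true (a∈s out)) (∈⇒true (a∈s out′)))

      b∈X : b ∈ X
      b∈X = true⇒∈ (value {true} {true} {true} refl (∈⇒true b∈C) (∉⇒false (b∉s out)) (∉⇒false (b∉s out′)))

      -- The elements `y` and `y′` are missing from `X` and hence from `c`; these two zeros force
      -- the three coefficients of `c` to agree.
      X-minimal : ∀ c → Cycle c → c ⊆ X → c ≡ ⊥ ⊎ c ≡ X
      X-minimal c cyc c⊆X with coefficients out out′ q≢q′ cyc (λ z∈ → X⊆ (c⊆X z∈))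
      ... | ε₁ , ε₂ , ε₃ , eq = classify ε₁ ε₂ ε₃ eq
        (trans (sym (left {ε₁} {ε₂} {ε₃} eq y∈q y∉q′)) (∉⇒false λ y∈c → y∉X y∈q y∉q′ (c⊆X y∈c)))
        (trans (sym (right {ε₁} {ε₂} {ε₃} eq y′∈q′ y′∉q)) (∉⇒false λ y∈c →
          false⇒∉ (right {true} {true} {true} refl y′∈q′ y′∉q) (c⊆X y∈c)))
        where
        classify : ∀ ε₁ ε₂ ε₃ → c ≡ ε₁ · C ⊕ (ε₂ · s q ⊕ ε₃ · s q′) →
                   ε₁ xor ε₂ ≡ false → ε₁ xor ε₃ ≡ false → c ≡ ⊥ ⊎ c ≡ X
        classify true  true  true  eq _ _ = inj₂ eq
        classify false false false eq _ _ = inj₁ (trans eq (trans (⊕-⊥ˡ _) (⊕-⊥ˡ _)))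

      X-circuit : Circuit M X
      X-circuit = minimal⇒circuit (cycle-⊕ (circuit⇒cycle circ) (cycle-⊕ (s-cycle out) (s-cycle out′)))
        (∈⇒≢⊥ a∈X) X-minimal

    -- The circuit that `y` closes with `X` is again a combination of `C`, `s q` and `s q′`, so it
    -- cannot tell `y` from another element of `t q ─ t q′`. But such an element is not in
    -- `X ∪ ⁅ y ⁆`.
    exchange-unique : ∀ {z} → z ∈ t q → z ∉ t q′ → z ≡ y
    exchange-unique {z} z∈ z∉ with z ≟ y
    ... | yes z≡y = z≡y
    ... | no  z≢y with spans X-circuit a∈X b∈X y (proj₁ circ (proj₂ (t⁻ y∈q))) (y∉X y∈q y∉q′)
    ...   | D , circD , y∈D , D⊆
          with coefficients out out′ q≢q′ (circuit⇒cycle circD)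
                 (λ w∈ → ∪⁅⁆⊆ X⊆ (∈-∪ˡ (∈-∪ˡ (proj₂ (t⁻ y∈q)))) (D⊆ w∈))
    ...     | ε₁ , ε₂ , ε₃ , eq = contradiction
      (trans (sym (∈⇒true y∈D)) (trans (trans (left {ε₁} {ε₂} {ε₃} eq y∈q y∉q′) (sym (left {ε₁} {ε₂} {ε₃} eq z∈ z∉)))
        (∉⇒false λ z∈D → y∉X z∈ z∉ (∈-∪⁅⁆-≢ (D⊆ z∈D) z≢y)))) (λ ())

    exchanged⇒real : y ∈ R
    exchanged⇒real = decidable-stable (y ∈? R) λ y∉R →
      y∉X y∈q y∉q′ (virtual X-circuit a∈X b∈X (proj₁ circ (proj₂ (t⁻ y∈q))) y∉R)

  -- With equal traces the sum of the two cycles is the pair `q`, `q′`, a parallel pair of real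
  -- elements.
  t-injective : ∀ {q q′} → Out q → Out q′ → q ≢ q′ → t q ≢ t q′
  t-injective {q} {q′} out out′ q≢q′ t≡ =
    simple (outside⇒real (proj₁ out) (proj₂ out)) (outside⇒real (proj₁ out′) (proj₂ out′)) q≢q′
      (pair-circuit cycleSpace loopless (cycle-⊕ (s-cycle out) (s-cycle out′))
        (∈⇒≢⊥ (∈⊕ˡ (q∈s out) (∉s out′ (proj₂ out) q≢q′)))
        λ z∈ → case ∈⊕⁻ (s q) (s q′) z∈ of λ
          { (inj₁ (z∈s , z∉s′)) → case ∈-∪⁅⁆⁻ C (s⊆ out z∈s) of λ
              { (inj₁ z∈C)  → contradiction (proj₁ (t⁻ (subst (_ ∈_) t≡ (t⁺ z∈s z∈C)))) z∉s′
              ; (inj₂ refl) → ∈-pairˡ }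
          ; (inj₂ (z∉s , z∈s′)) → case ∈-∪⁅⁆⁻ C (s⊆ out′ z∈s′) of λ
              { (inj₁ z∈C)  → contradiction (proj₁ (t⁻ (subst (_ ∈_) (sym t≡) (t⁺ z∈s′ z∈C)))) z∉s
              ; (inj₂ refl) → ∈-∪⁅⁆ q′ } })

  -- V together with the elements whose trace lies in V is no 2-separation.
  cut : ∀ {V} → V ⊆ C → a ∈ V → b ∉ V → (∀ {q} → Out q → t q ⊆ V ⊎ V ⊆ t q) →
        ∀ {x y} → x ∈ E M → x ≢ a → x ∈ V ⊎ (x ∉ C × t x ⊆ V) →
        y ∈ E M → y ≢ b → y ∉ V → y ∈ C ⊎ ¬ t y ⊆ V → False
  cut {V} V⊆C a∈V b∉V comparable {x} {y} x∈E x≢a x-side y∈E y≢b y∉V y-side =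
    circuit-cut M threeConnected circ X⊆E
      (two≤ (∈-comprehension⁺ X? ([ inj₁ , (λ { (x∉C , tx⊆) → inj₂ ((x∈E , x∉C) , λ {z} → tx⊆ {z}) }) ]′ x-side))
            (∈-comprehension⁺ X? (inj₁ a∈V)) x≢a)
      (two≤ (x∈p∧x∉q⇒x∈p─q y∈E λ y∈X → case ∈-comprehension⁻ X? y∈X of λ
              { (inj₁ y∈V) → y∉V y∈V
              ; (inj₂ ((_ , y∉C) , ty⊆)) → [ y∉C , (λ ty⊈ → ty⊈ ty⊆) ]′ y-side })
            (x∈p∧x∉q⇒x∈p─q b∈E b∉X) y≢b)
      (a , a∈C , ∈-comprehension⁺ X? (inj₁ a∈V))
      (b , b∈C , b∉X)
      spanX spanY
    where
    X? : ∀ x → Dec (x ∈ V ⊎ (Out x × t x ⊆ V))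
    X? x = (x ∈? V) ⊎-dec (out? x ×-dec (t x ⊆? V))
    X : Subset n
    X = comprehension X?
    X⊆E : X ⊆ E M
    X⊆E x∈ = [ (λ x∈V → proj₁ circ (V⊆C x∈V)) , proj₁ ∘ proj₁ ]′ (∈-comprehension⁻ X? x∈)
    b∉X : b ∉ X
    b∉X b∈X = [ b∉V , (λ { ((_ , b∉C) , _) → b∉C b∈C }) ]′ (∈-comprehension⁻ X? b∈X)
    spanX : ∀ {x} → x ∈ X → x ∉ C → ¬ Indep M (C ∩ X ∪ ⁅ x ⁆)
    spanX {x} x∈X x∉C ind with ∈-comprehension⁻ X? x∈X
    ... | inj₁ x∈V = x∉C (V⊆C x∈V)
    ... | inj₂ (out , tx⊆) = cycle⇒dependent (s-cycle out) (∈⇒≢⊥ (q∈s out)) (Matroid.indep-⊆ M ind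
      λ z∈s → case ∈-∪⁅⁆⁻ C (s⊆ out z∈s) of λ
        { (inj₁ z∈C)  → ∈-∪ˡ (x∈p∩q⁺ (z∈C , ∈-comprehension⁺ X? (inj₁ (tx⊆ (t⁺ z∈s z∈C)))))
        ; (inj₂ refl) → ∈-∪⁅⁆ x })
    spanY : ∀ {x} → x ∈ E M → x ∉ X → x ∉ C → ¬ Indep M ((C ─ X) ∪ ⁅ x ⁆)
    spanY {x} x∈E x∉X x∉C ind with comparable (x∈E , x∉C)
    ... | inj₁ tx⊆ = x∉X (∈-comprehension⁺ X? (inj₂ ((x∈E , x∉C) , λ {z} → tx⊆ {z})))
    ... | inj₂ V⊆tx = cycle⇒dependent (cycle-⊕ (s-cycle out) (circuit⇒cycle circ)) (∈⇒≢⊥ (∈⊕ˡ (q∈s out) x∉C))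
      (Matroid.indep-⊆ M ind λ z∈ → case ∈⊕⁻ (s x) C z∈ of λ
        { (inj₁ (z∈s , z∉C)) → case ∈-∪⁅⁆⁻ C (s⊆ out z∈s) of λ
            { (inj₁ z∈C) → contradiction z∈C z∉C ; (inj₂ refl) → ∈-∪⁅⁆ x }
        ; (inj₂ (z∉s , z∈C)) → ∈-∪ˡ (x∈p∧x∉q⇒x∈p─q z∈C λ z∈X → case ∈-comprehension⁻ X? z∈X of λ
            { (inj₁ z∈V) → z∉s (proj₁ (t⁻ (V⊆tx z∈V)))
            ; (inj₂ ((_ , z∉C) , _)) → z∉C z∈C }) })
      where
      out : Out x
      out = x∈E , x∉C

module FrameTrace {R : Subset n} {M : Matroid n} {a b : Fin n} (F : Frame R M a b) where

  open Frame F
  open FrameProperties F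

  -- Otherwise `q` is parallel to `a`, and this pair is one side of a 2-separation. The other side
  -- has a second element besides `b`, as there are at least four elements and no other trace equals
  -- that of `q`.
  trace-nontrivial : ∀ {q} → Out q → ∃[ d ] d ∈ t q × d ≢ a
  trace-nontrivial {q} out with any? (λ d → (d ∈? t q) ×-dec ¬? (d ≟ a))
  ... | yes found = found
  ... | no  none  =
    let (y , y∈E , y≢) = fresh {k = 3} (E M) (λ { zero → a ; (suc zero) → b ; (suc (suc _)) → q }) size in
    ⊥-elim (cut {⁅ a ⁆} (only λ { refl → a∈C }) (x∈⁅x⁆ a) (λ b∈ → a≢b (sym (x∈⁅y⁆⇒x≡y a b∈)))
      (λ out′ → inj₂ (only λ { refl → t⁺ (a∈s out′) a∈C }))
      (proj₁ out) (λ { refl → proj₂ out a∈C }) (inj₂ (proj₂ out , t⊆a))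
      y∈E (y≢ (suc zero)) (λ y∈ → y≢ zero (x∈⁅y⁆⇒x≡y a y∈))
      (case y ∈? C of λ
        { (yes y∈C) → inj₁ y∈C
        ; (no  y∉C) → inj₂ λ ty⊆ → t-injective (y∈E , y∉C) out (y≢ (suc (suc zero)))
            (⊆-antisym (λ z∈ → only (λ { refl → t⁺ (a∈s out) a∈C }) (ty⊆ z∈))
                       (λ z∈ → only (λ { refl → t⁺ (a∈s (y∈E , y∉C)) a∈C }) (t⊆a z∈))) }))
    where
    only : ∀ {V} → (∀ {z} → z ≡ a → z ∈ V) → ⁅ a ⁆ ⊆ V
    only ∈V z∈ = ∈V (x∈⁅y⁆⇒x≡y a z∈)
    t⊆a : t q ⊆ ⁅ a ⁆
    t⊆a {z} z∈ = subst (_∈ ⁅ a ⁆) (sym (decidable-stable (z ≟ a) λ z≢a → none (z , z∈ , z≢a))) (x∈⁅x⁆ a)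

  -- If `C` were everything, `M` would be a circuit with at least four elements, and any pair in it
  -- could be split off.
  ∃-out : ∃ Out
  ∃-out with any? out?
  ... | yes found = found
  ... | no  none  =
    let (d  , d∈E  , d≢)  = fresh {k = 2} (E M) (λ { zero → a ; (suc _) → b }) (ℕ.≤-trans (s≤s (s≤s (s≤s z≤n))) size)
        (d′ , d′∈E , d′≢) = fresh {k = 3} (E M) (λ { zero → a ; (suc zero) → b ; (suc (suc _)) → d }) size
        ∈C : ∀ {x} → x ∈ E M → x ∈ C
        ∈C x∈ = decidable-stable (_ ∈? C) λ x∉ → none (_ , x∈ , x∉)
    in ⊥-elim (cut {⁅ a ⁆ ∪ ⁅ d ⁆} (λ z∈ → case ∈-pair⁻ z∈ of λ { (inj₁ refl) → a∈C ; (inj₂ refl) → ∈C d∈E })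
         ∈-pairˡ (λ b∈ → [ (λ b≡a → a≢b (sym b≡a)) , (λ b≡d → d≢ (suc zero) (sym b≡d)) ]′ (∈-pair⁻ b∈))
         (λ out → contradiction (_ , out) none)
         d∈E (d≢ zero) (inj₁ (∈-∪⁅⁆ d))
         d′∈E (d′≢ (suc zero)) (λ d′∈ → [ d′≢ zero , d′≢ (suc (suc zero)) ]′ (∈-pair⁻ d′∈))
         (inj₁ (∈C d′∈E)))

module FrameStructure {R : Subset n} {M : Matroid n} {a b : Fin n} (F : Frame R M a b) where

  open Frame F
  open FrameProperties F
  open FrameTrace F
  private
    module Swapped = FrameTrace (swapFrame F)

  cotrace-nontrivial : ∀ {q} → Out q → ∃[ d ] d ∈ C × d ∉ t q × d ≢ b
  cotrace-nontrivial {q} out = let (d , d∈ , d≢b) = Swapped.trace-nontrivial out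
                                   (d∈⊕ , d∈C) = x∈p∩q⁻ (s q ⊕ C) C d∈ in
    d , d∈C , (λ d∈t → ∉⊕ᵇ (proj₁ (t⁻ d∈t)) d∈C d∈⊕) , d≢b

  -- If `d` lay in every trace, so would the pair `a`, `d`, which would then be comparable with all
  -- traces and give a forbidden cut.
  avoided : ∀ {d} → d ∈ C → d ≢ a → d ≢ b → ∃[ q ] Out q × d ∉ t q
  avoided {d} d∈C d≢a d≢b with any? (λ q → out? q ×-dec ¬? (d ∈? t q))
  ... | yes found = found
  ... | no  none  =
    let (q , out) = ∃-out
        d∈t : ∀ {q} → Out q → d ∈ t q
        d∈t {q} out = decidable-stable (d ∈? t q) λ d∉ → none (q , out , d∉)
        (y , y∈C , y∉ , y≢b) = cotrace-nontrivial out
    in ⊥-elim (cut {⁅ a ⁆ ∪ ⁅ d ⁆} (λ z∈ → case ∈-pair⁻ z∈ of λ { (inj₁ refl) → a∈C ; (inj₂ refl) → d∈C })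
         ∈-pairˡ (λ b∈ → [ (λ b≡a → a≢b (sym b≡a)) , (λ b≡d → d≢b (sym b≡d)) ]′ (∈-pair⁻ b∈))
         (λ out′ → inj₂ λ z∈ → case ∈-pair⁻ z∈ of λ { (inj₁ refl) → t⁺ (a∈s out′) a∈C ; (inj₂ refl) → d∈t out′ })
         (proj₁ circ d∈C) d≢a (inj₁ (∈-∪⁅⁆ d))
         (proj₁ circ y∈C) y≢b
         (λ y∈ → [ ∈∉⇒≢ (t⁺ (a∈s out) a∈C) y∉ ∘ sym , ∈∉⇒≢ (d∈t out) y∉ ∘ sym ]′ (∈-pair⁻ y∈))
         (inj₁ y∈C))

  exchange-unique : ∀ {q q′ y y′ z} → Out q → Out q′ → y ∈ t q → y ∉ t q′ → y′ ∈ t q′ → y′ ∉ t q →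
                    z ∈ t q → z ∉ t q′ → z ≡ y
  exchange-unique out out′ y∈ y∉ y′∈ y′∉ = Incomparable.exchange-unique out out′ y∈ y∉ y′∈ y′∉

  -- Let `V` be the union of the traces that do not properly contain `t q`. The remaining traces
  -- turn out to contain all of `V`, so `V` is comparable with every trace and cuts. It contains
  -- `t q` and lies in `t q′`, which keeps both sides large enough.
  no-inclusion : ∀ {q q′} → Out q → Out q′ → ¬ t q ⊂ t q′
  no-inclusion {q} {q′} out out′ q⊂q′ =
    let (x , x∈ , x≢a) = trace-nontrivial out
        (y , y∈C , y∉ , y≢b) = cotrace-nontrivial out′
    in cut {V} (λ z∈ → let (_ , _ , _ , z∈t) = ∈-comprehension⁻ V? z∈ in proj₂ (t⁻ z∈t))
         (inV out (λ q⊂q → ⊂-irref refl q⊂q) (t⁺ (a∈s out) a∈C))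
         (λ b∈ → let (_ , out₁ , _ , b∈t) = ∈-comprehension⁻ V? b∈ in b∉s out₁ (proj₁ (t⁻ b∈t)))
         comparable
         (proj₁ circ (proj₂ (t⁻ x∈))) x≢a (inj₁ (inV out (λ q⊂q → ⊂-irref refl q⊂q) x∈))
         (proj₁ circ y∈C) y≢b (λ y∈V → y∉ (above out′ q⊂q′ y∈V))
         (inj₁ y∈C)
    where
    V? : ∀ z → Dec (∃[ q₁ ] Out q₁ × ¬ t q ⊂ t q₁ × z ∈ t q₁)
    V? z = any? λ q₁ → out? q₁ ×-dec ¬? (t q ⊂? t q₁) ×-dec (z ∈? t q₁)
    V : Subset n
    V = comprehension V?
    inV : ∀ {q₁ z} → Out q₁ → ¬ t q ⊂ t q₁ → z ∈ t q₁ → z ∈ V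
    inV out₁ q⊄ z∈ = ∈-comprehension⁺ V? (_ , out₁ , q⊄ , z∈)
    -- q ⊂ q₂ and q ⊄ q₁.  If q₁ ⊈ q₂, then q₁ and q₂ are incomparable, and both α ∈ q ∖ q₁
    -- and β ∈ q₂ ∖ q lie in q₂ ∖ q₁.
    above : ∀ {q₂} → Out q₂ → t q ⊂ t q₂ → V ⊆ t q₂
    above {q₂} out₂ (q⊆q₂ , β , β∈q₂ , β∉q) {z} z∈V with ∈-comprehension⁻ V? z∈V
    ... | q₁ , out₁ , q⊄q₁ , z∈q₁ = decidable-stable (z ∈? t q₂) λ z∉q₂ →
      let (α , α∈q , α∉q₁) = ⊈⇒∃ {c = t q} {t q₁} λ q⊆q₁ → q⊄q₁ (q⊆q₁ , z , z∈q₁ , λ z∈q → z∉q₂ (q⊆q₂ z∈q))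
          β∉q₁ = λ β∈q₁ → z∉q₂ (subst (_∈ t q₂)
                   (sym (exchange-unique out₁ out β∈q₁ β∉q α∈q α∉q₁ z∈q₁ (λ z∈q → z∉q₂ (q⊆q₂ z∈q)))) β∈q₂)
      in β∉q (subst (_∈ t q) (sym (exchange-unique out₂ out₁ (q⊆q₂ α∈q) α∉q₁ z∈q₁ z∉q₂ β∈q₂ β∉q₁)) α∈q)
    comparable : ∀ {q₂} → Out q₂ → t q₂ ⊆ V ⊎ V ⊆ t q₂
    comparable {q₂} out₂ with t q ⊂? t q₂
    ... | yes q⊂q₂ = inj₂ (above out₂ q⊂q₂)
    ... | no  q⊄q₂ = inj₁ λ z∈ → ∈-comprehension⁺ V? (q₂ , out₂ , q⊄q₂ , z∈)

  antichain : ∀ {q q′} → Out q → Out q′ → q ≢ q′ → ∃[ y ] y ∈ t q × y ∉ t q′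
  antichain {q} {q′} out out′ q≢q′ = ⊈⇒∃ λ q⊆q′ →
    no-inclusion out out′ (⊆∧≢⇒⊂ q⊆q′ (t-injective out out′ q≢q′))

  exchanged : ∀ {q q′ y} → Out q → Out q′ → y ∈ t q → y ∉ t q′ → ∃[ y′ ] y′ ∈ t q′ × y′ ∉ t q
  exchanged out out′ y∈ y∉ = antichain out′ out λ { refl → y∉ y∈ }

  unique : ∀ {q q′ y z} → Out q → Out q′ → y ∈ t q → y ∉ t q′ → z ∈ t q → z ∉ t q′ → z ≡ y
  unique out out′ y∈ y∉ z∈ z∉ =
    let (y′ , y′∈ , y′∉) = exchanged out out′ y∈ y∉ in exchange-unique out out′ y∈ y∉ y′∈ y′∉ z∈ z∉

module FrameShape {R : Subset n} {M : Matroid n} {a b : Fin n} (F : Frame R M a b) where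

  open Frame F
  open FrameProperties F
  open FrameTrace F
  open FrameStructure F
  private
    module Swapped = FrameStructure (swapFrame F)

  -- The dual of `avoided` under the exchange of `a` and `b`.
  covered : ∀ {d} → d ∈ C → d ≢ a → d ≢ b → ∃[ q ] Out q × d ∈ t q
  covered {d} d∈C d≢a d≢b = let (q , out , d∉) = Swapped.avoided d∈C d≢b d≢a in
    q , out , decidable-stable (d ∈? t q) λ d∉t → d∉ (x∈p∩q⁺ (∈⊕ʳ (λ d∈s → d∉t (t⁺ d∈s d∈C)) d∈C , d∈C))

  -- Any other element of `C` lies in some trace but not in all of them. It is therefore exchanged
  -- between two traces, missed by the circuit of that exchange, and so real.
  virtual⇒end : ∀ {v} → v ∈ E M → v ∉ R → v ≡ a ⊎ v ≡ b
  virtual⇒end {v} v∈E v∉R with v ≟ a | v ≟ b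
  ... | yes v≡a | _       = inj₁ v≡a
  ... | no  _   | yes v≡b = inj₂ v≡b
  ... | no  v≢a | no  v≢b =
    let v∈C = virtual circ a∈C b∈C v∈E v∉R
        (q , out , v∈q) = covered v∈C v≢a v≢b
        (q′ , out′ , v∉q′) = avoided v∈C v≢a v≢b
        (y , y∈ , y∉) = exchanged out out′ v∈q v∉q′
    in contradiction (Incomparable.exchanged⇒real out out′ v∈q v∉q′ y∈ y∉) v∉R

  Single : Fin n → Set
  Single q = ∃[ d ] d ∈ t q × d ≢ a × (∀ {z} → z ∈ t q → z ≡ a ⊎ z ≡ d)

  Cosingle : Fin n → Set
  Cosingle q = ∃[ d ] d ∈ C × d ∉ t q × d ≢ b × (∀ {z} → z ∈ C → z ∉ t q → z ≡ b ⊎ z ≡ d)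

  -- Each other trace is t q - α + β, and any two of these exchanges share α or
  -- share β; but all α ≢ a in t q and all β ≢ b outside t q occur.
  not-both : ∀ {q d₁ d₂ e₁ e₂} → Out q → d₁ ∈ t q → d₂ ∈ t q → d₁ ≢ a → d₂ ≢ a → d₁ ≢ d₂ →
             e₁ ∈ C → e₂ ∈ C → e₁ ∉ t q → e₂ ∉ t q → e₁ ≢ b → e₂ ≢ b → e₁ ≢ e₂ → False
  not-both {q} {d₁} {d₂} {e₁} {e₂} out d₁∈ d₂∈ d₁≢a d₂≢a d₁≢d₂ e₁∈ e₂∈ e₁∉ e₂∉ e₁≢b e₂≢b e₁≢e₂ =
    let (q₁ , out₁ , d₁∉) = avoided (proj₂ (t⁻ d₁∈)) d₁≢a (≢b d₁∈)
        (q₂ , out₂ , d₂∉) = avoided (proj₂ (t⁻ d₂∈)) d₂≢a (≢b d₂∈)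
        (β₁ , β₁∈ , β₁∉) = exchanged out out₁ d₁∈ d₁∉
        (β₂ , β₂∈ , β₂∉) = exchanged out out₂ d₂∈ d₂∉
        β₁≡β₂ = decidable-stable (β₁ ≟ β₂) λ β₁≢β₂ →
          β₁∉ (subst (_∈ t q)
            (unique out₁ out₂ β₁∈ (λ β₁∈₂ → β₁≢β₂ (unique out₂ out β₂∈ β₂∉ β₁∈₂ β₁∉))
              (decidable-stable (d₂ ∈? t q₁) λ d₂∉₁ → d₁≢d₂ (unique out out₁ d₂∈ d₂∉₁ d₁∈ d₁∉)) d₂∉)
            d₂∈)
        (β , β∈C , β∉ , β≢b , β≢β₁) = third β₁
        (q₃ , out₃ , β∈₃) = covered β∈C (∈∉⇒≢ (t⁺ (a∈s out) a∈C) β∉ ∘ sym) β≢b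
    in d₁≢d₂ (unique out out₃ d₂∈ (missing out₂ out₃ d₂∈ d₂∉ β₂∈ β₂∉ β∈₃ β∉ (λ eq → β≢β₁ (trans eq (sym β₁≡β₂))))
                             d₁∈ (missing out₁ out₃ d₁∈ d₁∉ β₁∈ β₁∉ β∈₃ β∉ β≢β₁))
    where
    ≢b : ∀ {d} → d ∈ t q → d ≢ b
    ≢b d∈ refl = b∉s out (proj₁ (t⁻ d∈))
    third : ∀ β → ∃[ e ] e ∈ C × e ∉ t q × e ≢ b × e ≢ β
    third β with e₁ ≟ β
    ... | no  e₁≢β = e₁ , e₁∈ , e₁∉ , e₁≢b , e₁≢β
    ... | yes refl = e₂ , e₂∈ , e₂∉ , e₂≢b , e₁≢e₂ ∘ sym
    -- Here `t qᵢ` arises from `t q` by exchanging `d` for `β`. If `t q₃` gained `β′` but kept `d`,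
    -- it would lose some other `α`, and then `α` and `β` would be two elements of `t qᵢ ─ t q₃`.
    missing : ∀ {qᵢ q₃ d β β′} → Out qᵢ → Out q₃ → d ∈ t q → d ∉ t qᵢ → β ∈ t qᵢ → β ∉ t q →
              β′ ∈ t q₃ → β′ ∉ t q → β′ ≢ β → d ∉ t q₃
    missing {qᵢ} {q₃} outᵢ out₃ d∈ d∉ᵢ β∈ᵢ β∉ β′∈₃ β′∉ β′≢β d∈₃ =
      let (α , α∈ , α∉₃) = exchanged out₃ out β′∈₃ β′∉
          α∈ᵢ = decidable-stable (α ∈? t qᵢ) λ α∉ᵢ →
                  α∉₃ (subst (_∈ t q₃) (sym (unique out outᵢ d∈ d∉ᵢ α∈ α∉ᵢ)) d∈₃)
          β∉₃ = λ β∈₃ → β′≢β (unique out₃ out β∈₃ β∉ β′∈₃ β′∉)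
      in β∉ (subst (_∈ t q) (unique outᵢ out₃ β∈ᵢ β∉₃ α∈ᵢ α∉₃) α∈)

  single-or-cosingle : ∀ {q} → Out q → Single q ⊎ Cosingle q
  single-or-cosingle {q} out with trace-nontrivial out | cotrace-nontrivial out
  ... | d , d∈ , d≢a | e , e∈ , e∉ , e≢b
      with any? (λ z → (z ∈? t q) ×-dec ¬? (z ≟ a) ×-dec ¬? (z ≟ d))
         | any? (λ z → (z ∈? C) ×-dec ¬? (z ∈? t q) ×-dec ¬? (z ≟ b) ×-dec ¬? (z ≟ e))
  ...   | no none | _ = inj₁ (d , d∈ , d≢a , λ {z} z∈ → case z ≟ a of λ
            { (yes z≡a) → inj₁ z≡a
            ; (no z≢a) → inj₂ (decidable-stable (z ≟ d) λ z≢d → none (z , z∈ , z≢a , z≢d)) })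
  ...   | yes _ | no none = inj₂ (e , e∈ , e∉ , e≢b , λ {z} z∈ z∉ → case z ≟ b of λ
            { (yes z≡b) → inj₁ z≡b
            ; (no z≢b) → inj₂ (decidable-stable (z ≟ e) λ z≢e → none (z , z∈ , z∉ , z≢b , z≢e)) })
  ...   | yes (d′ , d′∈ , d′≢a , d′≢d) | yes (e′ , e′∈ , e′∉ , e′≢b , e′≢e) =
    ⊥-elim (not-both out d∈ d′∈ d≢a d′≢a (d′≢d ∘ sym) e∈ e′∈ e∉ e′∉ e≢b e′≢b (e′≢e ∘ sym))

  -- From the trace consisting of `a` and `d`, any other trace must lose `d`, as all traces contain
  -- `a`; it gains exactly one element in return.
  all-single : ∀ {q₀} → Out q₀ → Single q₀ → ∀ {q} → Out q → Single q
  all-single {q₀} out₀ single@(d , d∈ , d≢a , only) {q} out with q ≟ q₀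
  ... | yes refl = single
  ... | no  q≢q₀ =
    let (y , y∈ , y∉) = antichain out₀ out (q≢q₀ ∘ sym)
        (β , β∈ , β∉) = antichain out out₀ q≢q₀
        y≡d = [ (λ y≡a → contradiction (sym y≡a) (∈∉⇒≢ (t⁺ (a∈s out) a∈C) y∉)) , (λ y≡d → y≡d) ]′ (only y∈)
        d∉ = subst (_∉ t q) y≡d y∉
    in β , β∈ , ∈∉⇒≢ (t⁺ (a∈s out₀) a∈C) β∉ ∘ sym , λ {z} z∈ → case z ∈? t q₀ of λ
         { (yes z∈₀) → case only z∈₀ of λ { (inj₁ z≡a) → inj₁ z≡a ; (inj₂ z≡d) → contradiction (subst (_∈ t q) z≡d z∈) d∉ }
         ; (no  z∉₀) → inj₂ (unique out out₀ β∈ β∉ z∈ z∉₀) }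

cosingle⇒single : ∀ {R : Subset n} {M : Matroid n} {a b} (F : Frame R M a b) {q} →
  FrameShape.Cosingle F q → FrameShape.Single (swapFrame F) q
cosingle⇒single F {q} (d , d∈ , d∉ , d≢b , only) =
  d , x∈p∩q⁺ (∈⊕ʳ (λ d∈s → d∉ (t⁺ d∈s d∈)) d∈ , d∈) , d≢b , λ z∈ →
    let (z∈⊕ , z∈C) = x∈p∩q⁻ (s q ⊕ C) C z∈ in only z∈C λ z∈t → ∉⊕ᵇ (proj₁ (t⁻ z∈t)) z∈C z∈⊕
  where
  open Frame F
  open FrameProperties F

-- The circuit C consists of the tip, the element z and the elements d ≠ z of
-- the two-element legs {q, d}, of which q runs through the elements outside C.
record SpikeShape (M : Matroid n) (cs : CycleSpace M) : Set where
  open CycleSpace cs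
  field
    C          : Subset n
    tip z      : Fin n
    circ       : Circuit M C
    tip∈C      : tip ∈ C
    z∈C        : z ∈ C
    tip≢z      : tip ≢ z
    triangle   : Fin n → Subset n
    isCycle    : ∀ {q} → q ∈ E M → q ∉ C → Cycle (triangle q)
    q∈triangle : ∀ {q} → q ∈ E M → q ∉ C → q ∈ triangle q
    tip∈       : ∀ {q} → q ∈ E M → q ∉ C → tip ∈ triangle q
    leg        : ∀ {q} → q ∈ E M → q ∉ C → ∃[ d ] d ∈ C × d ≢ tip × d ≢ z × d ∈ triangle q ×
                   (∀ {x} → x ∈ triangle q → x ≡ q ⊎ x ≡ tip ⊎ x ≡ d)
    partner    : ∀ {d} → d ∈ C → d ≢ tip → d ≢ z → ∃[ q ] (q ∈ E M × q ∉ C) × d ∈ triangle q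
    two-legs   : ∃[ d ] ∃[ d′ ] (d ∈ C × d ≢ tip × d ≢ z) × (d′ ∈ C × d′ ≢ tip × d′ ≢ z) × d ≢ d′
    leg-unique : ∀ {q q′ d} → q ∈ E M → q ∉ C → q′ ∈ E M → q′ ∉ C → d ∈ C → d ≢ tip →
                   d ∈ triangle q → d ∈ triangle q′ → q ≡ q′

single⇒spikeShape : ∀ {R : Subset n} {M : Matroid n} {a b} (F : Frame R M a b) {q} → q ∈ E M → q ∉ Frame.C F →
  FrameShape.Single F q → SpikeShape M (Frame.cycleSpace F)
single⇒spikeShape {M = M} {a} {b} F q₀∈ q₀∉ single₀ = record
  { C = C ; tip = a ; z = b ; circ = circ ; tip∈C = a∈C ; z∈C = b∈C ; tip≢z = a≢b ; triangle = s
  ; isCycle = λ q∈ q∉ → s-cycle (q∈ , q∉) ; q∈triangle = λ q∈ q∉ → q∈s (q∈ , q∉) ; tip∈ = λ q∈ q∉ → a∈s (q∈ , q∉)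
  ; leg = λ q∈ q∉ → let (d , d∈ , d≢a , only) = all-single (q₀∈ , q₀∉) single₀ (q∈ , q∉) in
      d , proj₂ (t⁻ d∈) , d≢a , ∈∉⇒≢ (proj₁ (t⁻ d∈)) (b∉s (q∈ , q∉)) , proj₁ (t⁻ d∈) ,
      λ x∈ → case ∈-∪⁅⁆⁻ C (s⊆ (q∈ , q∉) x∈) of λ
        { (inj₁ x∈C) → inj₂ (only (t⁺ x∈ x∈C)) ; (inj₂ x≡q) → inj₁ x≡q }
  ; partner = λ d∈ d≢a d≢b → let (q , out , d∈t) = covered d∈ d≢a d≢b in q , out , proj₁ (t⁻ d∈t)
  -- One leg comes from inside the trace of `q₀`, the other from outside it. Together with `z` they
  -- will give the spike rank at least three.
  ; two-legs = let (d , d∈ , d≢a , _) = single₀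
                   (d′ , d′∈C , d′∉ , d′≢b) = cotrace-nontrivial (q₀∈ , q₀∉) in
      d , d′ , (proj₂ (t⁻ d∈) , d≢a , ∈∉⇒≢ (proj₁ (t⁻ d∈)) (b∉s (q₀∈ , q₀∉)))
             , (d′∈C , ∈∉⇒≢ (t⁺ (a∈s (q₀∈ , q₀∉)) a∈C) d′∉ ∘ sym , d′≢b) , ∈∉⇒≢ d∈ d′∉
  ; leg-unique = λ {q} {q′} q∈ q∉ q′∈ q′∉ d∈C d≢a d∈ d∈′ → decidable-stable (q ≟ q′) λ q≢q′ →
      let (e , e∈ , e≢a , only) = all-single (q₀∈ , q₀∉) single₀ (q∈ , q∉)
          (y , y∈ , y∉) = antichain (q∈ , q∉) (q′∈ , q′∉) q≢q′
          e≡y = [ (λ y≡a → contradiction (sym y≡a) (∈∉⇒≢ (t⁺ (a∈s (q′∈ , q′∉)) a∈C) y∉)) , sym ]′ (only y∈)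
          e≡d = [ (λ d≡a → contradiction d≡a d≢a) , sym ]′ (only (t⁺ d∈ d∈C))
      in y∉ (subst (_∈ t q′) (trans (sym e≡d) e≡y) (t⁺ d∈′ d∈C))
  }
  where
  open Frame F
  open FrameProperties F
  open FrameStructure F
  open FrameShape F

frame⇒spikeShape : ∀ {R : Subset n} {M : Matroid n} {a b} → Frame R M a b → Σ (CycleSpace M) (SpikeShape M)
frame⇒spikeShape F with FrameTrace.∃-out F
... | q , q∈ , q∉ with FrameShape.single-or-cosingle F (q∈ , q∉)
...   | inj₁ single   = _ , single⇒spikeShape F q∈ q∉ single
...   | inj₂ cosingle = _ , single⇒spikeShape (swapFrame F) q∈ q∉ (cosingle⇒single F cosingle)

-- Recognising spikes

module SpikeCycles (r : ℕ) where

  open VectorMatroid (spikeMatrix r) using (combination-⊕; combination-⁅⁆; combination-⊥)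

  x⁺ y⁺ : Fin r → Fin (r + (r + 1))
  x⁺ = spike-x
  y⁺ = spike-y
  t⁺ : Fin (r + (r + 1))
  t⁺ = spike-t {r}

  matrix-x : ∀ i k → spikeMatrix r (x⁺ i) k ≡ basisVector i k
  matrix-x i k rewrite Fin.splitAt-↑ˡ r i (r + 1) = refl

  matrix-y : ∀ i k → spikeMatrix r (y⁺ i) k ≡ basisVector i k xor true
  matrix-y i k rewrite Fin.splitAt-↑ʳ r (r + 1) (i ↑ˡ 1) | Fin.splitAt-↑ˡ r i 1 = refl

  matrix-t : ∀ k → spikeMatrix r t⁺ k ≡ true
  matrix-t k rewrite Fin.splitAt-↑ʳ r (r + 1) (r ↑ʳ zero) | Fin.splitAt-↑ʳ r 1 zero = refl

  data Position : Fin (r + (r + 1)) → Set where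
    at-x : ∀ i → Position (x⁺ i)
    at-y : ∀ i → Position (y⁺ i)
    at-t : Position t⁺

  position : ∀ j → Position j
  position j with splitAt r j in eq
  ... | inj₁ i = subst Position (Fin.splitAt⁻¹-↑ˡ eq) (at-x i)
  ... | inj₂ j′ with splitAt r j′ in eq′
  ...   | inj₁ i    = subst Position (trans (cong (r ↑ʳ_) (Fin.splitAt⁻¹-↑ˡ eq′)) (Fin.splitAt⁻¹-↑ʳ eq)) (at-y i)
  ...   | inj₂ zero = subst Position (trans (cong (r ↑ʳ_) (Fin.splitAt⁻¹-↑ʳ eq′)) (Fin.splitAt⁻¹-↑ʳ eq)) at-t

  IsCycle : Subset (r + (r + 1)) → Set
  IsCycle c = ∀ k → combination (spikeMatrix r) c k ≡ false

  isCycle-⊕ : ∀ c d → IsCycle c → IsCycle d → IsCycle (c ⊕ d)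
  isCycle-⊕ c d c≡0 d≡0 k = trans (combination-⊕ c d k) (cong₂ _xor_ (c≡0 k) (d≡0 k))

  triangle-isCycle : ∀ i → IsCycle ((⁅ x⁺ i ⁆ ⊕ ⁅ y⁺ i ⁆) ⊕ ⁅ t⁺ ⁆)
  triangle-isCycle i k = begin
    combination A ((⁅ x⁺ i ⁆ ⊕ ⁅ y⁺ i ⁆) ⊕ ⁅ t⁺ ⁆) k
      ≡⟨ combination-⊕ (⁅ x⁺ i ⁆ ⊕ ⁅ y⁺ i ⁆) ⁅ t⁺ ⁆ k ⟩
    combination A (⁅ x⁺ i ⁆ ⊕ ⁅ y⁺ i ⁆) k xor combination A ⁅ t⁺ ⁆ k
      ≡⟨ cong₂ _xor_ (combination-⊕ ⁅ x⁺ i ⁆ ⁅ y⁺ i ⁆ k) (trans (combination-⁅⁆ A t⁺ k) (matrix-t k)) ⟩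
    (combination A ⁅ x⁺ i ⁆ k xor combination A ⁅ y⁺ i ⁆ k) xor true
      ≡⟨ cong (_xor true) (cong₂ _xor_ (trans (combination-⁅⁆ A (x⁺ i) k) (matrix-x i k))
                                       (trans (combination-⁅⁆ A (y⁺ i) k) (matrix-y i k))) ⟩
    (δ xor (δ xor true)) xor true
      ≡⟨ cong (_xor true) (Bool.xor-assoc δ δ true) ⟨
    ((δ xor δ) xor true) xor true
      ≡⟨ cong (λ b → (b xor true) xor true) (Bool.xor-same δ) ⟩
    false ∎
    where
    open ≡-Reasoning
    A = spikeMatrix r
    δ = basisVector i k

  -- Among the columns other than the `y⁺ i`, only those of `x⁺ k` and the tip are nonzero in row
  -- `k`, so for this row `c` may be replaced by its part on these two.
  combination-no-y : ∀ c → (∀ i → y⁺ i ∉ c) → ∀ k →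
    combination (spikeMatrix r) c k ≡ lookup c (x⁺ k) xor lookup c t⁺
  combination-no-y c no-y k = begin
    combination A c k                                       ≡⟨ sum-cong-≗ pointwise ⟩
    combination A (α · ⁅ x⁺ k ⁆ ⊕ β · ⁅ t⁺ ⁆) k             ≡⟨ combination-⊕ (α · ⁅ x⁺ k ⁆) (β · ⁅ t⁺ ⁆) k ⟩
    combination A (α · ⁅ x⁺ k ⁆) k xor combination A (β · ⁅ t⁺ ⁆) k
      ≡⟨ cong₂ _xor_ (scaled α (x⁺ k) (trans (matrix-x k k) (diagonal k))) (scaled β t⁺ (matrix-t k)) ⟩
    α xor β                                                 ∎
    where
    open ≡-Reasoning
    A = spikeMatrix r
    α = lookup c (x⁺ k)
    β = lookup c t⁺
    diagonal : ∀ k → basisVector k k ≡ true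
    diagonal k with k ≟ k
    ... | yes _  = refl
    ... | no k≢k = contradiction refl k≢k
    scaled : ∀ ε j → A j k ≡ true → combination A (ε · ⁅ j ⁆) k ≡ ε
    scaled true  j eq = trans (combination-⁅⁆ A j k) eq
    scaled false j eq = combination-⊥ A k
    ·-at : ∀ ε j → lookup (ε · ⁅ j ⁆) j ≡ ε
    ·-at true  j = ∈⇒true (x∈⁅x⁆ j)
    ·-at false j = lookup-⊥ j
    ·-off : ∀ ε {j j′} → j ≢ j′ → lookup (ε · ⁅ j′ ⁆) j ≡ false
    ·-off true  j≢j′ = ∉⇒false (x≢y⇒x∉⁅y⁆ j≢j′)
    ·-off false {j} _ = lookup-⊥ j
    x≢t : ∀ {i} → x⁺ i ≢ t⁺
    x≢t {i} eq with () ← trans (sym (Fin.splitAt-↑ˡ r i (r + 1))) (trans (cong (splitAt r) eq) (Fin.splitAt-↑ʳ r (r + 1) (r ↑ʳ zero)))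
    off-diagonal : ∀ {i} → i ≢ k → A (x⁺ i) k ≡ false
    off-diagonal {i} i≢k = trans (matrix-x i k) (lemma i≢k)
      where
      lemma : i ≢ k → basisVector i k ≡ false
      lemma i≢k with i ≟ k
      ... | yes i≡k = contradiction i≡k i≢k
      ... | no  _   = refl
    pointwise : ∀ j → lookup c j ∧ A j k ≡ lookup (α · ⁅ x⁺ k ⁆ ⊕ β · ⁅ t⁺ ⁆) j ∧ A j k
    pointwise j with position j
    ... | at-y i = cong (_∧ A (y⁺ i) k) (trans (∉⇒false (no-y i)) (sym (trans (lookup-⊕ (α · ⁅ x⁺ k ⁆) (β · ⁅ t⁺ ⁆) _)
                     (cong₂ _xor_ (·-off α λ eq → y≢x eq) (·-off β λ eq → y≢t eq)))))
      where
      y≢x : ∀ {i k} → y⁺ i ≢ x⁺ k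
      y≢x {i} {k} eq with () ← trans (sym (Fin.splitAt-↑ʳ r (r + 1) (i ↑ˡ 1))) (trans (cong (splitAt r) eq) (Fin.splitAt-↑ˡ r k (r + 1)))
      y≢t : ∀ {i} → y⁺ i ≢ t⁺
      y≢t {i} eq with () ← trans (sym (Fin.splitAt-↑ˡ r i 1)) (trans (cong (splitAt r) (Fin.↑ʳ-injective r _ _ eq)) (Fin.splitAt-↑ʳ r 1 zero))
    ... | at-t = cong (_∧ A t⁺ k) (sym (trans (lookup-⊕ (α · ⁅ x⁺ k ⁆) (β · ⁅ t⁺ ⁆) _)
                     (cong₂ _xor_ (·-off α (x≢t ∘ sym)) (·-at β t⁺))))
    ... | at-x i with i ≟ k
    ...   | yes refl = cong (_∧ A (x⁺ i) i) (sym (trans (lookup-⊕ (α · ⁅ x⁺ k ⁆) (β · ⁅ t⁺ ⁆) _)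
                     (trans (cong₂ _xor_ (·-at α (x⁺ i)) (·-off β x≢t)) (Bool.xor-identityʳ α))))
    ...   | no i≢k = trans (vanish (lookup c (x⁺ i))) (sym (vanish (lookup (α · ⁅ x⁺ k ⁆ ⊕ β · ⁅ t⁺ ⁆) (x⁺ i))))
      where
      vanish : ∀ γ → γ ∧ A (x⁺ i) k ≡ false
      vanish γ = trans (cong (γ ∧_) (off-diagonal i≢k)) (Bool.∧-zeroʳ γ)

element-≡ : ∀ {M : Matroid n} {x y : Element M} → proj₁ x ≡ proj₁ y → x ≡ y
element-≡ {x = x , p} {y = _ , q} refl = cong (x ,_) (∈-irrelevant p q)

module SpikeIso {M : Matroid n} {cs : CycleSpace M} (shape : SpikeShape M cs) where

  open CycleSpace cs
  open SpikeShape shape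

  -- The elements that become x_1, ..., x_{r-1}. The element `z` becomes x_r, whose partner y_r is
  -- the deleted one; hence the rank is `suc s`.
  D : Subset n
  D = (C - tip) - z

  ∈D⁺ : ∀ {d} → d ∈ C → d ≢ tip → d ≢ z → d ∈ D
  ∈D⁺ d∈ d≢tip d≢z = x∈p∧x≢y⇒x∈p-y (x∈p∧x≢y⇒x∈p-y d∈ d≢tip) d≢z

  ∈D⁻ : ∀ {d} → d ∈ D → d ∈ C × d ≢ tip × d ≢ z
  ∈D⁻ d∈ = let (d∈′ , d≢z) = ∈-minus⁻ (C - tip) d∈ ; (d∈C , d≢tip) = ∈-minus⁻ C d∈′ in d∈C , d≢tip , d≢z

  s : ℕ
  s = ∣ D ∣

  open SpikeCycles (suc s)

  m : ℕ
  m = suc s + (suc s + 1)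

  yₛ : Fin m
  yₛ = y⁺ (fromℕ s)

  K : Matroid m
  K = delete (Z (suc s)) yₛ

  d : Fin s → Fin n
  d = enumerate D

  d∈D : ∀ i → d i ∈ C × d i ≢ tip × d i ≢ z
  d∈D i = ∈D⁻ (enumerate-∈ D i)

  partner-d : ∀ i → ∃[ q ] (q ∈ E M × q ∉ C) × d i ∈ triangle q
  partner-d i = let (d∈ , d≢tip , d≢z) = d∈D i in partner d∈ d≢tip d≢z

  q : Fin s → Fin n
  q = proj₁ ∘ partner-d

  q-out : ∀ i → q i ∈ E M × q i ∉ C
  q-out i = proj₁ (proj₂ (partner-d i))

  d∈triangle : ∀ i → d i ∈ triangle (q i)
  d∈triangle i = proj₂ (proj₂ (partner-d i))

  q-triangle : ∀ i {x} → x ∈ triangle (q i) → x ≡ q i ⊎ x ≡ tip ⊎ x ≡ d i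
  q-triangle i x∈ =
    let (e , e∈C , e≢tip , _ , _ , only) = leg (proj₁ (q-out i)) (proj₂ (q-out i))
        e≡d = case only (d∈triangle i) of λ
          { (inj₁ d≡q) → contradiction (subst (_∈ C) d≡q (proj₁ (d∈D i))) (proj₂ (q-out i))
          ; (inj₂ (inj₁ d≡tip)) → contradiction d≡tip (proj₁ (proj₂ (d∈D i)))
          ; (inj₂ (inj₂ d≡e)) → sym d≡e }
    in case only x∈ of λ
         { (inj₁ x≡q) → inj₁ x≡q ; (inj₂ (inj₁ x≡tip)) → inj₂ (inj₁ x≡tip) ; (inj₂ (inj₂ x≡e)) → inj₂ (inj₂ (trans x≡e e≡d)) }

  q-surjective : ∀ {x} → x ∈ E M → x ∉ C → ∃[ i ] q i ≡ x
  q-surjective x∈ x∉ =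
    let (e , e∈C , e≢tip , e≢z , e∈t , _) = leg x∈ x∉
        (i , di≡e) = enumerate-surjective D (∈D⁺ e∈C e≢tip e≢z)
    in i , leg-unique (proj₁ (q-out i)) (proj₂ (q-out i)) x∈ x∉ e∈C e≢tip
             (subst (_∈ triangle (q i)) di≡e (d∈triangle i)) e∈t

  q-injective : ∀ {i j} → q i ≡ q j → i ≡ j
  q-injective {i} {j} eq with q-triangle j (subst (λ x → d i ∈ triangle x) eq (d∈triangle i))
  ... | inj₁ d≡q          = contradiction (subst (_∈ C) d≡q (proj₁ (d∈D i))) (proj₂ (q-out j))
  ... | inj₂ (inj₁ d≡tip) = contradiction d≡tip (proj₁ (proj₂ (d∈D i)))
  ... | inj₂ (inj₂ d≡d)   = enumerate-injective D d≡d

  ψx ψy : Fin (suc s) → Fin n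
  ψx i with view i
  ... | ‵fromℕ     = z
  ... | ‵inject₁ j = d j
  -- the value at the deleted element yₛ is immaterial
  ψy i with view i
  ... | ‵fromℕ     = z
  ... | ‵inject₁ j = q j

  ψ : Fin m → Fin n
  ψ = [ ψx , [ ψy , (λ _ → tip) ]′ ∘ splitAt (suc s) ]′ ∘ splitAt (suc s)

  ψ-x : ∀ i → ψ (x⁺ i) ≡ ψx i
  ψ-x i rewrite Fin.splitAt-↑ˡ (suc s) i (suc s + 1) = refl

  ψ-y : ∀ i → ψ (y⁺ i) ≡ ψy i
  ψ-y i rewrite Fin.splitAt-↑ʳ (suc s) (suc s + 1) (i ↑ˡ 1) | Fin.splitAt-↑ˡ (suc s) i 1 = refl

  ψ-t : ψ t⁺ ≡ tip
  ψ-t rewrite Fin.splitAt-↑ʳ (suc s) (suc s + 1) (suc s ↑ʳ zero) | Fin.splitAt-↑ʳ (suc s) 1 zero = refl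

  data Kept : Fin m → Set where
    at-z : Kept (x⁺ (fromℕ s))
    at-d : ∀ i → Kept (x⁺ (inject₁ i))
    at-q : ∀ i → Kept (y⁺ (inject₁ i))
    at-t : Kept t⁺

  kept : ∀ {j} → j ≢ yₛ → Kept j
  kept {j} j≢ with position j
  ... | at-t = at-t
  ... | at-x i with view i
  ...   | ‵fromℕ     = at-z
  ...   | ‵inject₁ i = at-d i
  kept {j} j≢ | at-y i with view i
  ...   | ‵fromℕ     = contradiction refl j≢
  ...   | ‵inject₁ i = at-q i

  value : ∀ {j} → Kept j → Fin n
  value at-z     = z
  value (at-d i) = d i
  value (at-q i) = q i
  value at-t     = tip

  ψ-value : ∀ {j} (p : Kept j) → ψ j ≡ value p
  ψ-value at-z     = trans (ψ-x (fromℕ s)) lemma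
    where
    lemma : ψx (fromℕ s) ≡ z
    lemma rewrite view-fromℕ s = refl
  ψ-value (at-d i) = trans (ψ-x (inject₁ i)) lemma
    where
    lemma : ψx (inject₁ i) ≡ d i
    lemma rewrite view-inject₁ i = refl
  ψ-value (at-q i) = trans (ψ-y (inject₁ i)) lemma
    where
    lemma : ψy (inject₁ i) ≡ q i
    lemma rewrite view-inject₁ i = refl
  ψ-value at-t     = ψ-t

  value-injective : ∀ {j k} (p : Kept j) (p′ : Kept k) → value p ≡ value p′ → j ≡ k
  value-injective at-z     at-z     _  = refl
  value-injective at-z     (at-d i) eq = contradiction (sym eq) (proj₂ (proj₂ (d∈D i)))
  value-injective at-z     (at-q i) eq = contradiction (subst (_∈ C) eq z∈C) (proj₂ (q-out i))
  value-injective at-z     at-t     eq = contradiction (sym eq) tip≢z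
  value-injective (at-d i) at-z     eq = contradiction eq (proj₂ (proj₂ (d∈D i)))
  value-injective (at-d i) (at-d k) eq = cong (x⁺ ∘ inject₁) (enumerate-injective D eq)
  value-injective (at-d i) (at-q k) eq = contradiction (subst (_∈ C) eq (proj₁ (d∈D i))) (proj₂ (q-out k))
  value-injective (at-d i) at-t     eq = contradiction eq (proj₁ (proj₂ (d∈D i)))
  value-injective (at-q i) at-z     eq = contradiction (subst (_∈ C) (sym eq) z∈C) (proj₂ (q-out i))
  value-injective (at-q i) (at-d k) eq = contradiction (subst (_∈ C) (sym eq) (proj₁ (d∈D k))) (proj₂ (q-out i))
  value-injective (at-q i) (at-q k) eq = cong (y⁺ ∘ inject₁) (q-injective eq)
  value-injective (at-q i) at-t     eq = contradiction (subst (_∈ C) (sym eq) tip∈C) (proj₂ (q-out i))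
  value-injective at-t     at-z     eq = contradiction eq tip≢z
  value-injective at-t     (at-d i) eq = contradiction (sym eq) (proj₁ (proj₂ (d∈D i)))
  value-injective at-t     (at-q i) eq = contradiction (subst (_∈ C) eq tip∈C) (proj₂ (q-out i))
  value-injective at-t     at-t     _  = refl

  ψ-injective : ∀ {j k} → j ≢ yₛ → k ≢ yₛ → ψ j ≡ ψ k → j ≡ k
  ψ-injective j≢ k≢ eq = value-injective (kept j≢) (kept k≢)
    (trans (sym (ψ-value (kept j≢))) (trans eq (ψ-value (kept k≢))))

  x≢yₛ : ∀ i → x⁺ i ≢ yₛ
  x≢yₛ i eq with () ← trans (sym (Fin.splitAt-↑ˡ (suc s) i (suc s + 1)))
    (trans (cong (splitAt (suc s)) eq) (Fin.splitAt-↑ʳ (suc s) (suc s + 1) (fromℕ s ↑ˡ 1)))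

  t≢yₛ : t⁺ ≢ yₛ
  t≢yₛ eq with () ← trans (sym (Fin.splitAt-↑ʳ (suc s) 1 zero))
    (trans (cong (splitAt (suc s)) (Fin.↑ʳ-injective (suc s) _ _ eq)) (Fin.splitAt-↑ˡ (suc s) (fromℕ s) 1))

  y≢yₛ : ∀ i → y⁺ (inject₁ i) ≢ yₛ
  y≢yₛ i eq = Fin.fromℕ≢inject₁ (sym (Fin.↑ˡ-injective 1 _ _ (Fin.↑ʳ-injective (suc s) _ _ eq)))

  value∈E : ∀ {j} (p : Kept j) → value p ∈ E M
  value∈E at-z     = proj₁ circ z∈C
  value∈E (at-d i) = proj₁ circ (proj₁ (d∈D i))
  value∈E (at-q i) = proj₁ (q-out i)
  value∈E at-t     = proj₁ circ tip∈C

  ψ∈E : ∀ {j} → j ≢ yₛ → ψ j ∈ E M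
  ψ∈E j≢ = subst (_∈ E M) (sym (ψ-value (kept j≢))) (value∈E (kept j≢))

  ψ-surjective : ∀ {x} → x ∈ E M → ∃[ j ] j ≢ yₛ × ψ j ≡ x
  ψ-surjective {x} x∈ with x ≟ tip | x ≟ z | x ∈? C
  ... | yes refl | _        | _ = t⁺ , t≢yₛ , ψ-t
  ... | no _     | yes refl | _ = x⁺ (fromℕ s) , x≢yₛ (fromℕ s) , ψ-value at-z
  ... | no x≢tip | no x≢z   | yes x∈C = let (i , eq) = enumerate-surjective D (∈D⁺ x∈C x≢tip x≢z) in
    x⁺ (inject₁ i) , x≢yₛ (inject₁ i) , trans (ψ-value (at-d i)) eq
  ... | no _     | no _     | no x∉C = let (i , eq) = q-surjective x∈ x∉C in
    y⁺ (inject₁ i) , y≢yₛ i , trans (ψ-value (at-q i)) eq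

  inPull? : ∀ (X : Subset n) j → Dec (j ≢ yₛ × ψ j ∈ X)
  inPull? X j = ¬? (j ≟ yₛ) ×-dec (ψ j ∈? X)

  pull : Subset n → Subset m
  pull X = comprehension (inPull? X)

  pull⁺ : ∀ {X j} → j ≢ yₛ → ψ j ∈ X → j ∈ pull X
  pull⁺ {X} j≢ ψj∈ = ∈-comprehension⁺ (inPull? X) (j≢ , ψj∈)

  pull⁻ : ∀ {X j} → j ∈ pull X → j ≢ yₛ × ψ j ∈ X
  pull⁻ {X} = ∈-comprehension⁻ (inPull? X)

  pull-⊕ : ∀ X Y → pull (X ⊕ Y) ≡ pull X ⊕ pull Y
  pull-⊕ X Y = ⊆-antisym
    (λ j∈ → let (j≢ , ψj∈) = pull⁻ j∈ in case ∈⊕⁻ X Y ψj∈ of λ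
      { (inj₁ (∈X , ∉Y)) → ∈⊕ˡ (pull⁺ j≢ ∈X) (∉Y ∘ proj₂ ∘ pull⁻)
      ; (inj₂ (∉X , ∈Y)) → ∈⊕ʳ (∉X ∘ proj₂ ∘ pull⁻) (pull⁺ j≢ ∈Y) })
    (λ j∈ → case ∈⊕⁻ (pull X) (pull Y) j∈ of λ
      { (inj₁ (∈X , ∉Y)) → let (j≢ , ψj∈) = pull⁻ ∈X in pull⁺ j≢ (∈⊕ˡ ψj∈ (∉Y ∘ pull⁺ j≢))
      ; (inj₂ (∉X , ∈Y)) → let (j≢ , ψj∈) = pull⁻ ∈Y in pull⁺ j≢ (∈⊕ʳ (∉X ∘ pull⁺ j≢) ψj∈) })

  pull-triangle : ∀ i → pull (triangle (q i)) ≡ (⁅ x⁺ (inject₁ i) ⁆ ⊕ ⁅ y⁺ (inject₁ i) ⁆) ⊕ ⁅ t⁺ ⁆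
  pull-triangle i = ⊆-antisym
    (λ j∈ → let (j≢ , ψj∈) = pull⁻ j∈ in case q-triangle i ψj∈ of λ
      { (inj₁ ψ≡q) → at (ψ-injective j≢ (y≢yₛ i) (trans ψ≡q (sym (ψ-value (at-q i)))))
                       (∈⊕ˡ (∈⊕ʳ (x≢y⇒x∉⁅y⁆ (x≢y ∘ sym)) (x∈⁅x⁆ _)) (x≢y⇒x∉⁅y⁆ y≢t))
      ; (inj₂ (inj₁ ψ≡tip)) → at (ψ-injective j≢ t≢yₛ (trans ψ≡tip (sym ψ-t)))
                       (∈⊕ʳ (∉⊕ⁿ (x≢y⇒x∉⁅y⁆ (x≢t ∘ sym)) (x≢y⇒x∉⁅y⁆ (y≢t ∘ sym))) (x∈⁅x⁆ _))
      ; (inj₂ (inj₂ ψ≡d)) → at (ψ-injective j≢ (x≢yₛ (inject₁ i)) (trans ψ≡d (sym (ψ-value (at-d i)))))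
                       (∈⊕ˡ (∈⊕ˡ (x∈⁅x⁆ _) (x≢y⇒x∉⁅y⁆ x≢y)) (x≢y⇒x∉⁅y⁆ x≢t)) })
    (λ j∈ → case ∈⊕⁻ (⁅ x⁺ (inject₁ i) ⁆ ⊕ ⁅ y⁺ (inject₁ i) ⁆) ⁅ t⁺ ⁆ j∈ of λ
      { (inj₁ (j∈xy , _)) → case ∈⊕⁻ ⁅ x⁺ (inject₁ i) ⁆ ⁅ y⁺ (inject₁ i) ⁆ j∈xy of λ
          { (inj₁ (j∈x , _)) → at (x∈⁅y⁆⇒x≡y _ j∈x) (pull⁺ (x≢yₛ (inject₁ i)) (subst (_∈ triangle (q i)) (sym (ψ-value (at-d i))) (d∈triangle i)))
          ; (inj₂ (_ , j∈y)) → at (x∈⁅y⁆⇒x≡y _ j∈y) (pull⁺ (y≢yₛ i) (subst (_∈ triangle (q i)) (sym (ψ-value (at-q i)))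
                                  (q∈triangle (proj₁ (q-out i)) (proj₂ (q-out i))))) }
      ; (inj₂ (_ , j∈t)) → at (x∈⁅y⁆⇒x≡y _ j∈t) (pull⁺ t≢yₛ (subst (_∈ triangle (q i)) (sym ψ-t)
                                  (tip∈ (proj₁ (q-out i)) (proj₂ (q-out i))))) })
    where
    at : ∀ {X : Subset m} {j k} → j ≡ k → k ∈ X → j ∈ X
    at refl k∈ = k∈
    x≢y : x⁺ (inject₁ i) ≢ y⁺ (inject₁ i)
    x≢y eq = proj₂ (q-out i) (subst (_∈ C)
      (trans (sym (ψ-value (at-d i))) (trans (cong ψ eq) (ψ-value (at-q i)))) (proj₁ (d∈D i)))
    x≢t : x⁺ (inject₁ i) ≢ t⁺
    x≢t eq = proj₁ (proj₂ (d∈D i)) (trans (sym (ψ-value (at-d i))) (trans (cong ψ eq) ψ-t))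
    y≢t : y⁺ (inject₁ i) ≢ t⁺
    y≢t eq = proj₂ (q-out i) (subst (_∈ C)
      (sym (trans (sym (ψ-value (at-q i))) (trans (cong ψ eq) ψ-t))) tip∈C)

  pull-triangle-cycle : ∀ {x} → x ∈ E M → x ∉ C → IsCycle (pull (triangle x))
  pull-triangle-cycle x∈ x∉ with q-surjective x∈ x∉
  ... | i , refl = subst IsCycle (sym (pull-triangle i)) (triangle-isCycle (inject₁ i))

  cycle-⊥ : Cycle ⊥
  cycle-⊥ = subst Cycle (⊕-self C) (cycle-⊕ (circuit⇒cycle circ) (circuit⇒cycle circ))

  xor≡false : ∀ {α β} → α xor β ≡ false → α ≡ β
  xor≡false {true}  {true}  _ = refl
  xor≡false {false} {false} _ = refl

  -- Within C, both sides only know ⊥ and C.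
  base : ∀ {c} → c ⊆ C → Cycle c ⇔ IsCycle (pull c)
  base {c} c⊆C = mk⇔ forward backward
    where
    no-y : ∀ i → y⁺ i ∉ pull c
    no-y i y∈ with view i
    ... | ‵fromℕ     = proj₁ (pull⁻ y∈) refl
    ... | ‵inject₁ k = proj₂ (q-out k) (c⊆C (subst (_∈ c) (ψ-value (at-q k)) (proj₂ (pull⁻ y∈))))
    in-all : (∀ {x} → x ∈ C → x ∈ c) → ∀ k → lookup (pull c) (x⁺ k) ≡ lookup (pull c) t⁺
    in-all C⊆c k = trans (∈⇒true (pull⁺ (x≢yₛ k) (lemma (view k)))) (sym (∈⇒true (pull⁺ t≢yₛ (subst (_∈ c) (sym ψ-t) (C⊆c tip∈C)))))
      where
      lemma : ∀ {k} → View k → ψ (x⁺ k) ∈ c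
      lemma ‵fromℕ       = subst (_∈ c) (sym (ψ-value at-z)) (C⊆c z∈C)
      lemma (‵inject₁ i) = subst (_∈ c) (sym (ψ-value (at-d i))) (C⊆c (proj₁ (d∈D i)))
    forward : Cycle c → IsCycle (pull c)
    forward cyc k with cycle⊆circuit cyc circ c⊆C
    ... | inj₁ refl = trans (combination-no-y (pull ⊥) no-y k)
      (cong₂ _xor_ (∉⇒false (∉⊥ ∘ proj₂ ∘ pull⁻)) (∉⇒false (∉⊥ ∘ proj₂ ∘ pull⁻)))
    ... | inj₂ refl = trans (combination-no-y (pull C) no-y k)
      (trans (cong (_xor lookup (pull C) t⁺) (in-all (λ x∈ → x∈) k)) (Bool.xor-same (lookup (pull C) t⁺)))
    backward : IsCycle (pull c) → Cycle c
    backward cyc with tip ∈? c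
    ... | yes tip∈c = subst Cycle (⊆-antisym C⊆c c⊆C) (circuit⇒cycle circ)
      where
      all-x : ∀ k → ψ (x⁺ k) ∈ c
      all-x k = proj₂ (pull⁻ (true⇒∈ (trans (xor≡false (trans (sym (combination-no-y (pull c) no-y k)) (cyc k)))
                  (∈⇒true (pull⁺ t≢yₛ (subst (_∈ c) (sym ψ-t) tip∈c))))))
      C⊆c : C ⊆ c
      C⊆c {x} x∈C with x ≟ tip | x ≟ z
      ... | yes refl | _        = tip∈c
      ... | no _     | yes refl = subst (_∈ c) (ψ-value at-z) (all-x (fromℕ s))
      ... | no x≢tip | no x≢z   = let (i , eq) = enumerate-surjective D (∈D⁺ x∈C x≢tip x≢z) in
        subst (_∈ c) (trans (ψ-value (at-d i)) eq) (all-x (inject₁ i))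
    ... | no  tip∉c = subst Cycle (sym (⊆-antisym (λ x∈ → contradiction x∈ (c-empty x∈)) ⊥⊆)) cycle-⊥
      where
      no-x : ∀ k → ψ (x⁺ k) ∉ c
      no-x k ψ∈ = false⇒∉ (trans (xor≡false (trans (sym (combination-no-y (pull c) no-y k)) (cyc k)))
                    (∉⇒false λ t∈ → tip∉c (subst (_∈ c) ψ-t (proj₂ (pull⁻ t∈))))) (pull⁺ (x≢yₛ k) ψ∈)
      c-empty : ∀ {x} → x ∈ c → x ∉ c
      c-empty {x} x∈c with x ≟ tip | x ≟ z
      ... | yes refl | _        = tip∉c
      ... | no _     | yes refl = subst (_∉ c) (ψ-value at-z) (no-x (fromℕ s))
      ... | no x≢tip | no x≢z   = let (i , eq) = enumerate-surjective D (∈D⁺ (c⊆C x∈c) x≢tip x≢z) in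
        subst (_∉ c) (trans (ψ-value (at-d i)) eq) (no-x (inject₁ i))

  -- Induction on the number of elements of `c` outside `C`. The triangle of such an element is a
  -- cycle on both sides, and adding it removes that element without bringing in another one outside
  -- `C`.
  transport : ∀ k {c} → ∣ c ─ C ∣ ≤ k → c ⊆ E M → Cycle c ⇔ IsCycle (pull c)
  transport k {c} size c⊆E with any? (λ x → (x ∈? c) ×-dec ¬? (x ∈? C))
  ... | no none = base λ {x} x∈ → decidable-stable (x ∈? C) λ x∉ → none (x , x∈ , x∉)
  transport zero {c} size c⊆E | yes (x , x∈c , x∉C) =
    contradiction (ℕ.≤-trans (ℕ.≤-reflexive (sym (∣⁅x⁆∣≡1 x)))
      (ℕ.≤-trans (p⊆q⇒∣p∣≤∣q∣ λ z∈ → subst (_∈ c ─ C) (sym (x∈⁅y⁆⇒x≡y x z∈)) (x∈p∧x∉q⇒x∈p─q x∈c x∉C)) size)) λ ()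
  transport (suc k) {c} size c⊆E | yes (x , x∈c , x∉C) = mk⇔
    (λ cyc → subst IsCycle (trans (cong (_⊕ pull T) (pull-⊕ c T)) (⊕-cancelʳ (pull c) (pull T)))
      (isCycle-⊕ (pull (c ⊕ T)) (pull T) (⇒ smaller (cycle-⊕ cyc T-cycle)) pullT))
    (λ cyc → subst Cycle (⊕-cancelʳ c T)
      (cycle-⊕ (⇐ smaller (subst IsCycle (sym (pull-⊕ c T)) (isCycle-⊕ (pull c) (pull T) cyc pullT))) T-cycle))
    where
    T : Subset n
    T = triangle x
    T-cycle : Cycle T
    T-cycle = isCycle (c⊆E x∈c) x∉C
    pullT : IsCycle (pull T)
    pullT = pull-triangle-cycle (c⊆E x∈c) x∉C
    shrinks : (c ⊕ T) ─ C ⊂ c ─ C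
    shrinks = (λ {w} w∈ → let (w∈⊕ , w∉C) = ∈-diff⁻ (c ⊕ T) C w∈ in case ∈⊕⁻ c T w∈⊕ of λ
        { (inj₁ (w∈c , _)) → x∈p∧x∉q⇒x∈p─q w∈c w∉C
        ; (inj₂ (w∉c , w∈T)) → let (e , e∈C , _ , _ , _ , only) = leg (c⊆E x∈c) x∉C in case only w∈T of λ
            { (inj₁ refl) → contradiction x∈c w∉c
            ; (inj₂ (inj₁ refl)) → contradiction tip∈C w∉C
            ; (inj₂ (inj₂ w≡e)) → contradiction (subst (_∈ C) (sym w≡e) e∈C) w∉C } })
      , x , x∈p∧x∉q⇒x∈p─q x∈c x∉C
      , λ x∈ → ∉⊕ᵇ x∈c (q∈triangle (c⊆E x∈c) x∉C) (proj₁ (∈-diff⁻ (c ⊕ T) C x∈))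
    smaller : Cycle (c ⊕ T) ⇔ IsCycle (pull (c ⊕ T))
    smaller = transport k (s≤s⁻¹ (ℕ.<-≤-trans (p⊂q⇒∣p∣<∣q∣ shrinks) size)) (⊕⊆ c⊆E (cycle⊆E T-cycle))

  pull-cycle : ∀ {c} → c ⊆ E M → Cycle c ⇔ IsCycle (pull c)
  pull-cycle = transport _ ℕ.≤-refl

  inPush? : ∀ (v : Subset m) x → Dec (∃[ j ] j ∈ v × j ≢ yₛ × ψ j ≡ x)
  inPush? v x = any? λ j → (j ∈? v) ×-dec ¬? (j ≟ yₛ) ×-dec (ψ j ≟ x)

  push : Subset m → Subset n
  push v = comprehension (inPush? v)

  pull-push : ∀ {v} → yₛ ∉ v → pull (push v) ≡ v
  pull-push {v} yₛ∉ = ⊆-antisym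
    (λ {j} j∈ → let (j≢ , ψj∈) = pull⁻ j∈ ; (i , i∈ , i≢ , eq) = ∈-comprehension⁻ (inPush? v) ψj∈
                in subst (_∈ v) (ψ-injective i≢ j≢ eq) i∈)
    (λ {j} j∈ → let j≢ = ∈∉⇒≢ j∈ yₛ∉ in pull⁺ j≢ (∈-comprehension⁺ (inPush? v) (j , j∈ , j≢ , refl)))

  -- Independence is governed by cycles on both sides: a nonzero dependence within `pull X` pushes
  -- to a cycle within `X`, and a circuit within `X` pulls to a dependence.
  pull-preserves : ∀ X → X ⊆ E M → Indep M X ⇔ Indep K (pull X)
  pull-preserves X X⊆E = mk⇔
    (λ ind → (λ v v⊆ v≡0 → case v ≟ˢ ⊥ of λ
        { (yes v≡⊥) → v≡⊥
        ; (no v≢⊥) →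
            let (j , j∈) = ≢⊥⇒∈ v≢⊥
                yₛ∉ = λ yₛ∈ → proj₁ (pull⁻ (v⊆ yₛ∈)) refl
                push⊆ : push v ⊆ X
                push⊆ x∈ = let (i , i∈ , _ , eq) = ∈-comprehension⁻ (inPush? v) x∈ in subst (_∈ X) eq (proj₂ (pull⁻ (v⊆ i∈)))
                cyc = ⇐ (pull-cycle λ x∈ → X⊆E (push⊆ x∈)) (subst IsCycle (sym (pull-push yₛ∉)) v≡0)
            in contradiction (Matroid.indep-⊆ M ind push⊆)
                 (cycle⇒dependent cyc (∈⇒≢⊥ (∈-comprehension⁺ (inPush? v) (j , j∈ , ∈∉⇒≢ j∈ yₛ∉ , refl)))) })
      , λ yₛ∈ → proj₁ (pull⁻ yₛ∈) refl)
    (λ { (ind , _) → decidable-stable (indep? M X) (independent ind) })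
    where
    independent : LinearlyIndependent (spikeMatrix (suc s)) (pull X) → ¬ ¬ Indep M X
    independent ind dep =
      let (c , circ-c , c⊆X) = dependent⇒circuit M X⊆E dep
          (x , x∈c) = ≢⊥⇒∈ (circuit≢⊥ M circ-c)
          (j , j≢ , ψj≡x) = ψ-surjective (X⊆E (c⊆X x∈c))
          pull⊆ : pull c ⊆ pull X
          pull⊆ i∈ = let (i≢ , ψi∈) = pull⁻ i∈ in pull⁺ i≢ (c⊆X ψi∈)
      in ∈⇒≢⊥ (pull⁺ j≢ (subst (_∈ c) (sym ψj≡x) x∈c))
           (ind (pull c) pull⊆ (⇒ (pull-cycle (proj₁ circ-c)) (circuit⇒cycle circ-c)))

  ∈K : ∀ {j} → j ≢ yₛ → j ∈ E K
  ∈K j≢ = x∈p∧x≢y⇒x∈p-y ∈⊤ j≢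

  ≢yₛ : ∀ {j} → j ∈ E K → j ≢ yₛ
  ≢yₛ j∈ = proj₂ (∈-minus⁻ ⊤ j∈)

  spike : M ≅ K
  spike = record
    -- The correspondence of elements leaves `pull X` as the only possible `Y`.
    { φ = φ
    ; preserves = λ X Y X⊆ Y⊆ corr → subst (λ W → Indep M X ⇔ Indep K W)
        (⊆-antisym
          (λ {j} j∈ → let (j≢ , ψj∈) = pull⁻ j∈ in
            subst (_∈ Y) (cong proj₁ (Inverse.strictlyInverseˡ φ (j , ∈K j≢))) (⇒ (corr (ψ j , ψ∈E j≢)) ψj∈))
          (λ {j} j∈ → let j≢ = ≢yₛ (Y⊆ j∈) in
            pull⁺ j≢ (⇐ (corr (ψ j , ψ∈E j≢)) (subst (_∈ Y) (sym (cong proj₁ (Inverse.strictlyInverseˡ φ (j , ∈K j≢)))) j∈))))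
        (pull-preserves X X⊆)
    }
    where
    to : Element M → Element K
    to (x , x∈) = let (j , j≢ , _) = ψ-surjective x∈ in j , ∈K j≢
    from : Element K → Element M
    from (j , j∈) = ψ j , ψ∈E (≢yₛ j∈)
    φ : Element M ↔ Element K
    φ = mk↔ₛ′ to from
      (λ { (j , j∈) → let (i , i≢ , eq) = ψ-surjective (ψ∈E (≢yₛ j∈)) in element-≡ {M = K} (ψ-injective i≢ (≢yₛ j∈) eq) })
      (λ { (x , x∈) → element-≡ {M = M} (proj₂ (proj₂ (ψ-surjective x∈))) })

spikeShape⇒isSpikeMinusY : ∀ {M : Matroid n} {cs} → SpikeShape M cs → IsSpikeMinusY M
spikeShape⇒isSpikeMinusY shape =
  let (d , d′ , (d∈ , d≢tip , d≢z) , (d′∈ , d′≢tip , d′≢z) , d≢d′) = SpikeShape.two-legs shape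
  in SpikeIso.s shape
   , s≤s (two≤ (SpikeIso.∈D⁺ shape d∈ d≢tip d≢z) (SpikeIso.∈D⁺ shape d′∈ d′≢tip d′≢z) d≢d′)
   , SpikeIso.spike shape

-- Classification of the labels

≅U⇒size : ∀ {M : Matroid n} {j k} → M ≅ U j k → ∣ E M ∣ ≡ k
≅U⇒size {n} {M} {j} {k} iso = ℕ.≤-antisym
  (Fin.injective⇒≤ {f = λ i → proj₁ (to (element i))} λ {i} {i′} eq →
    enumerate-injective (E M) (cong proj₁ (injective (element-≡ {M = U j k} eq))))
  (Fin.injective⇒≤ {f = λ i → proj₁ (index i)} λ {i} {i′} eq →
    cong proj₁ (from-injective (element-≡ {M = M}
      (trans (sym (proj₂ (index i))) (trans (cong (enumerate (E M)) eq) (proj₂ (index i′)))))))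
  where
  open _≅_ iso
  open Inverse φ using (to; from; strictlyInverseˡ; strictlyInverseʳ)
  element : Fin ∣ E M ∣ → Element M
  element i = enumerate (E M) i , enumerate-∈ (E M) i
  injective : ∀ {x y} → to x ≡ to y → x ≡ y
  injective {x} {y} eq = trans (sym (strictlyInverseʳ x)) (trans (cong from eq) (strictlyInverseʳ y))
  from-injective : ∀ {x y} → from x ≡ from y → x ≡ y
  from-injective {x} {y} eq = trans (sym (strictlyInverseˡ x)) (trans (cong to eq) (strictlyInverseˡ y))
  index : ∀ (i : Fin k) → ∃[ l ] enumerate (E M) l ≡ proj₁ (from (i , ∈⊤))
  index i = enumerate-surjective (E M) (proj₂ (from (i , ∈⊤)))

cocircuit⇒parallel : ∀ {M : Matroid n} {k x y} → M ≅ U 1 k → x ∈ E M → y ∈ E M → x ≢ y → Circuit M (⁅ x ⁆ ∪ ⁅ y ⁆)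
cocircuit⇒parallel {M = M} {k} {x} {y} iso x∈ y∈ x≢y =
    pair⊆E x∈ y∈
  , (λ ind → ℕ.<⇒≱ (two≤ {p = pair̂} ∈-pairˡ (∈-∪⁅⁆ _) λ eq → x≢y (cong proj₁ (injective (element-≡ {M = U 1 k} eq))))
               (⇒ (preserves _ pair̂ (pair⊆E x∈ y∈) ⊆⊤ corresponds) ind))
  , λ { D (D⊆ , w , w∈ , w∉D) → case ∈-pair⁻ w∈ of λ
        { (inj₁ refl) → Matroid.indep-⊆ M (single y∈) λ z∈ → case ∈-pair⁻ (D⊆ z∈) of λ
            { (inj₁ refl) → contradiction z∈ w∉D ; (inj₂ refl) → x∈⁅x⁆ _ }
        ; (inj₂ refl) → Matroid.indep-⊆ M (single x∈) λ z∈ → case ∈-pair⁻ (D⊆ z∈) of λ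
            { (inj₁ refl) → x∈⁅x⁆ _ ; (inj₂ refl) → contradiction z∈ w∉D } } }
  where
  open _≅_ iso
  open Inverse φ using (to; from; strictlyInverseʳ)
  injective : ∀ {x y} → to x ≡ to y → x ≡ y
  injective {x} {y} eq = trans (sym (strictlyInverseʳ x)) (trans (cong from eq) (strictlyInverseʳ y))
  to-≡ : ∀ {v w} {p : v ∈ E M} {q : w ∈ E M} → v ≡ w → proj₁ (to (v , p)) ≡ proj₁ (to (w , q))
  to-≡ eq = cong (proj₁ ∘ to) (element-≡ {M = M} eq)
  to-≡⁻ : ∀ {v w} {p : v ∈ E M} {q : w ∈ E M} → proj₁ (to (v , p)) ≡ proj₁ (to (w , q)) → v ≡ w
  to-≡⁻ eq = cong proj₁ (injective (element-≡ {M = U 1 k} eq))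
  pair̂ : Subset k
  pair̂ = ⁅ proj₁ (to (x , x∈)) ⁆ ∪ ⁅ proj₁ (to (y , y∈)) ⁆
  pair⊆E : ∀ {x y} → x ∈ E M → y ∈ E M → ⁅ x ⁆ ∪ ⁅ y ⁆ ⊆ E M
  pair⊆E x∈ y∈ z∈ = [ (λ { refl → x∈ }) , (λ { refl → y∈ }) ]′ (∈-pair⁻ z∈)
  corresponds : ∀ w → proj₁ w ∈ ⁅ x ⁆ ∪ ⁅ y ⁆ ⇔ proj₁ (to w) ∈ pair̂
  corresponds (w , w∈) = mk⇔
    (λ w∈p → [ (λ eq → ∈-∪ˡ (≡⇒∈⁅⁆ (to-≡ eq)))
             , (λ eq → ∈-∪ʳ (≡⇒∈⁅⁆ (to-≡ eq))) ]′ (∈-pair⁻ w∈p))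
    (λ w∈p → [ (λ eq → ∈-∪ˡ (≡⇒∈⁅⁆ (to-≡⁻ eq)))
             , (λ eq → ∈-∪ʳ (≡⇒∈⁅⁆ (to-≡⁻ eq))) ]′ (∈-pair⁻ w∈p))
  single : ∀ {v} → v ∈ E M → Indep M ⁅ v ⁆
  single {v} v∈ = ⇐ (preserves ⁅ v ⁆ ⁅ proj₁ (to (v , v∈)) ⁆ (λ z∈ → subst (_∈ E M) (sym (x∈⁅y⁆⇒x≡y v z∈)) v∈) ⊆⊤
      λ { (w , w∈) → mk⇔ (λ z∈ → ≡⇒∈⁅⁆ (to-≡ (x∈⁅y⁆⇒x≡y v z∈)))
                         (λ z∈ → ≡⇒∈⁅⁆ (to-≡⁻ (x∈⁅y⁆⇒x≡y _ z∈))) })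
    (ℕ.≤-reflexive (∣⁅x⁆∣≡1 (proj₁ (to (v , v∈)))))

-- Virtual elements correspond to tree edges, so such a vertex meets at most two edges, one towards
-- `e` and one towards `f`.
OnPath : Subset n → Matroid n → Fin n → Fin n → Set
OnPath R M a b = a ≢ b × (∀ {v} → v ∈ E M → v ∉ R → v ≡ a ⊎ v ≡ b)

-- Any two elements form a circuit. The pair `a`, `b` is one that contains all virtual elements, so
-- any third element is real; a fourth element, or a real mark, would be real and parallel to it. If
-- `a ≡ b`, each of two further elements is missed by the pair of `a` with the other, so both are
-- real and parallel.
cocircuit-onPath : ∀ {R} {M : Matroid n} {a b k} → Marked R M a b → 3 ≤ ∣ E M ∣ → M ≅ U 1 k →
  OnPath R M a b × ¬ 4 ≤ ∣ E M ∣ × a ∉ R × b ∉ R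
cocircuit-onPath {n} {R} {M} {a} {b} m 3≤ iso = (a≢b , virtual⇒end) , not-four , not-real a∈E c≢a , not-real b∈E c≢b
  where
  open Marked m
  parallel : ∀ {x y} → x ∈ E M → y ∈ E M → x ≢ y → Circuit M (⁅ x ⁆ ∪ ⁅ y ⁆)
  parallel = cocircuit⇒parallel iso
  a≢b : a ≢ b
  a≢b refl =
    let (x , x∈ , x≢) = fresh {k = 1} (E M) (λ _ → a) (ℕ.≤-trans (ℕ.n≤1+n 2) 3≤)
        (y , y∈ , y≢) = fresh {k = 2} (E M) (λ { zero → a ; (suc _) → x }) 3≤
        x≢y = λ eq → y≢ (suc zero) (sym eq)
        real : ∀ {v w} → v ∈ E M → w ∈ E M → a ≢ w → v ≢ a → v ≢ w → v ∈ R
        real v∈ w∈ a≢w v≢a v≢w = decidable-stable (_ ∈? R) λ v∉R →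
          [ v≢a , v≢w ]′ (∈-pair⁻ (virtual (parallel a∈E w∈ a≢w) ∈-pairˡ ∈-pairˡ v∈ v∉R))
    in simple (real x∈ y∈ (λ eq → y≢ zero (sym eq)) (x≢ zero) x≢y)
              (real y∈ x∈ (λ eq → x≢ zero (sym eq)) (y≢ zero) (λ eq → x≢y (sym eq))) x≢y (parallel x∈ y∈ x≢y)
  virtual⇒end : ∀ {v} → v ∈ E M → v ∉ R → v ≡ a ⊎ v ≡ b
  virtual⇒end v∈ v∉R = ∈-pair⁻ (virtual (parallel a∈E b∈E a≢b) ∈-pairˡ (∈-∪⁅⁆ b) v∈ v∉R)
  third : ∃[ c ] c ∈ E M × c ≢ a × c ≢ b
  third = let (c , c∈ , c≢) = fresh {k = 2} (E M) (λ { zero → a ; (suc _) → b }) 3≤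
          in c , c∈ , c≢ zero , c≢ (suc zero)
  c : Fin n
  c = proj₁ third
  c∈E : c ∈ E M
  c∈E = proj₁ (proj₂ third)
  c≢a : c ≢ a
  c≢a = proj₁ (proj₂ (proj₂ third))
  c≢b : c ≢ b
  c≢b = proj₂ (proj₂ (proj₂ third))
  real : ∀ {v} → v ∈ E M → v ≢ a → v ≢ b → v ∈ R
  real v∈ v≢a v≢b = decidable-stable (_ ∈? R) λ v∉R → [ v≢a , v≢b ]′ (virtual⇒end v∈ v∉R)
  not-four : ¬ 4 ≤ ∣ E M ∣
  not-four 4≤ =
    let (c′ , c′∈ , c′≢) = fresh {k = 3} (E M) (λ { zero → a ; (suc zero) → b ; (suc (suc _)) → c }) 4≤ in
    simple (real c∈E c≢a c≢b) (real c′∈ (c′≢ zero) (c′≢ (suc zero))) (λ eq → c′≢ (suc (suc zero)) (sym eq))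
      (parallel c∈E c′∈ λ eq → c′≢ (suc (suc zero)) (sym eq))
  not-real : ∀ {x} → x ∈ E M → c ≢ x → x ∉ R
  not-real x∈ c≢x x∈R = simple (real c∈E c≢a c≢b) x∈R c≢x (parallel c∈E x∈ c≢x)

threeConnected-onPath : ∀ {R} {M : Matroid n} {a b} → Marked R M a b → Connected M → ThreeConnected M →
  4 ≤ ∣ E M ∣ → OnPath R M a b × IsSpikeMinusY M
threeConnected-onPath {n} {R} {M} {a} {b} m conn three 4≤ =
    (a≢b , FrameShape.virtual⇒end F)
  , spikeShape⇒isSpikeMinusY (proj₂ (frame⇒spikeShape F))
  where
  open Marked m
  loopless : ∀ {x} → x ∈ E M → ¬ Circuit M ⁅ x ⁆
  loopless {x} x∈ = let (y , y∈ , x≢y) = other x (ℕ.≤-trans (s≤s (s≤s z≤n)) 4≤)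
                    in connected⇒loopless M conn x∈ y∈ x≢y
  -- If a ≡ b, then M is a circuit.
  a≢b : a ≢ b
  a≢b refl =
    let (d , d∈E , d≢) = fresh {k = 1} (E M) (λ _ → a) (ℕ.≤-trans (s≤s (s≤s z≤n)) 4≤)
        (C , circ , a∈C , d∈C) = conn a d a∈E d∈E (λ eq → d≢ zero (sym eq))
        (y  , y∈  , y≢)  = fresh {k = 2} (E M) (λ { zero → a ; (suc _) → d }) (ℕ.≤-trans (s≤s (s≤s (s≤s z≤n))) 4≤)
        (y′ , y′∈ , y′≢) = fresh {k = 3} (E M) (λ { zero → a ; (suc zero) → d ; (suc (suc _)) → y }) 4≤
        E⊆C : ∀ {q} → q ∈ E M → q ∈ C
        E⊆C q∈ = decidable-stable (_ ∈? C) λ q∉ →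
          let (c , _ , _ , _ , a∈c , a∉c) = Theta.separating m loopless circ a∈C a∈C q∈ q∉ in a∉c a∈c
        y∉ = λ y∈X → [ y≢ zero , y≢ (suc zero) ]′ (∈-pair⁻ y∈X)
        y′∉ = λ y∈X → [ y′≢ zero , y′≢ (suc zero) ]′ (∈-pair⁻ y∈X)
        X⊆E : ⁅ a ⁆ ∪ ⁅ d ⁆ ⊆ E M
        X⊆E z∈ = [ (λ eq → subst (_∈ E M) (sym eq) a∈E) , (λ eq → subst (_∈ E M) (sym eq) d∈E) ]′ (∈-pair⁻ z∈)
    in circuit-cut M three {X = ⁅ a ⁆ ∪ ⁅ d ⁆} circ X⊆E
         (two≤ ∈-pairˡ (∈-∪⁅⁆ d) (λ eq → d≢ zero (sym eq)))
         (two≤ (x∈p∧x∉q⇒x∈p─q y∈ y∉) (x∈p∧x∉q⇒x∈p─q y′∈ y′∉) (λ eq → y′≢ (suc (suc zero)) (sym eq)))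
         (a , a∈C , ∈-pairˡ) (y , E⊆C y∈ , y∉)
         (λ x∈X x∉C → contradiction (E⊆C (X⊆E x∈X)) x∉C)
         (λ x∈E _ x∉C → contradiction (E⊆C x∈E) x∉C)
  F : Frame R M a b
  F = mkFrame m conn three 4≤ a≢b

-- A circuit may at this stage have any number of virtual elements; `orient` needs the restriction
-- for the other labels only.
Kind : Subset n → Matroid n → Fin n → Fin n → Set
Kind R M a b = (∃[ k ] 3 ≤ k × CircuitOfSize k M) ⊎ (OnPath R M a b × (M ≅ U 1 3 ⊎ IsSpikeMinusY M))

classify : ∀ {R} {M : Matroid n} {a b} → Marked R M a b → Connected M → 3 ≤ ∣ E M ∣ →
  IsCircuit M ⊎ IsCocircuit M ⊎ (ThreeConnected M × 4 ≤ ∣ E M ∣) → Kind R M a b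
classify m conn 3≤ (inj₁ (k , _ , iso)) = inj₁ (k , subst (3 ≤_) (≅U⇒size iso) 3≤ , iso)
classify {M = M} m conn 3≤ (inj₂ (inj₁ (k , _ , iso))) =
  let (onPath , not-four , _) = cocircuit-onPath m 3≤ iso
      k≡3 = trans (sym (≅U⇒size iso)) (ℕ.≤-antisym (s≤s⁻¹ (ℕ.≰⇒> not-four)) 3≤)
  in inj₂ (onPath , inj₁ (subst (λ k → M ≅ U 1 k) k≡3 iso))
classify m conn 3≤ (inj₂ (inj₂ (three , 4≤))) =
  let (onPath , spike) = threeConnected-onPath m conn three 4≤ in inj₂ (onPath , inj₂ spike)

-- Contracting the tree

project-in : ∀ (M : Matroid n) {p x} → x ∈ E M → project M p x ≡ x
project-in M {x = x} x∈ with x ∈? E M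
... | yes _  = refl
... | no  x∉ = contradiction x∈ x∉

project-out : ∀ (M : Matroid n) {p x} → x ∉ E M → project M p x ≡ p
project-out M {x = x} x∉ with x ∈? E M
... | yes x∈ = contradiction x∈ x∉
... | no  _  = refl

-- The facts about a tree decomposition that are carried along when edges are contracted.
record Sound {n m} (G : LabelledGraph n m) (R : Subset n) : Set where
  open LabelledGraph G
  field
    edge∉R         : ∀ c → edge c ∉ R
    edge-injective : ∀ {c d} → edge c ≡ edge d → c ≡ d
    edge∈          : ∀ c → edge c ∈ E (label (proj₁ (ends c))) × edge c ∈ E (label (proj₂ (ends c)))

-- mark w is the element of the label of w in whose direction e lies.
record Marking {n m} (G : LabelledGraph n m) (e : Fin n) : Set where
  open LabelledGraph G
  field
    mark      : Fin (suc m) → Fin n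
    mark-at   : ∀ {w} → e ∈ E (label w) → mark w ≡ e
    mark-edge : ∀ c → (mark (proj₁ (ends c)) ≡ edge c × mark (proj₂ (ends c)) ≢ edge c) ⊎
                      (mark (proj₁ (ends c)) ≢ edge c × mark (proj₂ (ends c)) ≡ edge c)

record MarkedTree {n m} (G : LabelledGraph n m) (R : Subset n) (e f : Fin n) : Set₁ where
  open LabelledGraph G
  field
    toward-e : Marking G e
    toward-f : Marking G f
    marked   : ∀ w → Marked R (label w) (Marking.mark toward-e w) (Marking.mark toward-f w)

module Expand {n m} (G : LabelledGraph n (suc m)) (d : Fin (suc m)) {N : Matroid n}
              (s≢t : Contraction.source G d ≢ Contraction.target G d)
              (S : Contraction.ComposedBy G d N) {R : Subset n} (sound : Sound G R) where

  open LabelledGraph G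
  open Contraction G d
  open Sound sound
  open TwoSum S
  private
    p : Fin n
    p = edge d
    G′ : LabelledGraph n m
    G′ = contract s≢t N
    module G′ = LabelledGraph G′
    g : Fin (suc (suc m)) → Fin (suc m)
    g = mergeVertex s≢t

  punchIn-g-target : punchIn target (g target) ≡ source
  punchIn-g-target with target ≟ target
  ... | yes _  = Fin.punchIn-punchOut (s≢t ∘ sym)
  ... | no t≢t = contradiction refl t≢t

  punchIn-g : ∀ {w} → target ≢ w → punchIn target (g w) ≡ w
  punchIn-g {w} t≢w with target ≟ w
  ... | yes t≡w = contradiction t≡w t≢w
  ... | no t≢w′ = Fin.punchIn-punchOut t≢w′

  g-merges : g source ≡ g target
  g-merges = Fin.punchIn-injective target _ _ (trans (punchIn-g (s≢t ∘ sym)) (sym punchIn-g-target))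

  label-source : G′.label (g source) ≡ N
  label-source with source ≟ punchIn target (g source)
  ... | yes _ = refl
  ... | no ≢  = contradiction (sym (punchIn-g (s≢t ∘ sym))) ≢

  label-target : G′.label (g target) ≡ N
  label-target = trans (cong G′.label (sym g-merges)) label-source

  label-other : ∀ {w} → source ≢ w → target ≢ w → G′.label (g w) ≡ label w
  label-other {w} s≢w t≢w with source ≟ punchIn target (g w)
  ... | yes s≡ = contradiction (trans s≡ (punchIn-g t≢w)) s≢w
  ... | no _   = cong label (punchIn-g t≢w)

  data Vertex : Fin (suc (suc m)) → Set where
    is-source : Vertex source
    is-target : Vertex target
    is-other  : ∀ {w} → source ≢ w → target ≢ w → Vertex w

  vertex : ∀ w → Vertex w
  vertex w with source ≟ w | target ≟ w
  ... | yes refl | _        = is-source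
  ... | no _     | yes refl = is-target
  ... | no s≢w   | no t≢w   = is-other s≢w t≢w

  ∈-merged : ∀ w {x} → x ∈ E (label w) → x ≢ p → x ∈ E (G′.label (g w))
  ∈-merged w {x} x∈ x≢p with vertex w
  ... | is-source = subst (λ L → x ∈ E L) (sym label-source) (∈E₁⇒∈E x∈ x≢p)
  ... | is-target = subst (λ L → x ∈ E L) (sym label-target) (∈E₂⇒∈E x∈ x≢p)
  ... | is-other s≢w t≢w = subst (λ L → x ∈ E L) (sym (label-other s≢w t≢w)) x∈

  sound′ : Sound G′ R
  sound′ = record
    { edge∉R         = λ c → edge∉R (punchIn d c)
    ; edge-injective = λ eq → Fin.punchIn-injective d _ _ (edge-injective eq)
    ; edge∈          = λ c → let (∈₁ , ∈₂) = edge∈ (punchIn d c)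
                                 ≢p = λ eq → Fin.punchInᵢ≢i d c (edge-injective eq)
                             in ∈-merged _ ∈₁ ≢p , ∈-merged _ ∈₂ ≢p
    }

  module _ {e : Fin n} (e∈R : e ∈ R) (μ : Marking G′ e)
           (μ∈ : ∀ w → Marking.mark μ w ∈ E (G′.label w)) where

    open Marking μ renaming (mark to mark′; mark-at to mark-at′; mark-edge to mark-edge′)

    mark⁺ : Fin (suc (suc m)) → Fin n
    mark⁺ w = project (label w) p (mark′ (g w))

    module _ {c} (c≢d : c ≢ d) {w} (c∈ : edge c ∈ E (label w)) where

      keeps : mark′ (g w) ≡ edge c → mark⁺ w ≡ edge c
      keeps eq = trans (project-in (label w) (subst (_∈ E (label w)) (sym eq) c∈)) eq

      -- The mark either stays as it was or becomes `p`, and `p` belongs to another edge.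
      reflects : mark′ (g w) ≢ edge c → mark⁺ w ≢ edge c
      reflects neq with mark′ (g w) ∈? E (label w)
      ... | yes _ = neq
      ... | no  _ = λ eq → c≢d (sym (edge-injective eq))

    -- The mark of the merged vertex is an element of the 2-sum, so it lies on exactly one side and
    -- differs from `p`. That side keeps it, and the other side is marked with `p`.
    mark-edge-d : (mark⁺ source ≡ p × mark⁺ target ≢ p) ⊎ (mark⁺ source ≢ p × mark⁺ target ≡ p)
    mark-edge-d with ∈E⁻ (subst (λ L → mark′ (g source) ∈ E L) label-source (μ∈ (g source)))
    ... | inj₁ x∈₁ , x≢p = inj₂
      ( (λ eq → x≢p (trans (sym (project-in (label source) x∈₁)) eq))
      , project-out (label target) λ x∈₂ → x≢p (common x∈₁ (subst (_∈ E (label target)) (cong mark′ (sym g-merges)) x∈₂)) )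
    ... | inj₂ x∈₂ , x≢p = inj₁
      ( project-out (label source) (λ x∈₁ → x≢p (common x∈₁ x∈₂))
      , λ eq → x≢p (trans (cong mark′ g-merges)
          (trans (sym (project-in (label target) (subst (_∈ E (label target)) (cong mark′ g-merges) x∈₂))) eq)) )

    mark-edge⁺ : ∀ c → (mark⁺ (proj₁ (ends c)) ≡ edge c × mark⁺ (proj₂ (ends c)) ≢ edge c) ⊎
                       (mark⁺ (proj₁ (ends c)) ≢ edge c × mark⁺ (proj₂ (ends c)) ≡ edge c)
    mark-edge⁺ c with d ≟ c
    ... | yes refl = mark-edge-d
    ... | no  d≢c  = lift (subst Condition (Fin.punchIn-punchOut d≢c) (mark-edge′ (punchOut d≢c)))
      where
      Condition : Fin (suc m) → Set
      Condition c = (mark′ (g (proj₁ (ends c))) ≡ edge c × mark′ (g (proj₂ (ends c))) ≢ edge c) ⊎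
                    (mark′ (g (proj₁ (ends c))) ≢ edge c × mark′ (g (proj₂ (ends c))) ≡ edge c)
      lift : Condition c → _
      lift (inj₁ (eq , neq)) = inj₁ (keeps (d≢c ∘ sym) (proj₁ (edge∈ c)) eq , reflects (d≢c ∘ sym) (proj₂ (edge∈ c)) neq)
      lift (inj₂ (neq , eq)) = inj₂ (reflects (d≢c ∘ sym) (proj₁ (edge∈ c)) neq , keeps (d≢c ∘ sym) (proj₂ (edge∈ c)) eq)

    marking : Marking G e
    marking = record
      { mark      = mark⁺
      ; mark-at   = λ {w} e∈ →
          let eq = mark-at′ (∈-merged w e∈ λ { refl → edge∉R d e∈R })
          in trans (project-in (label w) (subst (_∈ E (label w)) (sym eq) e∈)) eq
      ; mark-edge = mark-edge⁺
      }

  markedTree : ∀ {e f} → e ∈ R → f ∈ R → MarkedTree G′ R e f → MarkedTree G R e f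
  markedTree e∈R f∈R mt = record
    { toward-e = marking e∈R toward-e a∈
    ; toward-f = marking f∈R toward-f b∈
    ; marked   = expanded
    }
    where
    open MarkedTree mt
    a b : Fin (suc m) → Fin n
    a = Marking.mark toward-e
    b = Marking.mark toward-f
    relabel : ∀ w {L} → G′.label w ≡ L → Marked R L (a w) (b w)
    relabel w refl = marked w
    a∈ : ∀ w → Marking.mark toward-e w ∈ E (G′.label w)
    a∈ w = Marked.a∈E (marked w)
    b∈ : ∀ w → Marking.mark toward-f w ∈ E (G′.label w)
    b∈ w = Marked.b∈E (marked w)
    expanded : ∀ w → Marked R (label w) (mark⁺ e∈R toward-e a∈ w) (mark⁺ f∈R toward-f b∈ w)
    expanded w with vertex w
    ... | is-source = twoSum-marked S (edge∉R d) (relabel (g source) label-source)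
    ... | is-target = twoSum-marked (twoSum-sym S) (edge∉R d) (relabel (g target) label-target)
    ... | is-other s≢w t≢w =
      let same = label-other s≢w t≢w in
      subst₂ (Marked R (label w))
        (sym (project-in (label w) (subst (λ L → a (g w) ∈ E L) same (a∈ (g w)))))
        (sym (project-in (label w) (subst (λ L → b (g w) ∈ E L) same (b∈ (g w)))))
        (relabel (g w) same)

-- Soundness is passed on to each contracted graph; the marks, which are `e` and `f` at the single
-- final vertex, are carried back.
contractsTo⇒markedTree : ∀ {n m} {G : LabelledGraph n m} {M R e f} → ContractsTo G M → Sound G R →
  e ∈ R → f ∈ R → Marked R M e f → MarkedTree G R e f
contractsTo⇒markedTree (done label≐M) sound e∈R f∈R m = record
  { toward-e = record { mark = λ _ → _ ; mark-at = λ _ → refl ; mark-edge = λ () }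
  ; toward-f = record { mark = λ _ → _ ; mark-at = λ _ → refl ; mark-edge = λ () }
  ; marked   = λ { zero → marked-≐ label≐M m }
  }
contractsTo⇒markedTree (step {T = G} d s≢t S contracts) sound e∈R f∈R m =
  markedTree e∈R f∈R (contractsTo⇒markedTree contracts sound′ e∈R f∈R m)
  where open Expand G d s≢t S sound

-- The tree is a path

module TreeProperties {n} {M : Matroid n} (T : TreeDecomposition M) where

  open TreeDecomposition T
  open IsTree isTree

  joins-ends : ∀ {c u v x y} → Joins c u v → Joins c x y → (x ≡ u × y ≡ v) ⊎ (x ≡ v × y ≡ u)
  joins-ends (inj₁ refl) (inj₁ refl) = inj₁ (refl , refl)
  joins-ends (inj₁ refl) (inj₂ refl) = inj₂ (refl , refl)
  joins-ends (inj₂ refl) (inj₁ refl) = inj₂ (refl , refl)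
  joins-ends (inj₂ refl) (inj₂ refl) = inj₁ (refl , refl)

  joins-sym : ∀ {c u v} → Joins c u v → Joins c v u
  joins-sym = [ inj₂ , inj₁ ]′

  joins⇒≢ : ∀ {c u v} → Joins c u v → u ≢ v
  joins⇒≢ j refl = acyclic (go _ j stop) (s≤s z≤n , [] ∷ [] , [] ∷ [])

  no-parallel : ∀ {c d u v} → Joins c u v → Joins d u v → c ≡ d
  no-parallel {c} {d} j k = decidable-stable (c ≟ d) λ c≢d →
    acyclic (go c j (go d (joins-sym k) stop))
      (s≤s z≤n , (c≢d ∷ []) ∷ [] ∷ [] , (joins⇒≢ j ∷ []) ∷ [] ∷ [])

  no-triangle : ∀ {c d e u v w} → Joins c u v → Joins d v w → Joins e w u → False
  no-triangle {c} {d} {e} {u} {v} {w} j k l = acyclic (go c j (go d k (go e l stop)))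
    ( s≤s z≤n
    , (c≢d ∷ c≢e ∷ []) ∷ (d≢e ∷ []) ∷ [] ∷ []
    , (joins⇒≢ j ∷ joins⇒≢ (joins-sym l) ∷ []) ∷ (joins⇒≢ k ∷ []) ∷ [] ∷ [] )
    where
    c≢d : c ≢ d
    c≢d refl = [ joins⇒≢ j ∘ sym ∘ proj₁ , joins⇒≢ (joins-sym l) ∘ sym ∘ proj₂ ]′ (joins-ends j k)
    c≢e : c ≢ e
    c≢e refl = [ joins⇒≢ (joins-sym l) ∘ sym ∘ proj₁ , joins⇒≢ (joins-sym k) ∘ proj₁ ]′ (joins-ends j l)
    d≢e : d ≢ e
    d≢e refl = [ joins⇒≢ k ∘ sym ∘ proj₁ , joins⇒≢ j ∘ proj₂ ]′ (joins-ends k l)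

  joins? : ∀ c u v → Dec (Joins c u v)
  joins? c u v = ×-≡-dec _≟_ _≟_ (ends c) (u , v) ⊎-dec ×-≡-dec _≟_ _≟_ (ends c) (v , u)

  shared⇒joins : ∀ {u v x} → x ∈ E (label u) → x ∈ E (label v) → u ≢ v → ∃[ c ] Joins c u v × x ≡ edge c
  shared⇒joins {u} {v} {x} x∈u x∈v u≢v with any? (λ c → joins? c u v)
  ... | yes (c , j) = c , j , x∈⁅y⁆⇒x≡y (edge c) (subst (x ∈_) (joined c u v j) (x∈p∩q⁺ (x∈u , x∈v)))
  ... | no none     = contradiction (x , x∈p∩q⁺ (x∈u , x∈v)) (unjoined u v u≢v none)

  edge∈ : ∀ {c u v} → Joins c u v → edge c ∈ E (label u) × edge c ∈ E (label v)
  edge∈ {c} {u} {v} j = x∈p∩q⁻ (E (label u)) (E (label v)) (subst (edge c ∈_) (sym (joined c u v j)) (x∈⁅x⁆ (edge c)))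

  -- A third label containing the element would be adjacent to both ends and close a triangle.
  incident : ∀ {c u v w} → Joins c u v → edge c ∈ E (label w) → w ≡ u ⊎ w ≡ v
  incident {c} {u} {v} {w} j x∈w with w ≟ u | w ≟ v
  ... | yes w≡u | _       = inj₁ w≡u
  ... | no _    | yes w≡v = inj₂ w≡v
  ... | no w≢u  | no w≢v  =
    let (_ , k , _) = shared⇒joins (proj₂ (edge∈ j)) x∈w (w≢v ∘ sym)
        (_ , l , _) = shared⇒joins x∈w (proj₁ (edge∈ j)) w≢u
    in ⊥-elim (no-triangle j k l)

  -- By `incident` both ends of `d` are ends of `c`, and a tree has no parallel edges.
  edge-injective : ∀ {c d} → edge c ≡ edge d → c ≡ d
  edge-injective {c} {d} eq with edge∈ {d} (inj₁ refl)
  ... | ∈₁ , ∈₂ with incident {c} (inj₁ refl) (subst (_∈ _) (sym eq) ∈₁) | incident {c} (inj₁ refl) (subst (_∈ _) (sym eq) ∈₂)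
  ...   | inj₁ u≡ | inj₁ v≡ = contradiction (trans u≡ (sym v≡)) (joins⇒≢ (inj₁ refl))
  ...   | inj₁ u≡ | inj₂ v≡ = no-parallel (inj₁ refl) (inj₁ (cong₂ _,_ u≡ v≡))
  ...   | inj₂ u≡ | inj₁ v≡ = no-parallel (inj₁ refl) (inj₂ (cong₂ _,_ u≡ v≡))
  ...   | inj₂ u≡ | inj₂ v≡ = contradiction (trans u≡ (sym v≡)) (joins⇒≢ (inj₁ refl))

  edge∉E : ∀ c → edge c ∉ E M
  edge∉E c c∈ = proj₂ (⇒ (ground (edge c)) c∈) c refl

  virtual⇒edge : ∀ {v x} → x ∈ E (label v) → x ∉ E M → ∃[ c ] x ≡ edge c
  virtual⇒edge {v} {x} x∈ x∉ with any? (λ c → x ≟ edge c)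
  ... | yes found = found
  ... | no  none  = contradiction (⇐ (ground x) ((v , x∈) , λ c eq → none (c , eq))) x∉

  sound : Sound graph (E M)
  sound = record { edge∉R = edge∉E ; edge-injective = edge-injective ; edge∈ = λ c → edge∈ (inj₁ refl) }

module PathStructure {n} {M : Matroid n} (T : TreeDecomposition M) (canonical : IsCanonical T)
    {e f : Fin n} (e∈E : e ∈ E M) (mt : MarkedTree (TreeDecomposition.graph T) (E M) e f)
    (3≤ : ∀ v → 3 ≤ ∣ E (TreeDecomposition.label T v) ∣) where

  open TreeDecomposition T
  open IsTree isTree
  open IsCanonical canonical
  open TreeProperties T
  open MarkedTree mt

  Vertex : Set
  Vertex = Fin (suc m)

  a b : Vertex → Fin n
  a = Marking.mark toward-e
  b = Marking.mark toward-f

  kind : ∀ v → Kind (E M) (label v) (a v) (b v)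
  kind v = classify (marked v) (labelConnected v) (3≤ v) (labels v)

  kind-circuit : ∀ v → ¬ OnPath (E M) (label v) (a v) (b v) → IsCircuit (label v)
  kind-circuit v ¬onPath =
    [ (λ { (k , 3≤k , iso) → k , ℕ.≤-trans (s≤s z≤n) 3≤k , iso }) , (λ { (onPath , _) → contradiction onPath ¬onPath }) ]′ (kind v)

  -- c leads from u towards f and from v towards e.
  Next : Fin m → Vertex → Vertex → Set
  Next c u v = Joins c u v × b u ≡ edge c × a v ≡ edge c

  -- Suppose `e` and `f` lie on the same side of `c`. At the far end both marks are the element of
  -- `c`, so they coincide; at the near end this element is virtual but not a mark. Neither end is
  -- `OnPath`, so both are circuits.
  orient : ∀ c → Next c (proj₁ (ends c)) (proj₂ (ends c)) ⊎ Next c (proj₂ (ends c)) (proj₁ (ends c))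
  orient c with Marking.mark-edge toward-e c | Marking.mark-edge toward-f c
  ... | inj₁ (au , _)   | inj₂ (_ , bv)   = inj₂ (inj₂ refl , bv , au)
  ... | inj₂ (_ , av)   | inj₁ (bu , _)   = inj₁ (inj₁ refl , bu , av)
  ... | inj₁ (au , av≢) | inj₁ (bu , bv≢) = contradiction
    (kind-circuit _ (λ { (a≢b , _) → a≢b (trans au (sym bu)) })
    , kind-circuit _ (λ { (_ , end) → [ av≢ ∘ sym , bv≢ ∘ sym ]′ (end (proj₂ (edge∈ (inj₁ refl))) (edge∉E c)) }))
    (noCircuits _ _ (c , inj₁ refl))
  ... | inj₂ (au≢ , av) | inj₂ (bu≢ , bv) = contradiction
    (kind-circuit _ (λ { (_ , end) → [ au≢ ∘ sym , bu≢ ∘ sym ]′ (end (proj₁ (edge∈ (inj₁ refl))) (edge∉E c)) })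
    , kind-circuit _ (λ { (a≢b , _) → a≢b (trans av (sym bv)) }))
    (noCircuits _ _ (c , inj₁ refl))

  next-or-previous : ∀ {c u v} → Joins c u v → Next c u v ⊎ Next c v u
  next-or-previous {c} (inj₁ refl) = orient c
  next-or-previous {c} (inj₂ refl) = [ inj₂ , inj₁ ]′ (orient c)

  next-unique : ∀ {c c′ u v v′} → Next c u v → Next c′ u v′ → v ≡ v′
  next-unique (j , bu , _) (j′ , bu′ , _) with refl ← edge-injective (trans (sym bu) bu′) =
    [ sym ∘ proj₂ , (λ { (u≡v , v′≡u) → sym (trans v′≡u u≡v) }) ]′ (joins-ends j j′)

  previous-unique : ∀ {c c′ u u′ v} → Next c u v → Next c′ u′ v → u ≡ u′
  previous-unique (j , _ , av) (j′ , _ , av′) with refl ← edge-injective (trans (sym av) av′) =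
    [ sym ∘ proj₁ , (λ { (u′≡v , v≡u) → sym (trans u′≡v v≡u) }) ]′ (joins-ends j j′)

  first : Vertex
  first = proj₁ (proj₁ (⇒ (ground e) e∈E))

  a-first : a first ≡ e
  a-first = Marking.mark-at toward-e (proj₂ (proj₁ (⇒ (ground e) e∈E)))

  no-previous : ∀ {c u} → ¬ Next c u first
  no-previous {c} (_ , _ , av) = edge∉E c (subst (_∈ E M) (trans (sym a-first) av) e∈E)

  -- The position counted from `first`, kept as a relation because it is not known beforehand which
  -- vertices are reached or where the path stops.
  data At : ℕ → Vertex → Set where
    at-first : At 0 first
    at-next  : ∀ {k c u v} → At k u → Next c u v → At (suc k) v

  at-unique : ∀ {k u v} → At k u → At k v → u ≡ v
  at-unique at-first         at-first            = refl
  at-unique (at-next at-u nx) (at-next at-u′ nx′) with refl ← at-unique at-u at-u′ = next-unique nx nx′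

  at-injective : ∀ {j k v} → At j v → At k v → j ≡ k
  at-injective at-first         at-first          = refl
  at-injective at-first         (at-next _ nx)    = contradiction nx no-previous
  at-injective (at-next _ nx)   at-first          = contradiction nx no-previous
  at-injective (at-next at-u nx) (at-next at-u′ nx′) with refl ← previous-unique nx nx′ =
    cong suc (at-injective at-u at-u′)

  -- Each edge of the walk leads one position forward or one back, and since predecessors are
  -- unique, a step back returns to a vertex already placed.
  reach : ∀ {k u v} → At k u → Walk u v → ∃[ j ] At j v
  reach at-u stop = _ , at-u
  reach at-u (go c j walk) with next-or-previous j
  ... | inj₁ nx = reach (at-next at-u nx) walk
  ... | inj₂ nx with at-u
  ...   | at-first         = contradiction nx no-previous
  ...   | at-next at-u′ nx′ with refl ← previous-unique nx nx′ = reach at-u′ walk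

  at-prefix : ∀ {k v i} → At k v → i ≤ k → ∃[ u ] At i u
  at-prefix at-first z≤n = first , at-first
  at-prefix {v = v} at-v@(at-next at-u _) i≤ with ℕ.m≤n⇒m<n∨m≡n i≤
  ... | inj₁ i<   = at-prefix at-u (s≤s⁻¹ i<)
  ... | inj₂ refl = v , at-v

  -- The positions up to `k` are all occupied, by pairwise distinct vertices.
  at-bounded : ∀ {k v} → At k v → k < suc m
  at-bounded {k} at-v = Fin.injective⇒≤ {f = proj₁ ∘ visited} λ {i} {j} eq →
    Fin.toℕ-injective (at-injective (proj₂ (visited i)) (subst (At (toℕ j)) (sym eq) (proj₂ (visited j))))
    where
    visited : ∀ (i : Fin (suc k)) → ∃[ u ] At (toℕ i) u
    visited i = at-prefix at-v (Fin.toℕ≤pred[n] i)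

  successive⇒adjacent : ∀ {k u v} → At k u → At (suc k) v → Adjacent u v
  successive⇒adjacent at-u (at-next {c = c} at-u′ nx) with refl ← at-unique at-u at-u′ = c , proj₁ nx

  opaque
    position : Vertex → Fin (suc m)
    position v = fromℕ< (at-bounded (proj₂ (reach at-first (connected first v))))

    at-position : ∀ v → At (toℕ (position v)) v
    at-position v = let (k , at-v) = reach at-first (connected first v) in
      subst (λ k → At k v) (sym (Fin.toℕ-fromℕ< (at-bounded at-v))) at-v

    position-injective : ∀ {u v} → position u ≡ position v → u ≡ v
    position-injective {u} {v} eq = at-unique (at-position u) (subst (λ i → At (toℕ i) v) (sym eq) (at-position v))

    position-surjective : ∀ i → ∃[ v ] position v ≡ i
    position-surjective i with any? (λ v → position v ≟ i)
    ... | yes found = found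
    ... | no  none  = contradiction
      (Fin.injective⇒≤ {f = λ v → punchOut (i≢ v)} λ {u} {v} eq → position-injective (Fin.punchOut-injective (i≢ u) (i≢ v) eq))
      (ℕ.<⇒≱ (ℕ.n<1+n m))
      where
      i≢ : ∀ v → i ≢ position v
      i≢ v eq = none (v , sym eq)

  vertexAt : Fin (suc m) → Vertex
  vertexAt i = proj₁ (position-surjective i)

  at-vertexAt : ∀ i → At (toℕ i) (vertexAt i)
  at-vertexAt i = let (v , eq) = position-surjective i in subst (λ i → At (toℕ i) v) eq (at-position v)

  path : IsPath
  path = record
    { order = permutation vertexAt position
        (λ v → position-injective (proj₂ (position-surjective (position v))))
        (λ i → proj₂ (position-surjective i))
    ; consecutive = λ i j → mk⇔
        (λ { (c , join) → case next-or-previous join of λ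
          { (inj₁ nx) → inj₁ (at-injective (at-vertexAt j) (at-next (at-vertexAt i) nx))
          ; (inj₂ nx) → inj₂ (at-injective (at-vertexAt i) (at-next (at-vertexAt j) nx)) } })
        [ (λ eq → adjacent i j eq) , (λ eq → let (c , join) = adjacent j i eq in c , joins-sym join) ]′
    }
    where
    adjacent : ∀ i j → toℕ j ≡ suc (toℕ i) → Adjacent (vertexAt i) (vertexAt j)
    adjacent i j eq = successive⇒adjacent (at-vertexAt i) (subst (λ k → At k (vertexAt j)) eq (at-vertexAt j))

  first⇒real : ∀ {v} → At 0 v → a v ∈ E M
  first⇒real at-first = subst (_∈ E M) (sym a-first) e∈E

  -- A virtual `b v` would be an edge at `v`. Followed forwards it leads to a position beyond the
  -- last; followed backwards it is also `a v`.
  last⇒real : ∀ {v} → At m v → a v ≢ b v → b v ∈ E M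
  last⇒real {v} at-last a≢b = decidable-stable (b v ∈? E M) λ b∉E →
    let (c , b≡) = virtual⇒edge (Marked.b∈E (marked v)) b∉E in
    case incident {c} (inj₁ refl) (subst (_∈ E (label v)) b≡ (Marked.b∈E (marked v))) of λ
      { (inj₁ eq) → beyond b≡ (subst (λ u → Joins c u (proj₂ (ends c))) (sym eq) (inj₁ refl))
      ; (inj₂ eq) → beyond b≡ (subst (λ u → Joins c u (proj₁ (ends c))) (sym eq) (inj₂ refl)) }
    where
    beyond : ∀ {c w} → b v ≡ edge c → Joins c v w → False
    beyond b≡ j = [ (λ nx → ℕ.<-irrefl refl (at-bounded (at-next at-last nx)))
                  , (λ { (_ , _ , a≡) → a≢b (trans a≡ (sym b≡)) }) ]′ (next-or-previous j)

  end≢U₁₃ : ∀ v → IsPath.End path v → ¬ label v ≅ U 1 3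
  end≢U₁₃ v end iso =
    let ((a≢b , _) , _ , a∉E , b∉E) = cocircuit-onPath (marked v) (3≤ v) iso in
    [ (λ eq → a∉E (first⇒real (subst (At 0) (sym eq) (at-vertexAt zero))))
    , (λ eq → b∉E (last⇒real (subst₂ At (Fin.toℕ-fromℕ m) (sym eq) (at-vertexAt (fromℕ m))) a≢b)) ]′ end

-- A circuit through `e` and `f` has a third element, since `M` has no parallel pairs. This makes
-- the size condition `large` of the tree decomposition available.
simple⇒3≤ : ∀ (M : Matroid n) {e f} → Simple M → Connected M → e ∈ E M → f ∈ E M → e ≢ f → 3 ≤ ∣ E M ∣
simple⇒3≤ M {e} {f} (_ , no-pair) conn e∈E f∈E e≢f with conn e f e∈E f∈E e≢f
... | C , circ , e∈C , f∈C with any? (λ z → (z ∈? C) ×-dec ¬? (z ∈? ⁅ e ⁆ ∪ ⁅ f ⁆))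
...   | yes (z , z∈C , z∉) = ℕ.≤-<-trans
  (two≤ (x∈p∧x≢y⇒x∈p-y e∈E λ { refl → z∉ ∈-pairˡ }) (x∈p∧x≢y⇒x∈p-y f∈E λ { refl → z∉ (∈-∪⁅⁆ f) }) e≢f)
  (x∈p⇒∣p-x∣<∣p∣ (proj₁ circ z∈C))
...   | no none = contradiction
  (subst (Circuit M) (⊆-antisym
    (λ {z} z∈ → decidable-stable (z ∈? ⁅ e ⁆ ∪ ⁅ f ⁆) λ z∉ → none (z , z∈ , z∉))
    (λ z∈ → case ∈-pair⁻ z∈ of λ { (inj₁ refl) → e∈C ; (inj₂ refl) → f∈C })) circ)
  (no-pair e f e≢f)

theorem1p2 : ∀ {n} (M : Matroid n) → Simple M → Connected M → Binary M →
    ∀ (e f : Fin n) → e ∈ E M → f ∈ E M → e ≢ f →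
    (∀ C → Circuit M C → e ∈ C → f ∈ C → Spanning M C) →
    (T : TreeDecomposition M) → IsCanonical T →
    let open TreeDecomposition T in
    Σ IsPath λ P →
    (∀ v → (∃[ k ] 3 ≤ k × CircuitOfSize k (label v)) ⊎ label v ≅ U 1 3 ⊎ IsSpikeMinusY (label v)) ×
    (∀ v → IsPath.End P v → ¬ (label v ≅ U 1 3))
theorem1p2 M simple conn binary e f e∈E f∈E e≢f spanning T canonical =
    path
  , (λ v → [ inj₁ , (λ { (_ , shape) → inj₂ shape }) ]′ (kind v))
  , end≢U₁₃
  where
  mt : MarkedTree (TreeDecomposition.graph T) (E M) e f
  mt = contractsTo⇒markedTree (TreeDecomposition.contracts T) (TreeProperties.sound T) e∈E f∈E
         (spanning⇒marked M simple binary e∈E f∈E spanning)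
  open PathStructure T canonical e∈E mt
    (TreeDecomposition.large T (simple⇒3≤ M simple conn e∈E f∈E e≢f))
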